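{- If $H$ is a left pseudogalaxy or a $C_5$-co-chain, then $H$ satisfies the Erdős–Hajnal Conjecture: there exists $\epsilon(H)>0$ such that every tournament $T$ not containing $H$ as a subtournament contains a transitive subtournament on at least $|T|^{\epsilon(H)}$ vertices.
   Context: Tournaments are finite; subtournament = induced subtournament; transitive = no directed cycle. The complement of a tournament is obtained by reversing all edges. Given an ordering of the vertex set, an edge $(x,y)$ is backward if $y$ precedes $x$; a tournament on an ordered vertex set is determined by its backward edges. For an ordering $\theta=(v_1,\dots,v_n)$ of $V(T)$, $B(T,\theta)$ is the undirected graph on $V(T)$ whose edges are the pairs joined by backward edges. A right (resp. left) star is an induced subgraph of $B(T,\theta)$ that is a star $K_{1,t}$ whose center is the last (resp. first) of its vertices in $\theta$ (for $t=1$ either vertex may be the center). $T$ is a galaxy if for some ordering $\theta$ (a galaxy ordering) every component of $B(T,\theta)$ is a left star, a right star or a singleton, and no center of a star lies between two leaves of another star; non-singleton components are the stars. Product: for tournaments $H_1,H_2$ with disjoint vertex sets and injective $f_1,f_2$ into $\mathbb{N}$ with disjoint images, with $\theta_i$ ordering $V(H_i)$ by increasing $f_i$ and $\theta$ ordering $V(H_1)\cup V(H_2)$ by the combined values, $H_1^{f_1}\oplus H_2^{f_2}$ is the tournament on $V(H_1)\cup V(H_2)$ whose backward edges under $\theta$ are exactly those of $H_1$ under $\theta_1$ and of $H_2$ under $\theta_2$. Right pseudogalaxy: $H_l$ on $h_1,\dots,h_7$ with backward edges under $(h_1,\dots,h_7)$ exactly $(h_4,h_1),(h_6,h_2),(h_6,h_1),(h_5,h_3),(h_7,h_5)$;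 $G$ a galaxy with galaxy ordering $(g_1,\dots,g_r)$, $1\le s\le r$ such that no star of $G$ has one leaf in $\{g_1,\dots,g_s\}$ and another in $\{g_{s+1},\dots,g_r\}$; $\rho_1(h_i)=i$ ($i\le6$), $\rho_1(h_7)=7+s$; $\rho_2(g_u)=6+u$ ($u\le s$), $\rho_2(g_u)=7+u$ ($u>s$); then $H_l^{\rho_1}\oplus G^{\rho_2}$ is a right pseudogalaxy. A left pseudogalaxy is the complement of a right pseudogalaxy. $C_5$-chain: $H_l'$ on $h_1,\dots,h_6$ with backward edges under $(h_1,\dots,h_6)$ exactly $(h_4,h_1),(h_5,h_2),(h_5,h_1),(h_6,h_3)$, $\rho_1'(h_i)=i$ ($i\le5$), $\rho_1'(h_6)=7$; for an integer $t\ge0$, $P_{2t+1}$ on $p_1,\dots,p_{2t+1}$ with backward edges under $(p_1,\dots,p_{2t+1})$ exactly $(p_{2i},p_{2i-1})$, $1\le i\le t$, $\rho_2'(p_{2i+1})=2i+6$, $\rho_2'(p_{2i})=2i+7$; a $C_5$-chain is $H_l'^{\rho_1'}\oplus P_{2t+1}^{\rho_2'}$. A $C_5$-co-chain is the complement of a $C_5$-chain. -}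

module Defs where

open import Data.Nat using (ℕ; zero; suc; _+_; _*_; _∸_; _^_; _≤_; _<_; _<ᵇ_; _≡ᵇ_; s≤s)
open import Data.Nat.Properties using (_<?_)
open import Data.Bool using (Bool; true; false; not; if_then_else_)
open import Data.Fin using (Fin; toℕ; fromℕ<)
open import Data.Product using (Σ; Σ-syntax; _×_; _,_; ∃)
open import Data.Sum using (_⊎_)
open import Relation.Nullary using (¬_; yes; no)
open import Relation.Binary.PropositionalEquality using (_≡_; _≢_)
open import Function.Definitions using (Injective)

record Digraph : Set where
  field
    size : ℕ
    arc  : Fin size → Fin size → Bool
open Digraph public

IsTournament : Digraph → Set
IsTournament D =
  (∀ i → arc D i i ≡ false) ×
  (∀ i j → i ≢ j → arc D i j ≡ not (arc D j i))

complement : Digraph → Digraph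
complement D = record { size = size D ; arc = λ i j → arc D j i }

induced : (D : Digraph) {k : ℕ} → (Fin k → Fin (size D)) → Digraph
induced D {k} e = record { size = k ; arc = λ i j → arc D (e i) (e j) }

Contains : Digraph → Digraph → Set
Contains T H = Σ[ f ∈ (Fin (size H) → Fin (size T)) ]
  (Injective _≡_ _≡_ f × (∀ i j → arc H i j ≡ arc T (f i) (f j)))

Iso : Digraph → Digraph → Set
Iso H K = Σ[ f ∈ (Fin (size H) → Fin (size K)) ] Σ[ g ∈ (Fin (size K) → Fin (size H)) ]
  ((∀ x → g (f x) ≡ x) × (∀ y → f (g y) ≡ y) × (∀ i j → arc H i j ≡ arc K (f i) (f j)))

next : {k : ℕ} → Fin (suc k) → Fin (suc k)
next {k} i with toℕ i <? k
... | yes p = fromℕ< (s≤s p)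
... | no _  = Fin.zero

DirectedCycle : Digraph → Set
DirectedCycle D = Σ[ k ∈ ℕ ] Σ[ c ∈ (Fin (suc k) → Fin (size D)) ]
  (Injective _≡_ _≡_ c × (∀ i → arc D (c i) (c (next i)) ≡ true))

Transitive : Digraph → Set
Transitive D = ¬ DirectedCycle D

-- Tournaments on ordered vertex sets {0,…,n-1} given by backward edges.
-- For a < b, back a b ≡ true means the edge between a and b is b → a.

ordArc : (ℕ → ℕ → Bool) → ℕ → ℕ → Bool
ordArc back a b =
  if a <ᵇ b then not (back a b) else (if b <ᵇ a then back b a else false)

arcℕ : (D : Digraph) → ℕ → ℕ → Bool
arcℕ D a b with a <? size D | b <? size D
... | yes p | yes q = arc D (fromℕ< p) (fromℕ< q)
... | _     | _     = false

-- positions of the product labelled by the factor they come from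
data Lab : Set where
  L R : ℕ → Lab

-- product H1^{f1} ⊕ H2^{f2}, with vertices the positions 0,…,n-1 of the
-- combined ordering θ; lab p says which vertex (of which factor, given by its
-- index in that factor's own vertex numbering) sits at position p.
-- Edges inside a factor are those of the factor; edges between factors are forward.
product : (n : ℕ) → (ℕ → ℕ → Bool) → (ℕ → ℕ → Bool) → (ℕ → Lab) → Digraph
product n a1 a2 lab = record { size = n ; arc = λ i j → go (lab (toℕ i)) (lab (toℕ j)) (toℕ i) (toℕ j) }
  where
  go : Lab → Lab → ℕ → ℕ → Bool
  go (L x) (L y) _ _ = a1 x y
  go (R x) (R y) _ _ = a2 x y
  go _     _     p q = p <ᵇ q

-- Galaxies (with galaxy ordering the natural order of Fin r)

-- pairs joined by a backward edge: the graph B(G, natural order)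
BE : (G : Digraph) → Fin (size G) → Fin (size G) → Set
BE G u v = (toℕ u < toℕ v × arc G v u ≡ true) ⊎ (toℕ v < toℕ u × arc G u v ≡ true)

-- ctr u is the chosen center of the component of u (u itself for singletons
-- and centers).  A leaf is a vertex different from its center; a center of a
-- star is a vertex c with ctr c ≡ c having at least one leaf.
module _ (G : Digraph) (ctr : Fin (size G) → Fin (size G)) where
  IsLeaf : Fin (size G) → Set
  IsLeaf u = u ≢ ctr u

  IsStarCenter : Fin (size G) → Set
  IsStarCenter c = ctr c ≡ c × (Σ[ u ∈ Fin (size G) ] (u ≢ c × ctr u ≡ c))

  record StarStructure : Set where
    field
      -- every component is a star (induced K_{1,t}) or a singleton
      ctr-idem  : ∀ u → ctr (ctr u) ≡ ctr u
      edge-same : ∀ u v → BE G u v → ctr u ≡ ctr v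
      edge-ctr  : ∀ u v → BE G u v → (u ≡ ctr u) ⊎ (v ≡ ctr v)
      leaf-adj  : ∀ u → IsLeaf u → BE G u (ctr u)
      -- each star is a right star (center last) or a left star (center first)
      side      : ∀ c → (∀ u → ctr u ≡ c → toℕ u ≤ toℕ c)
                      ⊎ (∀ u → ctr u ≡ c → toℕ c ≤ toℕ u)
      noncross  : ∀ l l' c → IsLeaf l → IsLeaf l' → ctr l ≡ ctr l' →
                  IsStarCenter c → c ≢ ctr l →
                  ¬ (toℕ l < toℕ c × toℕ c < toℕ l')

IsGalaxyOrdered : Digraph → Set
IsGalaxyOrdered G = Σ[ ctr ∈ (Fin (size G) → Fin (size G)) ] StarStructure G ctr

-- H_l on h1..h7 (indices 0..6): backward edges (h4,h1),(h6,h2),(h6,h1),(h5,h3),(h7,h5)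
backHl : ℕ → ℕ → Bool
backHl 0 3 = true
backHl 1 5 = true
backHl 0 5 = true
backHl 2 4 = true
backHl 4 6 = true
backHl _ _ = false

-- position (0-indexed, i.e. ρ-value minus 1) ↦ vertex, for parameter s
labRPG : ℕ → ℕ → Lab
labRPG s p =
  if p <ᵇ 6 then L p
  else if p <ᵇ (6 + s) then R (p ∸ 6)
  else if p ≡ᵇ (6 + s) then L 6
  else R (p ∸ 7)

rightPseudogalaxy : (s : ℕ) (G : Digraph) → Digraph
rightPseudogalaxy s G = product (7 + size G) (ordArc backHl) (arcℕ G) (labRPG s)

SplitOK : (G : Digraph) → (Fin (size G) → Fin (size G)) → ℕ → Set
SplitOK G ctr s = ∀ l l' → IsLeaf G ctr l → IsLeaf G ctr l' → ctr l ≡ ctr l' →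
  ¬ (toℕ l < s × s ≤ toℕ l')

IsRightPseudogalaxy : Digraph → Set
IsRightPseudogalaxy H =
  Σ[ G ∈ Digraph ] Σ[ s ∈ ℕ ] Σ[ ctr ∈ (Fin (size G) → Fin (size G)) ]
    (IsTournament G × StarStructure G ctr × 1 ≤ s × s ≤ size G ×
     SplitOK G ctr s × Iso H (rightPseudogalaxy s G))

IsLeftPseudogalaxy : Digraph → Set
IsLeftPseudogalaxy H = IsRightPseudogalaxy (complement H)

-- H_l' on h1..h6 (indices 0..5): backward edges (h4,h1),(h5,h2),(h5,h1),(h6,h3)
backHl' : ℕ → ℕ → Bool
backHl' 0 3 = true
backHl' 1 4 = true
backHl' 0 4 = true
backHl' 2 5 = true
backHl' _ _ = false

-- P_{2t+1} on p1..p_{2t+1} (indices 0..2t): backward edges (p_{2i}, p_{2i-1}),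
-- i.e. for indices a < b: b odd and a ≡ b ∸ 1
isOdd : ℕ → Bool
isOdd zero = false
isOdd (suc n) = not (isOdd n)

backP : ℕ → ℕ → Bool
backP a b = if isOdd b then (a ≡ᵇ (b ∸ 1)) else false

-- positions (ρ-value minus 1): 0..4 ↦ h1..h5, 6 ↦ h6,
-- value 2i+6 ↦ p_{2i+1}, value 2i+7 ↦ p_{2i}
labC5 : ℕ → Lab
labC5 p =
  if p <ᵇ 5 then L p
  else if p ≡ᵇ 6 then L 5
  else if isOdd p then R (p ∸ 5)
  else R (p ∸ 7)

c5Chain : (t : ℕ) → Digraph
c5Chain t = product (7 + 2 * t) (ordArc backHl') (ordArc backP) labC5

IsC5CoChain : Digraph → Set
IsC5CoChain H = Σ[ t ∈ ℕ ] Iso H (complement (c5Chain t))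

{-# OPTIONS --safe #-}
module Submission where

-- Reversing all arcs, it suffices to treat right pseudogalaxies and C₅-chains D.  Suppose T is a minimal
-- counterexample for a small exponent 1/q.  Then no linear-size set is complete to another one, nor to (or
-- from) a transitive set of size proportional to the largest possible: so most vertices of a linear set have
-- a backward neighbour in any given long chain, and a star with its centre in a linear set and its leaves in
-- pieces of a chain can always be found.  A greedy embedding of D fails at a pair of sparse linear sets;
-- iterating yields a long sequence of linear sets and long chains that are almost complete from left to right,
-- in which the components of a backward graph can be placed one after another.
--
-- The backward graph of D has one path p – w – z – q, which is placed with w, z in linear sets and p, q in
-- one chain between them, and (for pseudogalaxies) one star with a leaf on either side of its centre.  Either
-- placement can fail only by exhibiting a backward transitive triangle in three different places of the
-- sequence.  But other orderings of D have such a triangle as a component, and stars otherwise, so a triangle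
-- also yields D.

-- What a small exponent buys: by minimality, a set of at least n/C vertices contains a chain longer
-- than d/(d+1) of the maximum `τ` as soon as C d ≤ q, since (1 + 1/d)^q ≥ 1 + q/d. Hence all
-- constants are carried along explicitly, and `q` is chosen at the end above one numerical bound,
-- `requirement`. The obstacle is that chains are sublinear: nothing forces an arc between two of
-- them. Arcs against the order are obtained only between a linear set and a chain or between two
-- linear sets. This is why the blocks alternate between the two kinds, with centres in linear sets
-- and leaves in chains. Leaves in one chain are joined correctly for free. Leaves in two different
-- chains, or an end of the path and the linear set at its other end, form an uncontrolled pair, and
-- a wrong arc there closes a backward triangle. Arcs between different components of the backward
-- graph need no such care. Smoothness holds for every single vertex and in both directions, so with
-- m vertices in the pattern each placed vertex spoils at most a 1/(2m) share of any other slot, and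
-- half of the slot survives all of them.

open import Defs
open import Data.Bool using (Bool; true; false; not; _∧_; _∨_; if_then_else_; T)
open import Data.Bool.ListAction using (all; any)
import Data.Bool.Properties as Bool
open import Data.Empty using (⊥; ⊥-elim)
open import Data.Fin using (Fin; toℕ; fromℕ<; #_) renaming (zero to fz; suc to fs)
import Data.Fin as F
open import Data.Fin.Properties using (toℕ<n; toℕ-injective; toℕ-fromℕ<; fromℕ<-toℕ; any?)
import Data.Fin.Properties as F
open import Data.List using (List; []; _∷_; length; filterᵇ; take; drop; map; _++_; tabulate; allFin)
import Data.List as List
open import Data.List.Membership.Propositional using (_∈_)
open import Data.List.Membership.Propositional.Properties using (∈-filter⁺; ∈-filter⁻; ∈-allFin; ∈-map⁺; ∈-map⁻; ∈-++⁺ˡ; ∈-++⁺ʳ; ∈-lookup; ∈-tabulate⁻)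
open import Data.List.Properties using (length-take; length-drop; length-++; length-map; length-tabulate; length-filter)
open import Data.List.Relation.Binary.Sublist.Propositional using (_⊆_; ⊆-trans; ⊆-refl; lookup; []; _∷_; _∷ʳ_)
open import Data.List.Relation.Binary.Sublist.Propositional.Properties using (filter-⊆; take-⊆; drop-⊆; length-mono-≤; All-resp-⊆)
open import Data.List.Relation.Unary.All as All using (All; []; _∷_)
open import Data.List.Relation.Unary.AllPairs using (AllPairs; []; _∷_)
import Data.List.Relation.Unary.AllPairs.Properties as AllPairs
open import Data.List.Relation.Unary.Any using (here; there)
open import Data.Nat
open import Data.Nat.DivMod using (_/_; _%_; m≡m%n+[m/n]*n; m%n<n; m/n*n≤m)
open import Data.Nat.Induction using (<-wellFounded)
open import Data.Nat.ListAction using (sum)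
open import Data.Nat.Properties
open import Data.Nat.Tactic.RingSolver using (solve-∀)
open import Data.Product using (_×_; _,_; ∃; Σ; Σ-syntax; proj₁; proj₂; map₂)
open import Data.Sum using (_⊎_; inj₁; inj₂)
open import Data.Unit using (⊤; tt)
open import Function using (_∘_; id)
open import Function.Definitions using (Injective)
open import Induction.WellFounded using (Acc; acc)
open import Relation.Binary.Definitions using (tri<; tri≈; tri>)
open import Relation.Binary.PropositionalEquality
open import Relation.Nullary using (¬_; Dec; yes; no; does)
open import Relation.Nullary.Decidable using (T?; ¬?; _×-dec_)

-- Counting in lists

≡true⇒T : ∀ {b} → b ≡ true → T b
≡true⇒T refl = _

T⇒≡true : ∀ {b} → T b → b ≡ true
T⇒≡true {true} _ = refl

∧-true⁻ : ∀ {b c} → b ∧ c ≡ true → b ≡ true × c ≡ true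
∧-true⁻ {true} {true} _ = refl , refl

≤ᵇ-true⇒≤ : ∀ {m n} → (m ≤ᵇ n) ≡ true → m ≤ n
≤ᵇ-true⇒≤ {m} {n} eq = ≤ᵇ⇒≤ m n (≡true⇒T eq)

≤ᵇ-false⇒> : ∀ {m n} → (m ≤ᵇ n) ≡ false → n < m
≤ᵇ-false⇒> {m} {n} eq = ≰⇒> λ m≤n → subst T eq (≤⇒≤ᵇ m≤n)

module _ {A : Set} where

  count : (A → Bool) → List A → ℕ
  count p xs = length (filterᵇ p xs)

  filterᵇ-⊆ : ∀ (p : A → Bool) xs → filterᵇ p xs ⊆ xs
  filterᵇ-⊆ p = filter-⊆ (T? ∘ p)

  ∈-filterᵇ⁻ : ∀ (p : A → Bool) {x} xs → x ∈ filterᵇ p xs → x ∈ xs × p x ≡ true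
  ∈-filterᵇ⁻ p xs x∈ = map₂ T⇒≡true (∈-filter⁻ (T? ∘ p) {xs = xs} x∈)

  count-mono-⊆ : ∀ (p : A → Bool) {xs ys} → xs ⊆ ys → count p xs ≤ count p ys
  count-mono-⊆ p {ys = ys} = go
    where
    go : ∀ {xs ys} → xs ⊆ ys → count p xs ≤ count p ys
    go [] = z≤n
    go (y ∷ʳ s) with p y
    ... | true = m≤n⇒m≤1+n (go s)
    ... | false = go s
    go (_∷_ {x = x} refl s) with p x
    ... | true = s≤s (go s)
    ... | false = go s

  count-mono : ∀ (p r : A → Bool) xs → (∀ {x} → x ∈ xs → p x ≡ true → r x ≡ true) →
               count p xs ≤ count r xs
  count-mono p r [] f = z≤n
  count-mono p r (x ∷ xs) f with p x in px | r x in rx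
  ... | true  | true  = s≤s (count-mono p r xs (f ∘ there))
  ... | false | true  = m≤n⇒m≤1+n (count-mono p r xs (f ∘ there))
  ... | false | false = count-mono p r xs (f ∘ there)
  ... | true  | false with () ← trans (sym rx) (f (here refl) px)

  count-strict : ∀ (p r : A → Bool) xs {z} → z ∈ xs → p z ≡ false → r z ≡ true →
                 (∀ {x} → p x ≡ true → r x ≡ true) → count p xs < count r xs
  count-strict p r (x ∷ xs) (here refl) pz rz f rewrite pz | rz = s≤s (count-mono p r xs λ _ → f)
  count-strict p r (x ∷ xs) (there z∈) pz rz f with p x in px | r x in rx
  ... | true  | true  = s≤s (count-strict p r xs z∈ pz rz f)
  ... | false | true  = m≤n⇒m≤1+n (count-strict p r xs z∈ pz rz f)
  ... | false | false = count-strict p r xs z∈ pz rz f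
  ... | true  | false with () ← trans (sym rx) (f px)

  count-none : ∀ (p : A → Bool) xs → (∀ {x} → x ∈ xs → p x ≡ false) → count p xs ≡ 0
  count-none p [] f = refl
  count-none p (x ∷ xs) f rewrite f (here refl) = count-none p xs (f ∘ there)

  count-complement : ∀ (p : A → Bool) xs → count p xs + count (not ∘ p) xs ≡ length xs
  count-complement p [] = refl
  count-complement p (x ∷ xs) with p x
  ... | true  = cong suc (count-complement p xs)
  ... | false = trans (+-suc _ _) (cong suc (count-complement p xs))

  count-∧ : ∀ (p r : A → Bool) xs → count p xs ≤ count (λ x → r x ∧ p x) xs + count (not ∘ r) xs
  count-∧ p r [] = z≤n
  count-∧ p r (x ∷ xs) with p x | r x
  ... | true  | true  = s≤s (count-∧ p r xs)
  ... | true  | false = ≤-trans (s≤s (count-∧ p r xs)) (≤-reflexive (sym (+-suc _ _)))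
  ... | false | true  = count-∧ p r xs
  ... | false | false = ≤-trans (count-∧ p r xs) (+-monoʳ-≤ _ (n≤1+n _))

  count-true : ∀ (xs : List A) → length xs ≤ count (λ _ → true) xs
  count-true [] = z≤n
  count-true (x ∷ xs) = s≤s (count-true xs)

  half : ∀ (p : A → Bool) xs → length xs ≤ 2 * count p xs ⊎ length xs ≤ 2 * count (not ∘ p) xs
  half p xs with count-complement p xs
  ... | e with ≤-total (count p xs) (count (not ∘ p) xs)
  ... | inj₁ le = inj₂ (≤-trans (≤-reflexive (sym e))
                    (≤-trans (+-monoˡ-≤ _ le) (≤-reflexive (cong (count (not ∘ p) xs +_) (sym (+-identityʳ _))))))
  ... | inj₂ le = inj₁ (≤-trans (≤-reflexive (sym e))
                    (≤-trans (+-monoʳ-≤ _ le) (≤-reflexive (cong (count p xs +_) (sym (+-identityʳ _))))))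

  majority : ∀ (p : A → Bool) xs → 2 * count (not ∘ p) xs ≤ length xs → length xs ≤ 2 * count p xs
  majority p xs le with count-complement p xs
  ... | e = +-cancelʳ-≤ (2 * count (not ∘ p) xs) _ _ (begin
      length xs + 2 * b ≤⟨ +-monoʳ-≤ (length xs) le ⟩
      length xs + length xs ≡⟨ cong₂ _+_ (sym e) (sym e) ⟩
      (a + b) + (a + b) ≡⟨ lem a b ⟩
      2 * a + 2 * b ∎)
    where
    open ≤-Reasoning
    a = count p xs
    b = count (not ∘ p) xs
    lem : ∀ a b → (a + b) + (a + b) ≡ 2 * a + 2 * b
    lem = solve-∀

  all-true⁻ : ∀ (p : A → Bool) {x} us → all p us ≡ true → x ∈ us → p x ≡ true
  all-true⁻ p (u ∷ us) e (here refl) = proj₁ (∧-true⁻ e)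
  all-true⁻ p (u ∷ us) e (there x∈) = all-true⁻ p us (proj₂ (∧-true⁻ {p u} e)) x∈

  any-true⁻ : ∀ (p : A → Bool) us → any p us ≡ true → ∃ λ x → x ∈ us × p x ≡ true
  any-true⁻ p (u ∷ us) e with p u in eq
  ... | true = u , here refl , eq
  ... | false with any-true⁻ p us e
  ...   | x , x∈ , px = x , there x∈ , px

  any-false⁻ : ∀ (p : A → Bool) us → any p us ≡ false → ∀ {x} → x ∈ us → p x ≡ false
  any-false⁻ p (u ∷ us) e (here refl) with p u
  ... | false = refl
  any-false⁻ p (u ∷ us) e (there x∈) with p u
  ... | false = any-false⁻ p us e x∈

  all-false⁻ : ∀ (p : A → Bool) us → all p us ≡ false → ∃ λ x → x ∈ us × p x ≡ false
  all-false⁻ p (u ∷ us) e with p u in eq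
  ... | false = u , here refl , eq
  ... | true with all-false⁻ p us e
  ...   | x , x∈ , px = x , there x∈ , px

  nonempty : ∀ (xs : List A) → 1 ≤ length xs → ∃ λ x → x ∈ xs
  nonempty (x ∷ xs) _ = x , here refl

  ∈⇒nonempty : ∀ {x} {xs : List A} → x ∈ xs → 1 ≤ length xs
  ∈⇒nonempty (here _) = s≤s z≤n
  ∈⇒nonempty (there _) = s≤s z≤n

  -- The failures of the single tests add up to at most half of `xs`.
  union-bound : ∀ {U : Set} (t : U → A → Bool) us xs → 1 ≤ length us →
    (∀ {u} → u ∈ us → 2 * length us * count (not ∘ t u) xs ≤ length xs) →
    length xs ≤ 2 * count (λ x → all (λ u → t u x) us) xs
  union-bound {U} t us xs 1≤ h = +-cancelʳ-≤ (length xs) _ _ (begin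
      length xs + length xs ≡⟨ cong (length xs +_) (sym (+-identityʳ _)) ⟩
      2 * length xs ≤⟨ *-monoʳ-≤ 2 (step us) ⟩
      2 * (count P xs + sum (map f us)) ≡⟨ *-distribˡ-+ 2 (count P xs) _ ⟩
      2 * count P xs + 2 * sum (map f us) ≤⟨ +-monoʳ-≤ (2 * count P xs) small ⟩
      2 * count P xs + length xs ∎)
    where
    open ≤-Reasoning
    f : U → ℕ
    f u = count (not ∘ t u) xs
    P = λ x → all (λ u → t u x) us
    step : ∀ vs → length xs ≤ count (λ x → all (λ u → t u x) vs) xs + sum (map f vs)
    step [] = ≤-trans (count-true xs) (≤-reflexive (sym (+-identityʳ _)))
    step (v ∷ vs) = begin
      length xs ≤⟨ step vs ⟩
      count (λ x → all (λ u → t u x) vs) xs + sum (map f vs)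
        ≤⟨ +-monoˡ-≤ _ (count-∧ _ (t v) xs) ⟩
      _ + f v + sum (map f vs) ≡⟨ +-assoc (count (λ x → all (λ u → t u x) (v ∷ vs)) xs) (f v) (sum (map f vs)) ⟩
      _ ∎
    bound : ∀ vs → (∀ {u} → u ∈ vs → u ∈ us) → 2 * length us * sum (map f vs) ≤ length vs * length xs
    bound [] _ = ≤-reflexive (*-zeroʳ (2 * length us))
    bound (v ∷ vs) i = begin
      2 * length us * (f v + sum (map f vs)) ≡⟨ *-distribˡ-+ (2 * length us) (f v) _ ⟩
      2 * length us * f v + 2 * length us * sum (map f vs) ≤⟨ +-mono-≤ (h (i (here refl))) (bound vs (i ∘ there)) ⟩
      length xs + length vs * length xs ∎
    small : 2 * sum (map f us) ≤ length xs
    small = *-cancelˡ-≤ (length us) {{>-nonZero 1≤}} (begin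
      length us * (2 * sum (map f us)) ≡⟨ sym (*-assoc (length us) 2 _) ⟩
      length us * 2 * sum (map f us) ≡⟨ cong (_* sum (map f us)) (*-comm (length us) 2) ⟩
      2 * length us * sum (map f us) ≤⟨ bound us (λ u∈ → u∈) ⟩
      length us * length xs ∎)

  AllPairs-resp-⊆ : ∀ {R : A → A → Set} {xs ys} → xs ⊆ ys → AllPairs R ys → AllPairs R xs
  AllPairs-resp-⊆ [] _ = []
  AllPairs-resp-⊆ (y ∷ʳ s) (_ ∷ c) = AllPairs-resp-⊆ s c
  AllPairs-resp-⊆ (refl ∷ s) (p ∷ c) = All-resp-⊆ s p ∷ AllPairs-resp-⊆ s c

  chunk : ℕ → ℕ → List A → List A
  chunk i s xs = take s (drop (i * s) xs)

  chunk-⊆ : ∀ i s xs → chunk i s xs ⊆ xs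
  chunk-⊆ i s xs = ⊆-trans (take-⊆ s _) (drop-⊆ (i * s) xs)

  length-chunk : ∀ {i k} s xs → i < k → k * s ≤ length xs → length (chunk i s xs) ≡ s
  length-chunk {i} {k} s xs i<k le = trans (length-take s (drop (i * s) xs)) (m≤n⇒m⊓n≡m
    (subst (s ≤_) (sym (length-drop (i * s) xs)) (m+n≤o⇒m≤o∸n s (≤-trans (*-monoˡ-≤ s i<k) le))))

  take-drop-AllPairs : ∀ {R : A → A → Set} k {l} {xs} → k ≤ l → AllPairs R xs → ∀ {x y} →
    x ∈ take k xs → y ∈ drop l xs → R x y
  take-drop-AllPairs (suc k) {suc l} {x ∷ xs} (s≤s le) (r ∷ rs) (here refl) y∈ =
    All.lookup r (lookup (drop-⊆ l xs) y∈)
  take-drop-AllPairs (suc k) {suc l} {x ∷ xs} (s≤s le) (r ∷ rs) (there x∈) y∈ =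
    take-drop-AllPairs k le rs x∈ y∈

  take-drop-⊆ : ∀ s k (xs : List A) {x} → x ∈ take s (drop k xs) → x ∈ take (k + s) xs
  take-drop-⊆ s zero xs x∈ = x∈
  take-drop-⊆ (suc s) (suc k) [] ()
  take-drop-⊆ s (suc k) (y ∷ xs) x∈ = there (take-drop-⊆ s k xs x∈)

  chunk-AllPairs : ∀ {R : A → A → Set} {i j} s {xs} → i < j → AllPairs R xs → ∀ {x y} →
    x ∈ chunk i s xs → y ∈ chunk j s xs → R x y
  chunk-AllPairs {i = i} {j} s {xs} i<j rs x∈ y∈ =
    take-drop-AllPairs (i * s + s) {j * s} (≤-trans (≤-reflexive (+-comm (i * s) s)) (*-monoˡ-≤ s i<j)) rs
      (take-drop-⊆ s (i * s) xs x∈) (lookup (take-⊆ s _) y∈)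

module _ {A B : Set} where

  incidences : (A → B → Bool) → List A → List B → ℕ
  incidences r xs ys = sum (map (λ x → count (r x) ys) xs)

  incidences-flip : ∀ (r : A → B → Bool) xs ys →
    incidences r xs ys ≡ sum (map (λ y → count (λ x → r x y) xs) ys)
  incidences-flip r [] ys = sym (zeros ys)
    where
    zeros : ∀ (ys : List B) → sum (map (λ _ → 0) ys) ≡ 0
    zeros [] = refl
    zeros (_ ∷ ys) = zeros ys
  incidences-flip r (x ∷ xs) ys = trans (cong (count (r x) ys +_) (incidences-flip r xs ys)) (go ys)
    where
    open ≡-Reasoning
    g : B → ℕ
    g y = count (λ x → r x y) xs
    lem : ∀ a b c → a + (b + c) ≡ b + (a + c)
    lem = solve-∀
    go : ∀ ys → count (r x) ys + sum (map g ys) ≡ sum (map (λ y → count (λ z → r z y) (x ∷ xs)) ys)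
    go [] = refl
    go (y ∷ ys) with r x y
    ... | true  = cong suc (trans (lem (count (r x) ys) (g y) _) (cong (g y +_) (go ys)))
    ... | false = trans (lem (count (r x) ys) (g y) _) (cong (g y +_) (go ys))

  -- Double counting: a bad `y` meets more than |xs|/K of `xs`, but there are at most |xs||ys|/(2K)
  -- incidences, so at most half of `ys` is bad. A bound for every `x` becomes a bound for half of
  -- the `y`, at the price of a factor 2.
  markov : ∀ K (r : A → B → Bool) xs ys → 1 ≤ length xs →
    (∀ {x} → x ∈ xs → 2 * K * count (r x) ys ≤ length ys) →
    length ys ≤ 2 * count (λ y → K * count (λ x → r x y) xs ≤ᵇ length xs) ys
  markov K r xs ys 1≤ h = majority good ys (*-cancelˡ-≤ (length xs) {{>-nonZero 1≤}} (begin
      length xs * (2 * count (not ∘ good) ys) ≡⟨ lem₁ (length xs) _ ⟩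
      2 * (length xs * count (not ∘ good) ys) ≤⟨ *-monoʳ-≤ 2 (lower ys) ⟩
      2 * (K * sum (map f ys)) ≡⟨ sym (*-assoc 2 K _) ⟩
      2 * K * sum (map f ys) ≡⟨ cong (2 * K *_) (sym (incidences-flip r xs ys)) ⟩
      2 * K * incidences r xs ys ≤⟨ upper xs (λ x∈ → x∈) ⟩
      length xs * length ys ∎))
    where
    open ≤-Reasoning
    f : B → ℕ
    f y = count (λ x → r x y) xs
    good : B → Bool
    good y = K * f y ≤ᵇ length xs
    lem₁ : ∀ a b → a * (2 * b) ≡ 2 * (a * b)
    lem₁ = solve-∀
    upper : ∀ zs → (∀ {x} → x ∈ zs → x ∈ xs) → 2 * K * incidences r zs ys ≤ length zs * length ys
    upper [] _ = ≤-reflexive (*-zeroʳ (2 * K))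
    upper (z ∷ zs) i = ≤-trans (≤-reflexive (*-distribˡ-+ (2 * K) (count (r z) ys) _))
      (+-mono-≤ (h (i (here refl))) (upper zs (i ∘ there)))
    lower : ∀ zs → length xs * count (not ∘ good) zs ≤ K * sum (map f zs)
    lower [] = ≤-trans (≤-reflexive (*-zeroʳ (length xs))) z≤n
    lower (z ∷ zs) with good z in eq
    ... | true = ≤-trans (lower zs) (*-monoʳ-≤ K (m≤n+m _ (f z)))
    ... | false = begin
      length xs * suc (count (not ∘ good) zs) ≡⟨ *-suc (length xs) _ ⟩
      length xs + length xs * count (not ∘ good) zs ≤⟨ +-mono-≤ (<⇒≤ (≤ᵇ-false⇒> eq)) (lower zs) ⟩
      K * f z + K * sum (map f zs) ≡⟨ sym (*-distribˡ-+ K (f z) _) ⟩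
      K * (f z + sum (map f zs)) ∎

-- Case analysis over small index ranges

module _ {P : Fin 3 → Set} where

  fin3 : P (# 0) → P (# 1) → P (# 2) → ∀ i → P i
  fin3 a b c fz = a
  fin3 a b c (fs fz) = b
  fin3 a b c (fs (fs fz)) = c

module _ {P : Fin 4 → Set} where

  fin4 : P (# 0) → P (# 1) → P (# 2) → P (# 3) → ∀ i → P i
  fin4 a b c d fz = a
  fin4 a b c d (fs fz) = b
  fin4 a b c d (fs (fs fz)) = c
  fin4 a b c d (fs (fs (fs fz))) = d

module _ {P : Fin 5 → Set} where

  fin5 : P (# 0) → P (# 1) → P (# 2) → P (# 3) → P (# 4) → ∀ i → P i
  fin5 a b c d e fz = a
  fin5 a b c d e (fs fz) = b
  fin5 a b c d e (fs (fs fz)) = c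
  fin5 a b c d e (fs (fs (fs fz))) = d
  fin5 a b c d e (fs (fs (fs (fs fz)))) = e

module _ {P : Fin 6 → Set} where

  fin6 : P (# 0) → P (# 1) → P (# 2) → P (# 3) → P (# 4) → P (# 5) → ∀ i → P i
  fin6 a b c d e f fz = a
  fin6 a b c d e f (fs fz) = b
  fin6 a b c d e f (fs (fs fz)) = c
  fin6 a b c d e f (fs (fs (fs fz))) = d
  fin6 a b c d e f (fs (fs (fs (fs fz)))) = e
  fin6 a b c d e f (fs (fs (fs (fs (fs fz))))) = f

index3 : ∀ {U : Set} {a b c u : U} → u ≡ a ⊎ u ≡ b ⊎ u ≡ c → ∃ λ i → u ≡ fin3 {λ _ → U} a b c i
index3 (inj₁ e) = # 0 , e
index3 (inj₂ (inj₁ e)) = # 1 , e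
index3 (inj₂ (inj₂ e)) = # 2 , e

index4 : ∀ {U : Set} {a b c d u : U} → u ≡ a ⊎ u ≡ b ⊎ u ≡ c ⊎ u ≡ d → ∃ λ i → u ≡ fin4 {λ _ → U} a b c d i
index4 (inj₁ e) = # 0 , e
index4 (inj₂ (inj₁ e)) = # 1 , e
index4 (inj₂ (inj₂ (inj₁ e))) = # 2 , e
index4 (inj₂ (inj₂ (inj₂ e))) = # 3 , e

-- Discards impossible cases by evaluation: once the test computes, the hidden argument has the unit
-- type and is filled in automatically.
unequal : ∀ {A : Set} {m n} → {t : T (not (m ≡ᵇ n))} → m ≡ n → A
unequal {m = m} {t = t} refl = ⊥-elim (subst (T ∘ not) (T⇒≡true (≡⇒≡ᵇ m m refl)) t)

module _ {P : ℕ → Set} where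

  just-1 : P 1 → ∀ i → 1 ≤ i → i < 2 → P i
  just-1 p 1 _ _ = p
  just-1 p (suc (suc _)) _ (s≤s (s≤s ()))

  just-0-1 : P 0 → P 1 → ∀ i → 0 ≤ i → i < 2 → P i
  just-0-1 p r 0 _ _ = p
  just-0-1 p r 1 _ _ = r
  just-0-1 p r (suc (suc _)) _ (s≤s (s≤s ()))

  just-1-2 : P 1 → P 2 → ∀ i → 1 ≤ i → i < 3 → P i
  just-1-2 p r 1 _ _ = p
  just-1-2 p r 2 _ _ = r
  just-1-2 p r (suc (suc (suc _))) _ (s≤s (s≤s (s≤s ())))

-- Critical tournaments

not-true : ∀ {b} → not b ≡ true → b ≡ false
not-true {false} _ = refl

-- Bernoulli's inequality (1 + 1/d)^q ≥ 1 + q/d, cleared of denominators.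
bernoulli : ∀ d q → (d + q) * d ^ q ≤ d * suc d ^ q
bernoulli d zero = ≤-reflexive (lem d)
  where
  lem : ∀ d → (d + 0) * 1 ≡ d * 1
  lem = solve-∀
bernoulli d (suc q) = begin
  (d + suc q) * (d * d ^ q) ≤⟨ m≤m+n _ (q * d ^ q) ⟩
  (d + suc q) * (d * d ^ q) + q * d ^ q ≡⟨ lem₁ d q (d ^ q) ⟩
  suc d * ((d + q) * d ^ q) ≤⟨ *-monoʳ-≤ (suc d) (bernoulli d q) ⟩
  suc d * (d * suc d ^ q) ≡⟨ lem₂ d (suc d ^ q) ⟩
  d * (suc d * suc d ^ q) ∎
  where
  open ≤-Reasoning
  lem₁ : ∀ d q p → (d + suc q) * (d * p) + q * p ≡ suc d * ((d + q) * p)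
  lem₁ = solve-∀
  lem₂ : ∀ d p → suc d * (d * p) ≡ d * (suc d * p)
  lem₂ = solve-∀

power-gap : ∀ c d q → 1 ≤ q → c * d ≤ q → c * d ^ q ≤ suc d ^ q
power-gap c zero (suc q) _ _ = ≤-trans (≤-reflexive (*-zeroʳ c)) z≤n
power-gap c (suc d) q _ le = *-cancelˡ-≤ (suc d) (begin
  suc d * (c * suc d ^ q) ≡⟨ lem (suc d) c _ ⟩
  c * suc d * suc d ^ q ≤⟨ *-monoˡ-≤ (suc d ^ q) (≤-trans le (m≤n+m q (suc d))) ⟩
  (suc d + q) * suc d ^ q ≤⟨ bernoulli (suc d) q ⟩
  suc d * suc (suc d) ^ q ∎)
  where
  open ≤-Reasoning
  lem : ∀ d c p → d * (c * p) ≡ c * d * p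
  lem = solve-∀

n<2^n : ∀ n → n < 2 ^ n
n<2^n zero = s≤s z≤n
n<2^n (suc n) = begin-strict
  suc n <⟨ s≤s (n<2^n n) ⟩
  1 + 2 ^ n ≤⟨ +-monoˡ-≤ (2 ^ n) (m^n>0 2 n) ⟩
  2 ^ n + 2 ^ n ≡⟨ cong (2 ^ n +_) (sym (+-identityʳ _)) ⟩
  2 * 2 ^ n ∎
  where open ≤-Reasoning

^-*-distrib : ∀ a b q → (a * b) ^ q ≡ a ^ q * b ^ q
^-*-distrib a b zero = refl
^-*-distrib a b (suc q) = trans (cong (a * b *_) (^-*-distrib a b q)) (lem a b (a ^ q) (b ^ q))
  where
  lem : ∀ a b x y → a * b * (x * y) ≡ a * x * (b * y)
  lem = solve-∀

-- If x ≤ d/(d+1) τ, then C x^q ≤ C (d/(d+1))^q τ^q ≤ τ^q < n by `power-gap`. So a set of at least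
-- n/C vertices, with C d ≤ q, always has a chain longer than d/(d+1) of `τ`.
ratio-absurd : ∀ {n τ} C d x q → 1 ≤ q → C * d ≤ q → τ ^ q < n → n ≤ C * x ^ q →
               suc d * x ≤ d * τ → ⊥
ratio-absurd {n} {τ} C d x q 1≤q Cd τ<n n≤ x≤ = <-irrefl refl (begin-strict
  suc d ^ q * τ ^ q <⟨ *-monoʳ-< (suc d ^ q) {{m^n≢0 (suc d) q}} τ<n ⟩
  suc d ^ q * n ≤⟨ *-monoʳ-≤ (suc d ^ q) n≤ ⟩
  suc d ^ q * (C * x ^ q) ≡⟨ lem (suc d ^ q) C (x ^ q) ⟩
  C * (suc d ^ q * x ^ q) ≡⟨ cong (C *_) (sym (^-*-distrib (suc d) x q)) ⟩
  C * (suc d * x) ^ q ≤⟨ *-monoʳ-≤ C (^-monoˡ-≤ q x≤) ⟩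
  C * (d * τ) ^ q ≡⟨ cong (C *_) (^-*-distrib d τ q) ⟩
  C * (d ^ q * τ ^ q) ≡⟨ sym (*-assoc C (d ^ q) _) ⟩
  C * d ^ q * τ ^ q ≤⟨ *-monoˡ-≤ (τ ^ q) (power-gap C d q 1≤q Cd) ⟩
  suc d ^ q * τ ^ q ∎)
  where
  open ≤-Reasoning
  lem : ∀ a b c → a * (b * c) ≡ b * (a * c)
  lem = solve-∀

module Arcs (T : Digraph) (tT : IsTournament T) where

  V : Set
  V = Fin (size T)

  Arc : V → V → Set
  Arc x y = arc T x y ≡ true

  Chain : List V → Set
  Chain = AllPairs Arc

  nonArc : V → V → Bool
  nonArc x y = not (arc T x y)

  Arc⇒≢ : ∀ {x y} → Arc x y → x ≢ y
  Arc⇒≢ {x} a refl with () ← trans (sym (proj₁ tT x)) a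

  Arc-asym : ∀ {x y} → Arc x y → arc T y x ≡ false
  Arc-asym {x} {y} a = trans (proj₂ tT y x (Arc⇒≢ a ∘ sym)) (cong not a)

  ¬Arc⇒Arc : ∀ {x y} → x ≢ y → arc T x y ≡ false → Arc y x
  ¬Arc⇒Arc {x} {y} ne a = trans (proj₂ tT y x (ne ∘ sym)) (cong not a)

  _⇒ₐ_ : List V → List V → Set
  X ⇒ₐ Y = ∀ {x y} → x ∈ X → y ∈ Y → Arc x y

  -- A common vertex also witnesses that completeness fails, so the arc is promised for distinct
  -- vertices only.
  backArc : ∀ X Y → ¬ (X ⇒ₐ Y) → ∃ λ x → ∃ λ y → x ∈ X × y ∈ Y × (x ≢ y → Arc y x)
  backArc X Y ¬fwd with any (λ x → any (nonArc x) Y) X in eq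
  ... | false = ⊥-elim (¬fwd λ {x} {y} x∈ y∈ → not-false (any-false⁻ (nonArc x) Y (any-false⁻ (λ x → any (nonArc x) Y) X eq x∈) y∈))
    where
    not-false : ∀ {b} → not b ≡ false → b ≡ true
    not-false {true} _ = refl
  ... | true with any-true⁻ (λ x → any (nonArc x) Y) X eq
  ...   | x , x∈ , e with any-true⁻ (nonArc x) Y e
  ...     | y , y∈ , e' = x , y , x∈ , y∈ , λ ne → ¬Arc⇒Arc ne (not-true e')

  ++-chain : ∀ {xs ys} → Chain xs → Chain ys → xs ⇒ₐ ys → Chain (xs ++ ys)
  ++-chain cx cy f = AllPairs.++⁺ cx cy (All.tabulate λ x∈ → All.tabulate λ y∈ → f x∈ y∈)

-- T violates the bound with exponent 1/q, while its proper subtournaments obey it; only those inside `base`,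
-- which omits the vertex `apex`, are needed.
record Critical (T : Digraph) (q : ℕ) : Set where
  field
    tournament : IsTournament T
    4≤q        : 4 ≤ q
    τ          : ℕ
    τ^q<n      : τ ^ q < size T
    base       : List (Fin (size T))
    apex       : Fin (size T)
    base-large : size T ≤ 2 * length base
    base-uniq  : AllPairs _≢_ base
    apex∉base  : ∀ {x} → x ∈ base → apex ≢ x
  open Arcs T tournament public
  field
    chain≤τ    : ∀ {ys} → Chain ys → length ys ≤ τ
    subchain   : ∀ X → X ⊆ base → Σ[ ys ∈ List V ] (Chain ys × (∀ {y} → y ∈ ys → y ∈ X) × length X ≤ length ys ^ q)

module CriticalFacts {T : Digraph} {q : ℕ} (crit : Critical T q) where
  open Critical crit public

  n : ℕ
  n = size T

  -- Sublists of `base` have no repetitions and miss `apex`, so they induce proper subtournaments,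
  -- to which minimality applies.
  record Linear (C : ℕ) (X : List V) : Set where
    constructor linear
    field
      ⊆base : X ⊆ base
      bound : n ≤ C * length X
  open Linear public

  record LongChain (D : ℕ) (Y : List V) : Set where
    constructor longChain
    field
      chain : Chain Y
      long  : τ ≤ D * length Y
  open LongChain public

  1≤q : 1 ≤ q
  1≤q = ≤-trans (s≤s z≤n) 4≤q

  1≤n : 1 ≤ n
  1≤n = ≤-trans (s≤s z≤n) τ^q<n

  linear-chain : ∀ {C X} → Linear C X →
    Σ[ ys ∈ List V ] (Chain ys × (∀ {y} → y ∈ ys → y ∈ X) × n ≤ C * length ys ^ q)
  linear-chain {C} {X} (linear X⊆ n≤) with subchain X X⊆
  ... | ys , c , i , le = ys , c , i , ≤-trans n≤ (*-monoʳ-≤ C le)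

  -- The case d = 1 of `ratio-absurd`: the chain given by minimality cannot be shorter than half of
  -- `τ`.
  linear-longChain : ∀ {C X} → C ≤ q → Linear C X →
    Σ[ ys ∈ List V ] (LongChain 2 ys × (∀ {y} → y ∈ ys → y ∈ X))
  linear-longChain {C} C≤q lin with linear-chain lin
  ... | ys , c , i , n≤ with τ ≤? 2 * length ys
  ...   | yes le = ys , longChain c le , i
  ...   | no ¬le = ⊥-elim (ratio-absurd C 1 (length ys) q 1≤q
            (≤-trans (≤-reflexive (*-identityʳ C)) C≤q) τ^q<n n≤
            (≤-trans (<⇒≤ (≰⇒> ¬le)) (≤-reflexive (sym (*-identityˡ τ)))))

  private
    -- With D = d + 1, the bound on `n` forces `a` above (1 - 1/D) τ, while `b` is at least τ/D;
    -- together they exceed `τ`.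
    longChain-absurd : ∀ C D a b → C * D ≤ q → 1 ≤ D → n ≤ C * a ^ q → τ ≤ D * b → a + b ≤ τ → ⊥
    longChain-absurd C (suc d) a b CD _ n≤ τ≤ ab = ratio-absurd C d a q 1≤q
      (≤-trans (*-monoʳ-≤ C (n≤1+n d)) CD) τ^q<n n≤ (+-cancelʳ-≤ τ _ _ (begin
        suc d * a + τ ≤⟨ +-monoʳ-≤ (suc d * a) τ≤ ⟩
        suc d * a + suc d * b ≡⟨ sym (*-distribˡ-+ (suc d) a b) ⟩
        suc d * (a + b) ≤⟨ *-monoʳ-≤ (suc d) ab ⟩
        τ + d * τ ≡⟨ +-comm τ (d * τ) ⟩
        d * τ + τ ∎))
      where open ≤-Reasoning

  -- Otherwise the chain inside `X` followed by `Y` would be longer than `τ`.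
  linear⇏longChain : ∀ {C D X Y} → C * D ≤ q → 1 ≤ D → Linear C X → LongChain D Y → ¬ (X ⇒ₐ Y)
  linear⇏longChain {C} {D} {Y = Y} CD 1≤D lin (longChain cY τ≤) f with linear-chain lin
  ... | xs , c , i , n≤ = longChain-absurd C D (length xs) (length Y) CD 1≤D n≤ τ≤
        (≤-trans (≤-reflexive (sym (length-++ xs))) (chain≤τ (++-chain c cY (λ x∈ → f (i x∈)))))

  longChain⇏linear : ∀ {C D X Y} → C * D ≤ q → 1 ≤ D → Linear C X → LongChain D Y → ¬ (Y ⇒ₐ X)
  longChain⇏linear {C} {D} {Y = Y} CD 1≤D lin (longChain cY τ≤) f with linear-chain lin
  ... | xs , c , i , n≤ = longChain-absurd C D (length xs) (length Y) CD 1≤D n≤ τ≤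
        (≤-trans (≤-reflexive (trans (+-comm (length xs) _) (sym (length-++ Y))))
          (chain≤τ (++-chain cY c (λ y∈ x∈ → f y∈ (i x∈)))))

  -- Each set contains a chain longer than τ/2, and completeness would join the two.
  linear⇏linear : ∀ {C X Y} → C ≤ q → Linear C X → Linear C Y → ¬ (X ⇒ₐ Y)
  linear⇏linear {C} C≤q linX linY f with linear-chain linX | linear-chain linY
  ... | xs , cx , ix , nx | ys , cy , iy , ny = go
    where
    a = length xs
    b = length ys
    ab : a + b ≤ τ
    ab = ≤-trans (≤-reflexive (sym (length-++ xs))) (chain≤τ (++-chain cx cy (λ x∈ y∈ → f (ix x∈) (iy y∈))))
    C1 : C * 1 ≤ q
    C1 = ≤-trans (≤-reflexive (*-identityʳ C)) C≤q
    double : ∀ k → k + k ≤ τ → 2 * k ≤ 1 * τ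
    double k le = subst₂ _≤_ (cong (k +_) (sym (+-identityʳ k))) (sym (*-identityˡ τ)) le
    go : ⊥
    go with ≤-total a b
    ... | inj₁ a≤b = ratio-absurd C 1 a q 1≤q C1 τ^q<n nx (double a (≤-trans (+-monoʳ-≤ a a≤b) ab))
    ... | inj₂ b≤a = ratio-absurd C 1 b q 1≤q C1 τ^q<n ny (double b (≤-trans (+-monoˡ-≤ b b≤a) ab))

  -- If τ ≤ D, the single vertex `apex` would count as a long chain; yet it is complete to, or from,
  -- at least a quarter of all vertices.
  τ-large : ∀ D → 4 * D ≤ q → 1 ≤ D → D < τ
  τ-large D 4D 1≤D with τ ≤? D
  ... | no τ≰D = ≰⇒> τ≰D
  ... | yes τ≤D = ⊥-elim (go (half (arc T apex) base))
    where
    open ≤-Reasoning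
    single : LongChain D (apex ∷ [])
    single = longChain ([] ∷ []) (≤-trans τ≤D (≤-reflexive (sym (*-identityʳ D))))
    lin : ∀ p → length base ≤ 2 * count p base → Linear 4 (filterᵇ p base)
    lin p le = linear (filterᵇ-⊆ p base) (begin
      n ≤⟨ base-large ⟩
      2 * length base ≤⟨ *-monoʳ-≤ 2 le ⟩
      2 * (2 * count p base) ≡⟨ sym (*-assoc 2 2 (count p base)) ⟩
      4 * count p base ∎)
    go : _ → ⊥
    go (inj₁ le) = longChain⇏linear {4} 4D 1≤D (lin _ le) single
      λ { (here refl) x∈ → proj₂ (∈-filterᵇ⁻ (arc T apex) base x∈) }
    go (inj₂ le) = linear⇏longChain {4} 4D 1≤D (lin _ le) single
      λ { {x} x∈ (here refl) → let x∈b , px = ∈-filterᵇ⁻ (not ∘ arc T apex) base x∈ in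
            ¬Arc⇒Arc (apex∉base x∈b) (not-true px) }

  -- Since τ ≥ 2, `n` exceeds 2^q. This makes linear sets large enough to be cut into the parts of
  -- the greedy embedding.
  q<n : q < n
  q<n = begin-strict
    q <⟨ n<2^n q ⟩
    2 ^ q ≤⟨ ^-monoˡ-≤ q (τ-large 1 4≤q ≤-refl) ⟩
    τ ^ q <⟨ τ^q<n ⟩
    n ∎
    where open ≤-Reasoning

  linear-nonempty : ∀ {C X} → Linear C X → 1 ≤ length X
  linear-nonempty {C} {[]} (linear _ n≤) = ⊥-elim (<-irrefl refl (≤-trans 1≤n (≤-trans n≤ (≤-reflexive (*-zeroʳ C)))))
  linear-nonempty {X = _ ∷ _} _ = s≤s z≤n

  longChain-nonempty : ∀ {D X} → LongChain D X → 1 ≤ length X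
  longChain-nonempty {D} {[]} (longChain _ τ≤) = ⊥-elim (<-irrefl refl
    (≤-trans (≤-trans (s≤s z≤n) (τ-large 1 4≤q ≤-refl)) (≤-trans τ≤ (≤-reflexive (*-zeroʳ D)))))
  longChain-nonempty {X = _ ∷ _} _ = s≤s z≤n

  linear-⊆ : ∀ {C X X'} k → X' ⊆ X → length X ≤ k * length X' → Linear C X → Linear (C * k) X'
  linear-⊆ {C} k s le (linear X⊆ n≤) = linear (⊆-trans s X⊆)
    (≤-trans n≤ (≤-trans (*-monoʳ-≤ C le) (≤-reflexive (sym (*-assoc C k _)))))

  linear-mono : ∀ {C C' X} → C ≤ C' → Linear C X → Linear C' X
  linear-mono {X = X} le (linear X⊆ n≤) = linear X⊆ (≤-trans n≤ (*-monoˡ-≤ (length X) le))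

  longChain-⊆ : ∀ {D X X'} k → X' ⊆ X → length X ≤ k * length X' → LongChain D X → LongChain (D * k) X'
  longChain-⊆ {D} k s le (longChain c τ≤) = longChain (AllPairs-resp-⊆ s c)
    (≤-trans τ≤ (≤-trans (*-monoʳ-≤ D le) (≤-reflexive (sym (*-assoc D k _)))))

  longChain-mono : ∀ {D D' X} → D ≤ D' → LongChain D X → LongChain D' X
  longChain-mono {X = X} le (longChain c τ≤) = longChain c (≤-trans τ≤ (*-monoˡ-≤ (length X) le))

  -- The vertices without a neighbour in Y on the requested side do not form a linear set.
  module _ {C D X Y} (CD : C * 2 * D ≤ q) (1≤D : 1 ≤ D) (lin : Linear C X) (long : LongChain D Y)
           (disj : ∀ {x y} → x ∈ X → y ∈ Y → x ≢ y) where

    refine-out : Σ[ X' ∈ List V ] (X' ⊆ X × Linear (C * 2) X' × (∀ {x} → x ∈ X' → ∃ λ y → y ∈ Y × Arc x y))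
    refine-out with half (λ x → any (arc T x) Y) X
    ... | inj₁ le = _ , filterᵇ-⊆ _ X , linear-⊆ 2 (filterᵇ-⊆ _ X) le lin ,
          λ x∈ → any-true⁻ _ Y (proj₂ (∈-filterᵇ⁻ (λ x → any (arc T x) Y) X x∈))
    ... | inj₂ le = ⊥-elim (longChain⇏linear CD 1≤D (linear-⊆ 2 (filterᵇ-⊆ _ X) le lin) long
          λ {y} {x} y∈ x∈ → let x∈X , e = ∈-filterᵇ⁻ (λ x → not (any (arc T x) Y)) X x∈ in
            ¬Arc⇒Arc (disj x∈X y∈) (any-false⁻ _ Y (not-true e) y∈))

    refine-in : Σ[ X' ∈ List V ] (X' ⊆ X × Linear (C * 2) X' × (∀ {x} → x ∈ X' → ∃ λ y → y ∈ Y × Arc y x))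
    refine-in with half (λ x → any (λ y → arc T y x) Y) X
    ... | inj₁ le = _ , filterᵇ-⊆ _ X , linear-⊆ 2 (filterᵇ-⊆ _ X) le lin ,
          λ x∈ → any-true⁻ _ Y (proj₂ (∈-filterᵇ⁻ (λ x → any (λ y → arc T y x) Y) X x∈))
    ... | inj₂ le = ⊥-elim (linear⇏longChain CD 1≤D (linear-⊆ 2 (filterᵇ-⊆ _ X) le lin) long
          λ {x} {y} x∈ y∈ → let x∈X , e = ∈-filterᵇ⁻ (λ x → not (any (λ y → arc T y x) Y)) X x∈ in
            ¬Arc⇒Arc (disj x∈X y∈ ∘ sym) (any-false⁻ _ Y (not-true e) y∈))

-- Sparse pairs by greedy embedding

agree : Bool → Bool → Bool
agree b c = if c then b else not b

agree⇒≡ : ∀ {b} c → agree b c ≡ true → b ≡ c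
agree⇒≡ true e = e
agree⇒≡ false e = not-true e

-- Rounding down loses at most a factor 2 once the quotient is positive.
div-large : ∀ l k → suc k ≤ l → l ≤ 2 * suc k * (l / suc k)
div-large l k k<l with l / suc k | m≡m%n+[m/n]*n l (suc k) | m%n<n l (suc k)
... | zero | e | r< = ⊥-elim (<-irrefl (sym (trans e (+-identityʳ _))) (≤-trans r< k<l))
... | suc s | e | r< = begin
    l ≡⟨ e ⟩
    l % suc k + suc s * suc k ≤⟨ +-monoˡ-≤ (suc s * suc k) (≤-trans (<⇒≤ r<) (m≤m+n (suc k) (s * suc k))) ⟩
    suc s * suc k + suc s * suc k ≡⟨ lem (suc s) (suc k) ⟩
    2 * suc k * suc s ∎
  where
  open ≤-Reasoning
  lem : ∀ s k → s * k + s * k ≡ 2 * k * s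
  lem = solve-∀

-- The factor `2 ^ m` instead of `m` comes from halving: either half of `X` satisfies the first
-- predicate, or the other half is covered by the remaining ones.
pigeonhole : ∀ {A : Set} m (p : Fin m → A → Bool) X → 1 ≤ length X →
  (∀ {x} → x ∈ X → ∃ λ j → p j x ≡ true) → ∃ λ j → length X ≤ 2 ^ m * count (p j) X
pigeonhole zero p X 1≤ f with nonempty X 1≤
... | x , x∈ with f x∈
...   | () , _
pigeonhole (suc m) p X 1≤ f with half (p fz) X
... | inj₁ le = fz , ≤-trans le (*-monoˡ-≤ (count (p fz) X) (≤-trans (≤-reflexive (sym (*-identityʳ 2))) (*-monoʳ-≤ 2 (m^n>0 2 m))))
... | inj₂ le = pick (pigeonhole m (p ∘ fs) X' (n≢0⇒n>0 λ e → <-irrefl (sym (n≤0⇒n≡0 (≤-trans le (≤-reflexive (cong (2 *_) e))))) 1≤) covered)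
  where
  open ≤-Reasoning
  X' = filterᵇ (not ∘ p fz) X
  covered : ∀ {x} → x ∈ X' → ∃ λ j → p (fs j) x ≡ true
  covered {x} x∈ with ∈-filterᵇ⁻ (not ∘ p fz) X x∈
  ... | x∈X , np with f x∈X
  ...   | fz , e with () ← trans (sym (not-true np)) e
  ...   | fs j , e = j , e
  pick : (∃ λ j → length X' ≤ 2 ^ m * count (p (fs j)) X') → _
  pick (j , le') = fs j , (begin
    length X ≤⟨ le ⟩
    2 * length X' ≤⟨ *-monoʳ-≤ 2 le' ⟩
    2 * (2 ^ m * count (p (fs j)) X') ≡⟨ sym (*-assoc 2 (2 ^ m) (count (p (fs j)) X')) ⟩
    2 ^ suc m * count (p (fs j)) X' ≤⟨ *-monoʳ-≤ (2 ^ suc m) (count-mono-⊆ (p (fs j)) (filterᵇ-⊆ (not ∘ p fz) X)) ⟩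
    2 ^ suc m * count (p (fs j)) X ∎)

-- The first summand pays for a failure at the current vertex, the second for a later one, when the
-- parts have shrunk by a factor `K`; their sum covers both.
sparsity : ℕ → ℕ → ℕ → ℕ
sparsity K zero    c = 0
sparsity K (suc m) c = c * 2 ^ m + sparsity K m (c * K)

module Greedy (T : Digraph) (tT : IsTournament T) (K s : ℕ) (1≤s : 1 ≤ s) where
  open Arcs T tT

  -- `b` records which value of `arc T x y` is rare, since the embedding may lack an arc in either
  -- direction.
  record Sparse {m} (Vs : Fin m → List V) (F : ℕ) : Set where
    constructor sparse
    field
      i j : Fin m
      i<j : i F.< j
      b : Bool
      A B : List V
      A⊆ : A ⊆ Vs i
      B⊆ : B ⊆ Vs j
      A-large : s ≤ F * length A
      B-large : s ≤ F * length B
      few : ∀ {x} → x ∈ A → K * count (λ y → agree (arc T x y) b) B ≤ length B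

  Embedding : ∀ {m} (h : Fin m → Fin m → Bool) (Vs : Fin m → List V) → Set
  Embedding {m} h Vs = Σ[ φ ∈ (Fin m → V) ] ((∀ i → φ i ∈ Vs i) × (∀ {i j} → i F.< j → arc T (φ i) (φ j) ≡ h i j))

  -- A vertex of the first part is usable if a 1/K share of every later part is joined to it as
  -- required. If no vertex is, many of them fail at the same later part, and these form a sparse
  -- pair with that part.
  greedy : ∀ m (h : Fin m → Fin m → Bool) (Vs : Fin m → List V) c → (∀ i → s ≤ c * length (Vs i)) →
    Embedding h Vs ⊎ Sparse Vs (sparsity K m c)
  greedy zero h Vs c _ = inj₁ ((λ ()) , (λ ()) , λ { {()} })
  greedy (suc m) h Vs c large = search
    where
    open ≤-Reasoning
    X = Vs fz
    N : V → Fin m → List V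
    N v j = filterᵇ (λ y → agree (arc T v y) (h fz (fs j))) (Vs (fs j))
    ok : V → Fin m → Bool
    ok v j = length (Vs (fs j)) ≤ᵇ K * length (N v j)
    nonemptyX : 1 ≤ length X
    nonemptyX = n≢0⇒n>0 λ e → <-irrefl (sym (n≤0⇒n≡0 (≤-trans (large fz) (≤-reflexive (trans (cong (c *_) e) (*-zeroʳ c)))))) 1≤s
    extend : ∀ {v} → v ∈ X → (∀ j → ok v j ≡ true) → Embedding h Vs ⊎ Sparse Vs (sparsity K (suc m) c)
    extend {v} v∈ oks = lift (greedy m (λ i j → h (fs i) (fs j)) (N v) (c * K) λ j → begin
        s ≤⟨ large (fs j) ⟩
        c * length (Vs (fs j)) ≤⟨ *-monoʳ-≤ c (≤ᵇ-true⇒≤ (oks j)) ⟩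
        c * (K * length (N v j)) ≡⟨ sym (*-assoc c K _) ⟩
        c * K * length (N v j) ∎)
      where
      sub : ∀ j → N v j ⊆ Vs (fs j)
      sub j = filterᵇ-⊆ _ (Vs (fs j))
      widen : ∀ (Y : List V) → s ≤ sparsity K m (c * K) * length Y → s ≤ sparsity K (suc m) c * length Y
      widen Y le = ≤-trans le (*-monoˡ-≤ (length Y) (m≤n+m (sparsity K m (c * K)) (c * 2 ^ m)))
      lift : _ → _
      lift (inj₂ (sparse i j i<j b A B A⊆ B⊆ la lb few)) =
        inj₂ (sparse (fs i) (fs j) (s≤s i<j) b A B (⊆-trans A⊆ (sub i)) (⊆-trans B⊆ (sub j)) (widen A la) (widen B lb) few)
      lift (inj₁ (φ , φ∈ , arcs)) = inj₁ (ψ , ψ∈ , λ {i} {j} → ψarcs {i} {j})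
        where
        ψ : Fin (suc m) → V
        ψ fz = v
        ψ (fs i) = φ i
        ψ∈ : ∀ i → ψ i ∈ Vs i
        ψ∈ fz = v∈
        ψ∈ (fs i) = lookup (sub i) (φ∈ i)
        ψarcs : ∀ {i j} → i F.< j → arc T (ψ i) (ψ j) ≡ h i j
        ψarcs {fz} {fs j} _ = agree⇒≡ (h fz (fs j)) (proj₂ (∈-filterᵇ⁻ _ (Vs (fs j)) (φ∈ j)))
        ψarcs {fs i} {fs j} (s≤s lt) = arcs lt
    search : _
    search with any (λ v → all (ok v) (allFin m)) X in eq
    ... | true with any-true⁻ (λ v → all (ok v) (allFin m)) X eq
    ...   | v , v∈ , okv = extend v∈ λ j → all-true⁻ (ok v) (allFin m) okv (∈-allFin j)
    search | false with pigeonhole m (λ j v → not (ok v j)) X nonemptyX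
        (λ {v} v∈ → let j , _ , e = all-false⁻ (ok v) (allFin m) (any-false⁻ _ X eq v∈) in j , cong not e)
    ... | j , le = inj₂ (sparse fz (fs j) (s≤s z≤n) (h fz (fs j)) (filterᵇ (λ v → not (ok v j)) X) (Vs (fs j))
          (filterᵇ-⊆ _ X) ⊆-refl
          (begin
            s ≤⟨ large fz ⟩
            c * length X ≤⟨ *-monoʳ-≤ c le ⟩
            c * (2 ^ m * k) ≡⟨ sym (*-assoc c (2 ^ m) _) ⟩
            c * 2 ^ m * k ≤⟨ *-monoˡ-≤ k (m≤m+n (c * 2 ^ m) (sparsity K m (c * K))) ⟩
            sparsity K (suc m) c * k ∎)
          (begin
            s ≤⟨ large (fs j) ⟩
            c * length (Vs (fs j)) ≤⟨ *-monoˡ-≤ (length (Vs (fs j))) (≤-trans (≤-trans (≤-reflexive (sym (*-identityʳ c))) (*-monoʳ-≤ c (m^n>0 2 m))) (m≤m+n (c * 2 ^ m) (sparsity K m (c * K)))) ⟩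
            sparsity K (suc m) c * length (Vs (fs j)) ∎)
          λ {x} x∈ → <⇒≤ (≤ᵇ-false⇒> (not-true (proj₂ (∈-filterᵇ⁻ (λ v → not (ok v j)) X x∈)))))
      where k = count (λ v → not (ok v j)) X

embedding⇒Contains : ∀ {T H} (tT : IsTournament T) (tH : IsTournament H) (φ : Fin (size H) → Fin (size T)) →
  (∀ {i j} → i ≢ j → φ i ≢ φ j) → (∀ {i j} → i F.< j → arc T (φ i) (φ j) ≡ arc H i j) → Contains T H
embedding⇒Contains {T} {H} tT tH φ inj arcs = φ , injective , preserves
  where
  injective : Injective _≡_ _≡_ φ
  injective {i} {j} e with i F.≟ j
  ... | yes i≡j = i≡j
  ... | no i≢j = ⊥-elim (inj i≢j e)
  preserves : ∀ i j → arc H i j ≡ arc T (φ i) (φ j)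
  preserves i j with <-cmp (toℕ i) (toℕ j)
  ... | tri< lt _ _ = sym (arcs lt)
  ... | tri≈ _ e _ rewrite toℕ-injective e = trans (proj₁ tH j) (sym (proj₁ tT (φ j)))
  ... | tri> _ ne gt = trans (proj₂ tH i j i≢j) (trans (cong not (sym (arcs gt))) (sym (proj₂ tT (φ i) (φ j) (inj i≢j))))
    where
    i≢j : i ≢ j
    i≢j refl = ne refl

module Constants (h : ℕ) where

  -- `2 * suc h` accounts for cutting the set into parts with rounding, `sparsity` for the greedy
  -- embedding, the last 2 for one use of `markov`.
  pairConst : ℕ → ℕ → ℕ
  pairConst K C = C * (2 * suc h) * (2 * sparsity (2 * K) h 1)

  -- `2 ^ N` pays for up to `N` halvings of a block, `2 * K` for the use of `markov` at each of
  -- them.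
  slack : ℕ → ℕ → ℕ
  slack N K = 2 ^ N * (2 * K)

  firstConst : ℕ → ℕ → ℕ → ℕ
  firstConst N K C = pairConst (2 * slack N K) C

  blockConst : ℕ → ℕ → ℕ → ℕ
  blockConst zero    K C = 0
  blockConst (suc N) K C = C * suc h + firstConst N K C * 2 ^ N + blockConst N K (firstConst N K C * 2)

  linConst : ℕ → ℕ → ℕ → ℕ
  linConst m W N = blockConst N (2 * suc W * (2 * m)) 2

  chainConst : ℕ → ℕ → ℕ
  chainConst W N = 2 ^ N * (2 * suc W)

  -- Three demands on `q`, one per summand: the blocks can be found, `τ` is large enough for chain
  -- blocks to be cut into pieces, and the candidates for a centre can be halved once per vertex of
  -- the pattern.
  requirement : ℕ → ℕ → ℕ → ℕ
  requirement m W N = linConst m W N + 4 * chainConst W N + linConst m W N * 2 * 2 ^ m * 2 * (chainConst W N * 2)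

module DensePair {T q} (crit : Critical T q) (H : Digraph) (tH : IsTournament H) (noH : ¬ Contains T H) where
  open CriticalFacts crit
  open Constants (size H)

  -- Density is demanded of every vertex of `P`, not on average, so that it passes to a chain inside
  -- `P`, however small.
  record Pair (K C : ℕ) (X : List V) : Set where
    constructor pair
    field
      P Q : List V
      P⊆ : P ⊆ X
      Q⊆ : Q ⊆ X
      P-linear : Linear (pairConst K C) P
      Q-linear : Linear (pairConst K C) Q
      disjoint : ∀ {x y} → x ∈ P → y ∈ Q → x ≢ y
      dense : ∀ {x} → x ∈ P → K * count (nonArc x) Q ≤ length Q

  densePair : ∀ K C X → C * suc (size H) ≤ q → Linear C X → Pair K C X
  densePair K C X Ch lin = result (greedy h (arc H) Vs 1 λ i → ≤-reflexive (sym (trans (*-identityˡ _) (length-Vs i))))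
    where
    h = size H
    s = length X / suc h
    h<X : suc h ≤ length X
    h<X with suc h ≤? length X
    ... | yes p = p
    ... | no ¬p = ⊥-elim (<-irrefl refl (≤-trans q<n (≤-trans (bound lin) (≤-trans (*-monoʳ-≤ C (<⇒≤ (≰⇒> ¬p))) Ch))))
    X≤ : length X ≤ 2 * suc h * s
    X≤ = div-large (length X) h h<X
    1≤s : 1 ≤ s
    1≤s = n≢0⇒n>0 λ e → <-irrefl refl (≤-trans (s≤s z≤n) (≤-trans h<X (≤-trans X≤ (≤-reflexive (trans (cong (2 * suc h *_) e) (*-zeroʳ (2 * suc h)))))))
    open Greedy T tournament (2 * K) s 1≤s
    Vs : Fin h → List V
    Vs i = chunk (toℕ i) s X
    length-Vs : ∀ i → length (Vs i) ≡ s
    length-Vs i = length-chunk s X (toℕ<n i) (≤-trans (*-monoˡ-≤ s (n≤1+n h)) (≤-trans (≤-reflexive (*-comm (suc h) s)) (m/n*n≤m (length X) (suc h))))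
    Vs-disjoint : ∀ {i j} → i F.< j → ∀ {x y} → x ∈ Vs i → y ∈ Vs j → x ≢ y
    Vs-disjoint lt = chunk-AllPairs s lt (AllPairs-resp-⊆ (⊆base lin) base-uniq)
    sub : ∀ {Y} i → Y ⊆ Vs i → Y ⊆ X
    sub i Y⊆ = ⊆-trans Y⊆ (chunk-⊆ (toℕ i) s X)
    linear-sub : ∀ {Y} i l → Y ⊆ Vs i → s ≤ sparsity (2 * K) h 1 * l → l ≤ 2 * length Y →
                 Linear (pairConst K C) Y
    linear-sub {Y} i l Y⊆ le l≤ = linear (⊆-trans (sub i Y⊆) (⊆base lin)) (begin
      n ≤⟨ bound lin ⟩
      C * length X ≤⟨ *-monoʳ-≤ C X≤ ⟩
      C * (2 * suc h * s) ≤⟨ *-monoʳ-≤ C (*-monoʳ-≤ (2 * suc h) (≤-trans le (*-monoʳ-≤ (sparsity (2 * K) h 1) l≤))) ⟩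
      C * (2 * suc h * (sparsity (2 * K) h 1 * (2 * length Y))) ≡⟨ lem C (2 * suc h) (sparsity (2 * K) h 1) (length Y) ⟩
      pairConst K C * length Y ∎)
      where
      open ≤-Reasoning
      lem : ∀ a b c d → a * (b * (c * (2 * d))) ≡ a * b * (2 * c) * d
      lem = solve-∀
    result : Embedding (arc H) Vs ⊎ Sparse Vs _ → Pair K C X
    result (inj₁ (φ , φ∈ , arcs)) = ⊥-elim (noH (embedding⇒Contains tournament tH φ inj (λ {i} {j} → arcs {i} {j})))
      where
      inj : ∀ {i j} → i ≢ j → φ i ≢ φ j
      inj {i} {j} i≢j with <-cmp (toℕ i) (toℕ j)
      ... | tri< lt _ _ = Vs-disjoint lt (φ∈ i) (φ∈ j)
      ... | tri≈ _ e _ = ⊥-elim (i≢j (toℕ-injective e))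
      ... | tri> _ _ gt = Vs-disjoint gt (φ∈ j) (φ∈ i) ∘ sym
    result (inj₂ (sparse i j i<j false A B A⊆ B⊆ la lb few)) =
      pair A B (sub i A⊆) (sub j B⊆)
        (linear-sub i (length A) A⊆ la (m≤n*m (length A) 2)) (linear-sub j (length B) B⊆ lb (m≤n*m (length B) 2))
        (λ x∈ y∈ → Vs-disjoint i<j (lookup A⊆ x∈) (lookup B⊆ y∈))
        λ {x} x∈ → ≤-trans (*-monoˡ-≤ (count (nonArc x) B) (m≤n*m K 2)) (few x∈)
    -- Few arcs from `A` to `B`: the pair is reversed, after discarding the at most half of `B` that
    -- receives too many of them. The greedy embedding runs with `2 * K` to afford this.
    result (inj₂ (sparse i j i<j true A B A⊆ B⊆ la lb few)) =
      pair B' A (sub j B'⊆) (sub i A⊆)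
        (linear-sub j (length B) B'⊆ lb (markov K (arc T) A B 1≤A few)) (linear-sub i (length A) A⊆ la (m≤n*m (length A) 2))
        (λ x∈ y∈ → Vs-disjoint i<j (lookup A⊆ y∈) (lookup B'⊆ x∈) ∘ sym)
        λ {y} y∈ → ≤-trans (*-monoʳ-≤ K (count-mono (nonArc y) (λ x → arc T x y) A
            λ x∈ e → ¬Arc⇒Arc (Vs-disjoint i<j (lookup A⊆ x∈) (lookup B'⊆ y∈) ∘ sym) (not-true e)))
          (≤ᵇ-true⇒≤ (proj₂ (∈-filterᵇ⁻ (λ y → K * count (λ x → arc T x y) A ≤ᵇ length A) B y∈)))
      where
      B' = filterᵇ (λ y → K * count (λ x → arc T x y) A ≤ᵇ length A) B
      B'⊆ : B' ⊆ Vs j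
      B'⊆ = ⊆-trans (filterᵇ-⊆ _ B) B⊆
      1≤A : 1 ≤ length A
      1≤A = linear-nonempty (linear-sub i (length A) A⊆ la (m≤n*m (length A) 2))

-- Smooth sequences of blocks

module Structure {T q} (crit : Critical T q) (H : Digraph) (tH : IsTournament H) (noH : ¬ Contains T H) where
  open CriticalFacts crit
  open DensePair crit H tH noH
  open Constants (size H)

  record Smooth (K : ℕ) (X Y : List V) : Set where
    constructor smooth
    field
      few-out  : ∀ {x} → x ∈ X → K * count (nonArc x) Y ≤ length Y
      few-in   : ∀ {y} → y ∈ Y → K * count (λ x → nonArc x y) X ≤ length X
      disjoint : ∀ {x y} → x ∈ X → y ∈ Y → x ≢ y
  open Smooth public

  OfKind : Bool → ℕ → ℕ → List V → Set
  OfKind true  C D = Linear C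
  OfKind false C D = LongChain D

  ofKind-nonempty : ∀ b {C D X} → OfKind b C D X → 1 ≤ length X
  ofKind-nonempty true = linear-nonempty
  ofKind-nonempty false = longChain-nonempty

  ofKind-mono : ∀ b {C C' D D' X} → C ≤ C' → D ≤ D' → OfKind b C D X → OfKind b C' D' X
  ofKind-mono true C≤ D≤ = linear-mono C≤
  ofKind-mono false C≤ D≤ = longChain-mono D≤

  ofKind-⊆ : ∀ b {C D X X'} k → X' ⊆ X → length X ≤ k * length X' → OfKind b C D X → OfKind b (C * k) (D * k) X'
  ofKind-⊆ true k = linear-⊆ k
  ofKind-⊆ false k = longChain-⊆ k

  record Blocks (N : ℕ) (kind : ℕ → Bool) (K C : ℕ) (X : List V) : Set where
    constructor blocks
    field
      block    : ℕ → List V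
      inside   : ∀ {i} → i < N → ∀ {x} → x ∈ block i → x ∈ X
      kinds    : ∀ {i} → i < N → OfKind (kind i) (blockConst N K C) (2 ^ N) (block i)
      smoothly : ∀ {i j} → i < j → j < N → Smooth K (block i) (block j)

  module Clean (N K : ℕ) {kind : ℕ → Bool} {C D : ℕ} (S : ℕ → List V)
               (S-kind : ∀ {i} → i < N → OfKind (kind i) C D (S i)) (Z : List V)
               (few-into-Z : ∀ {j} → j < N → ∀ {y} → y ∈ S j → slack N K * count (λ x → nonArc x y) Z ≤ length Z)
               where
    open ≤-Reasoning

    few-into-part : ∀ {M Z'} → M ≤ N → Z' ⊆ Z → length Z ≤ 2 ^ M * length Z' → ∀ {j} → j < N → ∀ {y} → y ∈ S j →
                    2 * K * count (λ x → nonArc x y) Z' ≤ length Z'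
    few-into-part {M} {Z'} M≤N Z'⊆ le j<N {y} y∈ = *-cancelˡ-≤ (2 ^ N) {{m^n≢0 2 N}} (begin
      2 ^ N * (2 * K * count (λ x → nonArc x y) Z') ≡⟨ sym (*-assoc (2 ^ N) (2 * K) (count (λ x → nonArc x y) Z')) ⟩
      slack N K * count (λ x → nonArc x y) Z' ≤⟨ *-monoʳ-≤ (slack N K) (count-mono-⊆ (λ x → nonArc x y) Z'⊆) ⟩
      slack N K * count (λ x → nonArc x y) Z ≤⟨ few-into-Z j<N y∈ ⟩
      length Z ≤⟨ le ⟩
      2 ^ M * length Z' ≤⟨ *-monoˡ-≤ (length Z') (^-monoʳ-≤ 2 M≤N) ⟩
      2 ^ N * length Z' ∎)

    -- A later block may be a chain, too small for the density of the pair to control it. The bound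
    -- in the other direction, from each vertex of the block into `Z`, is therefore turned around by
    -- `markov`, one block at a time.
    clean : ∀ M → M ≤ N → Σ[ Z' ∈ List V ] (Z' ⊆ Z × length Z ≤ 2 ^ M * length Z' ×
      (∀ {x} → x ∈ Z' → ∀ {j} → j < M → K * count (nonArc x) (S j) ≤ length (S j)))
    clean zero _ = Z , ⊆-refl , ≤-reflexive (sym (*-identityˡ _)) , λ _ ()
    clean (suc M) M<N with clean M (<⇒≤ M<N)
    ... | Z' , Z'⊆ , le , few = Z″ , ⊆-trans Z″⊆ Z'⊆ , large″ , few″
      where
      good' : V → Bool
      good' x = K * count (nonArc x) (S M) ≤ᵇ length (S M)
      Z″ = filterᵇ good' Z'
      Z″⊆ = filterᵇ-⊆ good' Z'
      large″ : length Z ≤ 2 ^ suc M * length Z″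
      large″ = begin
        length Z ≤⟨ le ⟩
        2 ^ M * length Z' ≤⟨ *-monoʳ-≤ (2 ^ M) (markov K (λ y x → nonArc x y) (S M) Z'
           (ofKind-nonempty (kind M) (S-kind M<N)) (few-into-part (<⇒≤ M<N) Z'⊆ le M<N)) ⟩
        2 ^ M * (2 * length Z″) ≡⟨ sym (*-assoc (2 ^ M) 2 (length Z″)) ⟩
        2 ^ M * 2 * length Z″ ≡⟨ cong (_* length Z″) (*-comm (2 ^ M) 2) ⟩
        2 ^ suc M * length Z″ ∎
      few″ : ∀ {x} → x ∈ Z″ → ∀ {j} → j < suc M → K * count (nonArc x) (S j) ≤ length (S j)
      few″ x∈ {j} (s≤s j≤M) with m≤n⇒m<n∨m≡n j≤M
      ... | inj₁ j<M = few (lookup Z″⊆ x∈) j<M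
      ... | inj₂ refl = ≤ᵇ-true⇒≤ (proj₂ (∈-filterᵇ⁻ good' Z' x∈))

  -- The first block comes from `P`; the others are found recursively among the vertices of `Q` that
  -- are beaten by almost all of it. Only when these exist can the first block be cleaned against
  -- them.
  findBlocks : ∀ N kind K C X → Linear C X → blockConst N K C ≤ q → Blocks N kind K C X
  findBlocks zero kind K C X lin _ = blocks (λ _ → []) (λ ()) (λ ()) (λ _ ())
  findBlocks (suc N) kind K C X lin small = choose (kind 0) refl (densePair (2 * slack N K) C X Ch≤q lin)
    where
    C₁ = firstConst N K C
    Ch≤q : C * suc (size H) ≤ q
    Ch≤q = ≤-trans (≤-trans (m≤m+n (C * suc (size H)) (C₁ * 2 ^ N))
                            (m≤m+n (C * suc (size H) + C₁ * 2 ^ N) (blockConst N K (C₁ * 2)))) small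
    C₁≤ : C₁ * 2 ^ N ≤ blockConst (suc N) K C
    C₁≤ = ≤-trans (m≤n+m (C₁ * 2 ^ N) (C * suc (size H)))
                  (m≤m+n (C * suc (size H) + C₁ * 2 ^ N) (blockConst N K (C₁ * 2)))
    C₁≤q : C₁ ≤ q
    C₁≤q = ≤-trans (m≤m*n C₁ (2 ^ N) {{m^n≢0 2 N}}) (≤-trans C₁≤ small)
    rec≤ : blockConst N K (C₁ * 2) ≤ blockConst (suc N) K C
    rec≤ = m≤n+m (blockConst N K (C₁ * 2)) (C * suc (size H) + C₁ * 2 ^ N)

    module _ (P Q : List V) (P⊆ : P ⊆ X) (Q⊆ : Q ⊆ X) (Q-linear : Linear C₁ Q)
             (PQ-disjoint : ∀ {x y} → x ∈ P → y ∈ Q → x ≢ y)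
             (dense : ∀ {x} → x ∈ P → 2 * slack N K * count (nonArc x) Q ≤ length Q)
             (Z : List V) (Z-kind : OfKind (kind 0) C₁ 2 Z) (Z⊆P : ∀ {x} → x ∈ Z → x ∈ P) where

      good : V → Bool
      good y = slack N K * count (λ x → nonArc x y) Z ≤ᵇ length Z

      Q' : List V
      Q' = filterᵇ good Q

      Q'-linear : Linear (C₁ * 2) Q'
      Q'-linear = linear-⊆ 2 (filterᵇ-⊆ good Q)
        (markov (slack N K) nonArc Z Q (ofKind-nonempty (kind 0) Z-kind) (λ x∈ → dense (Z⊆P x∈))) Q-linear

      combine : Blocks N (λ i → kind (suc i)) K (C₁ * 2) Q' → Blocks (suc N) kind K C X
      combine (blocks S inside kinds smoothly) = assemble (clean N ≤-refl)
        where
        open Clean N K {λ i → kind (suc i)} S kinds Z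
          (λ j<N y∈ → ≤ᵇ-true⇒≤ (proj₂ (∈-filterᵇ⁻ good Q (inside j<N y∈))))
        assemble : _ → Blocks (suc N) kind K C X
        assemble (Z' , Z'⊆ , Z'-large , Z'-few) = blocks S' inside' kinds' smoothly'
          where
          S' : ℕ → List V
          S' zero = Z'
          S' (suc i) = S i
          inside' : ∀ {i} → i < suc N → ∀ {x} → x ∈ S' i → x ∈ X
          inside' {zero} _ x∈ = lookup P⊆ (Z⊆P (lookup Z'⊆ x∈))
          inside' {suc i} (s≤s i<N) x∈ = lookup Q⊆ (lookup (filterᵇ-⊆ good Q) (inside i<N x∈))
          kinds' : ∀ {i} → i < suc N → OfKind (kind i) (blockConst (suc N) K C) (2 ^ suc N) (S' i)
          kinds' {zero} _ = ofKind-mono (kind 0) C₁≤ ≤-refl (ofKind-⊆ (kind 0) (2 ^ N) Z'⊆ Z'-large Z-kind)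
          kinds' {suc i} (s≤s i<N) = ofKind-mono (kind (suc i)) rec≤ (^-monoʳ-≤ 2 (n≤1+n N)) (kinds i<N)
          smoothly' : ∀ {i j} → i < j → j < suc N → Smooth K (S' i) (S' j)
          smoothly' {zero} {suc j} _ (s≤s j<N) = smooth (λ x∈ → Z'-few x∈ j<N)
            (λ {y} y∈ → ≤-trans (*-monoˡ-≤ (count (λ x → nonArc x y) Z') (m≤n*m K 2))
                          (few-into-part ≤-refl Z'⊆ Z'-large j<N y∈))
            λ x∈ y∈ → PQ-disjoint (Z⊆P (lookup Z'⊆ x∈)) (lookup (filterᵇ-⊆ good Q) (inside j<N y∈))
          smoothly' {suc i} {suc j} (s≤s i<j) (s≤s j<N) = smoothly i<j j<N

      continue : Blocks (suc N) kind K C X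
      continue = combine (findBlocks N (λ i → kind (suc i)) K (C₁ * 2) Q' Q'-linear (≤-trans rec≤ small))

    choose : ∀ b → kind 0 ≡ b → Pair (2 * slack N K) C X → Blocks (suc N) kind K C X
    choose true e (pair P Q P⊆ Q⊆ lP lQ disj dense) =
      continue P Q P⊆ Q⊆ lQ disj dense P (subst (λ b → OfKind b C₁ 2 P) (sym e) lP) (λ x∈ → x∈)
    choose false e (pair P Q P⊆ Q⊆ lP lQ disj dense) with linear-longChain C₁≤q lP
    ... | Z , long , Z⊆P =
      continue P Q P⊆ Q⊆ lQ disj dense Z (subst (λ b → OfKind b C₁ 2 Z) (sym e) long) Z⊆P

-- Embedding component by component

Slot : Set
Slot = ℕ × ℕ

-- A slot is a piece of a block.  Even blocks are linear sets and have one piece only, whatever the index;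
-- odd blocks are chains cut into consecutive pieces.
Before : Slot → Slot → Set
Before (b , a) (b' , a') = b < b' ⊎ (b ≡ b' × isOdd b ≡ true × a < a')

module Slots {T q} (crit : Critical T q) (H : Digraph) (tH : IsTournament H) (noH : ¬ Contains T H) where
  open CriticalFacts crit public
  open Structure crit H tH noH public using (Smooth; smooth; few-out; few-in; disjoint; OfKind; ofKind-mono; ofKind-nonempty; Blocks; blocks; findBlocks)
  open Constants (size H) public

  -- Here `m` is the number of vertices to be placed; smoothness with `2 * m` is what `union-bound`
  -- consumes.
  record Arena (m W N C D : ℕ) : Set where
    field
      St       : Slot → List V
      St-kind  : ∀ {b a} → b < N → a ≤ W → OfKind (not (isOdd b)) C D (St (b , a))
      ordered  : ∀ {b a a'} → isOdd b ≡ true → a < a' → ∀ {x y} → x ∈ St (b , a) → y ∈ St (b , a') → b < N → Arc x y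
      smoothly : ∀ {b a b' a'} → b < b' → b' < N → a ≤ W → a' ≤ W → Smooth (2 * m) (St (b , a)) (St (b' , a'))
      roomy    : C * 2 * 2 ^ m * 2 * (D * 2) ≤ q
      1≤D      : 1 ≤ D

  arena : ∀ m W N → requirement m W N ≤ q → Arena m W N (linConst m W N) (chainConst W N)
  arena m W N big = build (findBlocks N (not ∘ isOdd) K 2 base (linear ⊆-refl base-large) C≤q)
    where
    open ≤-Reasoning
    -- A piece has at least a 1/(2(W+1)) share of its block; the first factor makes up for this and
    -- leaves `2 * m`.
    K = 2 * suc W * (2 * m)
    C = linConst m W N
    D = chainConst W N
    C≤q : C ≤ q
    C≤q = ≤-trans (≤-trans (m≤m+n C (4 * D)) (m≤m+n _ _)) big
    4D≤q : 4 * D ≤ q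
    4D≤q = ≤-trans (≤-trans (m≤n+m (4 * D) C) (m≤m+n (C + 4 * D) (C * 2 * 2 ^ m * 2 * (D * 2)))) big
    room : C * 2 * 2 ^ m * 2 * (D * 2) ≤ q
    room = ≤-trans (m≤n+m (C * 2 * 2 ^ m * 2 * (D * 2)) (C + 4 * D)) big
    1≤D' : 1 ≤ D
    1≤D' = *-mono-≤ (m^n>0 2 N) (s≤s z≤n)
    build : Blocks N (not ∘ isOdd) K 2 base → Arena m W N C D
    build (blocks S inside kinds smoothS) = record
      { St = St ; St-kind = λ {b} b<N a≤W → kind b (isOdd b) refl b<N a≤W ; ordered = λ {b} → ordered b
      ; smoothly = smoothly ; roomy = room ; 1≤D = 1≤D' }
      where
      part : Bool → ℕ → List V → List V
      part false a X = X
      part true  a X = chunk a (length X / suc W) X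
      St : Slot → List V
      St (b , a) = part (isOdd b) a (S b)
      part-⊆ : ∀ o a X → part o a X ⊆ X
      part-⊆ false a X = ⊆-refl
      part-⊆ true a X = chunk-⊆ a _ X
      part-length : ∀ o a X → OfKind (not o) C (2 ^ N) X → a ≤ W → length X ≤ 2 * suc W * length (part o a X)
      part-length false a X _ _ = m≤n*m (length X) (2 * suc W)
      part-length true a X (longChain _ τ≤) a≤W =
        ≤-trans (div-large (length X) W W<X) (*-monoʳ-≤ (2 * suc W) (≤-reflexive (sym
          (length-chunk (length X / suc W) X (s≤s a≤W) (≤-trans (≤-reflexive (*-comm (suc W) _)) (m/n*n≤m (length X) (suc W)))))))
        where
        -- A shorter block would give τ ≤ D, against `τ-large`; so every piece has positive length.
        W<X : suc W ≤ length X
        W<X with suc W ≤? length X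
        ... | yes p = p
        ... | no ¬p = ⊥-elim (<-irrefl refl (<-≤-trans (τ-large D 4D≤q 1≤D') (begin
          τ ≤⟨ τ≤ ⟩
          2 ^ N * length X ≤⟨ *-monoʳ-≤ (2 ^ N) (<⇒≤ (≰⇒> ¬p)) ⟩
          2 ^ N * suc W ≤⟨ *-monoʳ-≤ (2 ^ N) (m≤n*m (suc W) 2) ⟩
          D ∎)))
      kind : ∀ b o → isOdd b ≡ o → ∀ {a} → b < N → a ≤ W → OfKind (not (isOdd b)) C D (St (b , a))
      kind b o e {a} b<N a≤W rewrite e with subst (λ o → OfKind (not o) C (2 ^ N) (S b)) e (kinds b<N)
      ... | k with o
      ...   | false = k
      ...   | true = longChain-⊆ (2 * suc W) (part-⊆ true a (S b)) (part-length true a (S b) k a≤W) k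
      ordered : ∀ b {a a'} → isOdd b ≡ true → a < a' → ∀ {x y} → x ∈ St (b , a) → y ∈ St (b , a') → b < N → Arc x y
      ordered b e a<a' x∈ y∈ b<N with subst (λ o → OfKind (not o) C (2 ^ N) (S b)) e (kinds b<N)
      ... | k rewrite e = chunk-AllPairs _ a<a' (chain k) x∈ y∈
      shrink : ∀ {b} a (p : V → Bool) → b < N → a ≤ W → K * count p (S b) ≤ length (S b) →
               2 * m * count p (St (b , a)) ≤ length (St (b , a))
      shrink {b} a p b<N a≤W le = *-cancelˡ-≤ (2 * suc W) (begin
        2 * suc W * (2 * m * count p (St (b , a))) ≡⟨ sym (*-assoc (2 * suc W) (2 * m) _) ⟩
        K * count p (St (b , a)) ≤⟨ *-monoʳ-≤ K (count-mono-⊆ p (part-⊆ (isOdd b) a (S b))) ⟩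
        K * count p (S b) ≤⟨ le ⟩
        length (S b) ≤⟨ part-length (isOdd b) a (S b) (kinds b<N) a≤W ⟩
        2 * suc W * length (St (b , a)) ∎)
      smoothly : ∀ {b a b' a'} → b < b' → b' < N → a ≤ W → a' ≤ W → Smooth (2 * m) (St (b , a)) (St (b' , a'))
      smoothly {b} {a} {b'} {a'} b<b' b'<N a≤W a'≤W = smooth
        (λ {x} x∈ → shrink a' (nonArc x) b'<N a'≤W (few-out sm (in-b x∈)))
        (λ {y} y∈ → shrink a (λ x → nonArc x y) (<-trans b<b' b'<N) a≤W (few-in sm (in-b' y∈)))
        λ x∈ y∈ → disjoint sm (in-b x∈) (in-b' y∈)
        where
        sm = smoothS b<b' b'<N
        in-b : ∀ {x} → x ∈ St (b , a) → x ∈ S b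
        in-b = lookup (part-⊆ (isOdd b) a (S b))
        in-b' : ∀ {x} → x ∈ St (b' , a') → x ∈ S b'
        in-b' = lookup (part-⊆ (isOdd b') a' (S b'))

  module Place {m W N C D : ℕ} (ar : Arena m W N C D) where
    open Arena ar public

    Valid : Slot → Set
    Valid (b , a) = b < N × a ≤ W

    before-disjoint : ∀ {s t} → Valid s → Valid t → Before s t → ∀ {x y} → x ∈ St s → y ∈ St t → x ≢ y
    before-disjoint (_ , a≤) (b'< , a'≤) (inj₁ b<b') = disjoint (smoothly b<b' b'< a≤ a'≤)
    before-disjoint (b< , _) _ (inj₂ (refl , odd , a<a')) x∈ y∈ = Arc⇒≢ (ordered odd a<a' x∈ y∈ b<)

    before-few-out : ∀ {s t} → Valid s → Valid t → Before s t → ∀ {x} → x ∈ St s →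
                     2 * m * count (nonArc x) (St t) ≤ length (St t)
    before-few-out (_ , a≤) (b'< , a'≤) (inj₁ b<b') = few-out (smoothly b<b' b'< a≤ a'≤)
    before-few-out {t = t} (b< , _) _ (inj₂ (refl , odd , a<a')) {x} x∈
      rewrite count-none (nonArc x) (St t) (λ y∈ → cong not (ordered odd a<a' x∈ y∈ b<)) =
      ≤-trans (≤-reflexive (*-zeroʳ (2 * m))) z≤n

    before-few-in : ∀ {s t} → Valid s → Valid t → Before s t → ∀ {y} → y ∈ St t →
                    2 * m * count (λ x → nonArc x y) (St s) ≤ length (St s)
    before-few-in (_ , a≤) (b'< , a'≤) (inj₁ b<b') = few-in (smoothly b<b' b'< a≤ a'≤)
    before-few-in {s} (b< , _) _ (inj₂ (refl , odd , a<a')) {y} y∈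
      rewrite count-none (λ x → nonArc x y) (St s) (λ x∈ → cong not (ordered odd a<a' x∈ y∈ b<)) =
      ≤-trans (≤-reflexive (*-zeroʳ (2 * m))) z≤n

    St-linear : ∀ {b a} → isOdd b ≡ false → Valid (b , a) → Linear C (St (b , a))
    St-linear {b} {a} e (b< , a≤) = subst (λ o → OfKind (not o) C D (St (b , a))) e (St-kind b< a≤)

    St-chain : ∀ {b a} → isOdd b ≡ true → Valid (b , a) → LongChain D (St (b , a))
    St-chain {b} {a} e (b< , a≤) = subst (λ o → OfKind (not o) C D (St (b , a))) e (St-kind b< a≤)

    St-nonempty : ∀ {b a} → Valid (b , a) → 1 ≤ length (St (b , a))
    St-nonempty {b} (b< , a≤) = ofKind-nonempty (not (isOdd b)) (St-kind b< a≤)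

    -- `comp` numbers the components of the backward graph in the order of placement. Arcs between
    -- different components are forward, the typical case for smooth slots; backward arcs have to be
    -- forced inside a component only.
    module Assemble {U : Set} (us : List U) (us-complete : ∀ u → u ∈ us) (m≡ : m ≡ length us)
                    (h : U → U → Bool) (irrefl-h : ∀ u → h u u ≡ false)
                    (slot : U → Slot) (valid : ∀ u → Valid (slot u)) (comp : U → ℕ) where

      SU : U → List V
      SU u = St (slot u)

      Forward : U → U → Set
      Forward u v = Before (slot u) (slot v) × h u v ≡ true × h v u ≡ false

      Backward : U → U → Set
      Backward u v = Before (slot u) (slot v) × h u v ≡ false × h v u ≡ true

      Large : (U → List V) → ℕ → Set
      Large A k = ∀ u → comp u ≡ k → A u ⊆ SU u × length (SU u) ≤ 2 * length (A u)

      -- Half of each slot is what the vertices placed earlier leave over, so the component must be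
      -- realizable in arbitrary halves.
      Gadget : ℕ → Set
      Gadget k = ∀ (A : U → List V) → Large A k →
        Σ[ ψ ∈ (∀ u → comp u ≡ k → V) ] ((∀ u p → ψ u p ∈ A u) × (∀ u v p r → arc T (ψ u p) (ψ v r) ≡ h u v))

      Partial : ℕ → (U → V) → Set
      Partial k φ = (∀ u → comp u < k → φ u ∈ SU u) × (∀ u v → comp u < k → comp v < k → arc T (φ u) (φ v) ≡ h u v)

      module _ (compat : ∀ u v → comp u ≢ comp v → Forward u v ⊎ Forward v u) where

        module Extend (k : ℕ) (φ : U → V) (φ∈ : ∀ u → comp u < k → φ u ∈ SU u)
                      (φ-arc : ∀ u v → comp u < k → comp v < k → arc T (φ u) (φ v) ≡ h u v) where

          -- Vacuous for vertices of components not yet placed, so that the union bound can always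
          -- run over all of `us`.
          test : U → U → V → Bool
          test v u y = if comp u <ᵇ k then agree (arc T (φ u) y) (h u v) ∧ agree (arc T y (φ u)) (h v u) else true

          A : U → List V
          A v = filterᵇ (λ y → all (λ u → test v u y) us) (SU v)

          placed : ∀ u → (comp u <ᵇ k) ≡ true → comp u < k
          placed u e = <ᵇ⇒< (comp u) k (≡true⇒T e)

          few : ∀ v → comp v ≡ k → ∀ u → 2 * m * count (not ∘ test v u) (SU v) ≤ length (SU v)
          few v refl u with comp u <ᵇ k in eq
          ... | false rewrite count-none (λ _ → false) (SU v) (λ _ → refl) =
                ≤-trans (≤-reflexive (*-zeroʳ (2 * m))) z≤n
          ... | true with compat u v (λ e → <-irrefl e (placed u eq))
          ...   | inj₁ (bef , e₁ , e₂) rewrite e₁ | e₂ = ≤-trans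
                  (*-monoʳ-≤ (2 * m) (count-mono _ (nonArc (φ u)) (SU v) λ {y} _ e → bad y e))
                  (before-few-out (valid u) (valid v) bef (φ∈ u (placed u eq)))
                  where
                  bad : ∀ y → not (arc T (φ u) y ∧ not (arc T y (φ u))) ≡ true → nonArc (φ u) y ≡ true
                  bad y e with arc T (φ u) y in a
                  ... | false = refl
                  ... | true rewrite Arc-asym a = e
          ...   | inj₂ (bef , e₁ , e₂) rewrite e₁ | e₂ = ≤-trans
                  (*-monoʳ-≤ (2 * m) (count-mono _ (λ y → nonArc y (φ u)) (SU v) λ {y} _ e → bad y e))
                  (before-few-in (valid v) (valid u) bef (φ∈ u (placed u eq)))
                  where
                  bad : ∀ y → not (not (arc T (φ u) y) ∧ arc T y (φ u)) ≡ true → nonArc y (φ u) ≡ true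
                  bad y e with arc T y (φ u) in a
                  ... | false = refl
                  ... | true rewrite Arc-asym a = e

          A-large : Large A k
          A-large v e = filterᵇ-⊆ _ (SU v) , union-bound (test v) us (SU v) (∈⇒nonempty (us-complete v))
            λ {u} _ → subst (λ l → 2 * l * count (not ∘ test v u) (SU v) ≤ length (SU v)) m≡ (few v e u)

          test-true : ∀ v u y → comp u < k → test v u y ≡ true → arc T (φ u) y ≡ h u v × arc T y (φ u) ≡ h v u
          test-true v u y lt t rewrite T⇒≡true (<⇒<ᵇ lt) with ∧-true⁻ t
          ... | t₁ , t₂ = agree⇒≡ (h u v) t₁ , agree⇒≡ (h v u) t₂

          below : ∀ {u} → comp u < suc k → comp u ≢ k → comp u < k
          below (s≤s le) ne = ≤∧≢⇒< le ne

          mixed : ∀ u v y → y ∈ A v → comp u < k → arc T (φ u) y ≡ h u v × arc T y (φ u) ≡ h v u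
          mixed u v y y∈ lt = test-true v u y lt
            (all-true⁻ (λ u → test v u y) us (proj₂ (∈-filterᵇ⁻ (λ y → all (λ u → test v u y) us) (SU v) y∈)) (us-complete u))

          module _ (ψ : ∀ u → comp u ≡ k → V) (ψ∈ : ∀ u p → ψ u p ∈ A u)
                   (ψ-arc : ∀ u v p r → arc T (ψ u p) (ψ v r) ≡ h u v) where

            merge : U → V
            merge u with comp u ≟ k
            ... | yes p = ψ u p
            ... | no _  = φ u

            merge∈ : ∀ u → comp u < suc k → merge u ∈ SU u
            merge∈ u lt with comp u ≟ k
            ... | yes p = lookup (proj₁ (A-large u p)) (ψ∈ u p)
            ... | no ne = φ∈ u (below lt ne)

            merge-arc : ∀ u v → comp u < suc k → comp v < suc k → arc T (merge u) (merge v) ≡ h u v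
            merge-arc u v lu lv with comp u ≟ k | comp v ≟ k
            ... | yes p | yes r = ψ-arc u v p r
            ... | yes p | no ne = proj₂ (mixed v u (ψ u p) (ψ∈ u p) (below lv ne))
            ... | no ne | yes r = proj₁ (mixed u v (ψ v r) (ψ∈ v r) (below lu ne))
            ... | no ne | no ne' = φ-arc u v (below lu ne) (below lv ne')

        extend : ∀ k φ → Partial k φ → Gadget k → Σ[ φ' ∈ (U → V) ] Partial (suc k) φ'
        extend k φ (φ∈ , φ-arc) gadget with gadget (Extend.A k φ φ∈ φ-arc) (Extend.A-large k φ φ∈ φ-arc)
        ... | ψ , ψ∈ , ψ-arc = merge ψ ψ∈ ψ-arc , merge∈ ψ ψ∈ ψ-arc , merge-arc ψ ψ∈ ψ-arc
          where open Extend k φ φ∈ φ-arc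

        assemble : ∀ j k φ → Partial k φ → (∀ i → k ≤ i → i < k + j → Gadget i) → (∀ u → comp u < k + j) →
                   Σ[ φ' ∈ (U → V) ] (∀ u v → arc T (φ' u) (φ' v) ≡ h u v)
        assemble zero k φ (_ , φ-arc) _ all< =
          φ , λ u v → φ-arc u v (subst (comp u <_) (+-identityʳ k) (all< u)) (subst (comp v <_) (+-identityʳ k) (all< v))
        assemble (suc j) k φ part gadgets all< with extend k φ part (gadgets k ≤-refl (m<m+n k (s≤s z≤n)))
        ... | φ' , part' = assemble j (suc k) φ' part'
              (λ i k<i i< → gadgets i (<⇒≤ k<i) (subst (i <_) (sym (+-suc k j)) i<))
              λ u → subst (comp u <_) (+-suc k j) (all< u)

      large⇒nonempty : ∀ {A : U → List V} {u} → length (SU u) ≤ 2 * length (A u) → ∃ λ x → x ∈ A u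
      large⇒nonempty {A} {u} le with A u
      ... | x ∷ _ = x , here refl
      ... | [] = ⊥-elim (<-irrefl refl (≤-trans (St-nonempty (valid u)) le))

      single : ∀ {k} → (∀ u v → comp u ≡ k → comp v ≡ k → u ≡ v) → Gadget k
      single {k} unique A large = ψ , ψ∈ , arcs
        where
        ψ : ∀ u → comp u ≡ k → V
        ψ u p = proj₁ (large⇒nonempty {A} {u} (proj₂ (large u p)))
        ψ∈ : ∀ u p → ψ u p ∈ A u
        ψ∈ u p = proj₂ (large⇒nonempty {A} {u} (proj₂ (large u p)))
        arcs : ∀ u v p r → arc T (ψ u p) (ψ v r) ≡ h u v
        arcs u v p r with unique u v p r
        ... | refl with ≡-irrelevant p r
        ...   | refl = trans (proj₁ tournament (ψ u p)) (sym (irrefl-h u))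

      large-linear : ∀ {A k u} → Large A k → comp u ≡ k → isOdd (proj₁ (slot u)) ≡ false → Linear (C * 2) (A u)
      large-linear {A} {k} {u} large p e = linear-⊆ 2 (proj₁ (large u p)) (proj₂ (large u p)) (St-linear e (valid u))

      large-chain : ∀ {A k u} → Large A k → comp u ≡ k → isOdd (proj₁ (slot u)) ≡ true → LongChain (D * 2) (A u)
      large-chain {A} {k} {u} large p e = longChain-⊆ 2 (proj₁ (large u p)) (proj₂ (large u p)) (St-chain e (valid u))

      record Leaf (c u : U) : Set where
        constructor leaf
        field
          odd  : isOdd (proj₁ (slot u)) ≡ true
          back : Backward u c ⊎ Backward c u

      Attached : (A : U → List V) → U → U → V → Set
      Attached A c u x = Σ[ y ∈ V ] (y ∈ A u × arc T x y ≡ h c u × arc T y x ≡ h u c)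

      -- Half of the candidates for the centre have a suitable neighbour in the chain `A u`. Only
      -- the candidates shrink; the chain stays as it is.
      attach : ∀ {A k c u E X} → Large A k → comp u ≡ k → Leaf c u → E * 2 * (D * 2) ≤ q → Linear E X →
        (∀ {x} → x ∈ X → x ∈ SU c) → Σ[ X' ∈ List V ] (X' ⊆ X × Linear (E * 2) X' × (∀ {x} → x ∈ X' → Attached A c u x))
      attach {A} {k} {c} {u} {E} large p (leaf odd (inj₁ (bef , e₁ , e₂))) ED lin inSU
        with refine-out {E} {D * 2} ED (≤-trans 1≤D (m≤m*n D 2)) lin (large-chain large p odd)
             (λ x∈ y∈ e → before-disjoint (valid u) (valid c) bef (lookup (proj₁ (large u p)) y∈) (inSU x∈) (sym e))
      ... | X' , X'⊆ , lin' , nb = X' , X'⊆ , lin' , λ x∈ →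
            let y , y∈ , a = nb x∈ in y , y∈ , trans a (sym e₂) , trans (Arc-asym a) (sym e₁)
      attach {A} {k} {c} {u} {E} large p (leaf odd (inj₂ (bef , e₁ , e₂))) ED lin inSU
        with refine-in {E} {D * 2} ED (≤-trans 1≤D (m≤m*n D 2)) lin (large-chain large p odd)
             (λ x∈ y∈ → before-disjoint (valid c) (valid u) bef (inSU x∈) (lookup (proj₁ (large u p)) y∈))
      ... | X' , X'⊆ , lin' , nb = X' , X'⊆ , lin' , λ x∈ →
            let y , y∈ , a = nb x∈ in y , y∈ , trans (Arc-asym a) (sym e₁) , trans a (sym e₂)

      -- For leaves in different pieces of one chain block, the arc between them is right whichever
      -- vertices are chosen.
      Aligned : U → U → Set
      Aligned u v = proj₁ (slot u) ≡ proj₁ (slot v) × proj₂ (slot u) < proj₂ (slot v) × h u v ≡ true × h v u ≡ false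

      module _ {k} (c : U) (c∈k : comp c ≡ k) (c-even : isOdd (proj₁ (slot c)) ≡ false)
               (classify : ∀ u → comp u ≡ k → u ≡ c ⊎ Leaf c u)
               where

        private
          Reached : (A : U → List V) → U → V → Set
          Reached A u x = comp u ≡ k → u ≡ c ⊎ (Leaf c u × Attached A c u x)

        -- A factor 2 is reserved for every vertex of the list, leaf or not, which keeps the bound
        -- independent of the star.
        attachAll : ∀ {A} → Large A k → ∀ ws E X → Linear E X → (∀ {x} → x ∈ X → x ∈ SU c) →
          E * 2 ^ length ws * (D * 2) ≤ q →
          Σ[ X' ∈ List V ] (X' ⊆ X × Linear (E * 2 ^ length ws) X' × (∀ {x u} → x ∈ X' → u ∈ ws → Reached A u x))
        attachAll large [] E X lin inSU room = X , ⊆-refl , linear-mono (m≤m*n E 1) lin , λ _ ()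
        attachAll {A} large (w ∷ ws) E X lin inSU room with attachAll large ws E X lin inSU
          (≤-trans (*-monoˡ-≤ (D * 2) (*-monoʳ-≤ E (^-monoʳ-≤ 2 (n≤1+n (length ws))))) room)
        ... | X₁ , X₁⊆ , lin₁ , reach₁ = step
          where
          Goal = Σ[ X' ∈ List V ] (X' ⊆ X × Linear (E * 2 ^ suc (length ws)) X' × (∀ {x u} → x ∈ X' → u ∈ (w ∷ ws) → Reached A u x))
          assoc : E * 2 ^ length ws * 2 ≡ E * 2 ^ suc (length ws)
          assoc = trans (*-assoc E (2 ^ length ws) 2) (cong (E *_) (*-comm (2 ^ length ws) 2))
          keep : (∀ {x} → x ∈ X₁ → Reached A w x) → Goal
          keep r = X₁ , X₁⊆ , linear-mono (*-monoʳ-≤ E (^-monoʳ-≤ 2 (n≤1+n (length ws)))) lin₁ ,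
            λ { x∈ (here refl) → r x∈ ; x∈ (there u∈) → reach₁ x∈ u∈ }
          step : Goal
          step with comp w ≟ k
          ... | no ne = keep λ _ p → ⊥-elim (ne p)
          ... | yes p with classify w p
          ...   | inj₁ e = keep λ _ _ → inj₁ e
          ...   | inj₂ lf with attach large p lf (subst (λ z → z * (D * 2) ≤ q) (sym assoc) room) lin₁ (λ x∈ → inSU (lookup X₁⊆ x∈))
          ...     | X₂ , X₂⊆ , lin₂ , att = X₂ , ⊆-trans X₂⊆ X₁⊆ , subst (λ z → Linear z X₂) assoc lin₂ ,
                    λ { x∈ (here refl) _ → inj₂ (lf , att x∈) ; x∈ (there u∈) → reach₁ (lookup X₂⊆ x∈) u∈ }

        module _ {A : U → List V} (large : Large A k) (x : V) (x∈A : x ∈ A c) (reached : ∀ u → Reached A u x) where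

          private
            value : ∀ {u} → u ≡ c ⊎ (Leaf c u × Attached A c u x) → V
            value (inj₁ _) = x
            value (inj₂ (_ , y , _)) = y

            value∈ : ∀ {u} (r : u ≡ c ⊎ (Leaf c u × Attached A c u x)) → value r ∈ A u
            value∈ (inj₁ refl) = x∈A
            value∈ (inj₂ (_ , _ , y∈ , _)) = y∈

            inSU : ∀ {u} → comp u ≡ k → ∀ {y} → y ∈ A u → y ∈ SU u
            inSU {u} p = lookup (proj₁ (large u p))

            aligned-arc : ∀ {u v} → Leaf c u → Aligned u v → ∀ {y z} → y ∈ SU u → z ∈ SU v → Arc y z
            aligned-arc {u} {v} lu (e , lt , _) {y} y∈ z∈ =
              ordered (trans (cong isOdd (sym e)) (Leaf.odd lu)) lt
                (subst (λ b → y ∈ St (b , proj₂ (slot u))) e y∈) z∈ (proj₁ (valid v))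

            -- `ru` and `rv` may classify the same vertex through different proofs; the last
            -- hypothesis makes the chosen values agree.
            value-arc : ∀ {u v} → comp u ≡ k → comp v ≡ k →
              (Leaf c u → Leaf c v → u ≡ v ⊎ (Aligned u v ⊎ Aligned v u)) →
              (ru : u ≡ c ⊎ (Leaf c u × Attached A c u x)) (rv : v ≡ c ⊎ (Leaf c v × Attached A c v x)) →
              (u ≡ v → value ru ≡ value rv) → arc T (value ru) (value rv) ≡ h u v
            value-arc p r al (inj₁ refl) (inj₁ refl) same = trans (proj₁ tournament x) (sym (irrefl-h c))
            value-arc p r al (inj₁ refl) (inj₂ (_ , y , y∈ , a₁ , a₂)) same = a₁
            value-arc p r al (inj₂ (_ , y , y∈ , a₁ , a₂)) (inj₁ refl) same = a₂
            value-arc {u} p r al (inj₂ (lu , y , y∈ , _)) (inj₂ (lv , z , z∈ , _)) same with al lu lv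
            ... | inj₁ refl rewrite same refl = trans (proj₁ tournament z) (sym (irrefl-h u))
            ... | inj₂ (inj₁ uv@(_ , _ , e , _)) = trans (aligned-arc lu uv (inSU p y∈) (inSU r z∈)) (sym e)
            ... | inj₂ (inj₂ vu@(_ , _ , _ , e)) = trans (Arc-asym (aligned-arc lv vu (inSU r z∈) (inSU p y∈))) (sym e)

          starAt : (∀ u v → comp u ≡ k → comp v ≡ k → Leaf c u → Leaf c v → u ≡ v ⊎ (Aligned u v ⊎ Aligned v u)) →
            Σ[ ψ ∈ (∀ u → comp u ≡ k → V) ] ((∀ u p → ψ u p ∈ A u) × (∀ u v p r → arc T (ψ u p) (ψ v r) ≡ h u v))
          starAt aligned = (λ u p → value (reached u p)) , (λ u p → value∈ (reached u p)) ,
            λ u v p r → value-arc p r (aligned u v p r) (reached u p) (reached v r)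
              λ { refl → cong (λ p → value (reached u p)) (≡-irrelevant p r) }

        star : (∀ u v → comp u ≡ k → comp v ≡ k → Leaf c u → Leaf c v → u ≡ v ⊎ (Aligned u v ⊎ Aligned v u)) → Gadget k
        star aligned A large with attachAll large us (C * 2) (A c) (large-linear large c∈k c-even) (lookup (proj₁ (large c c∈k)))
            (≤-trans (*-monoˡ-≤ (D * 2) (subst (λ l → C * 2 * 2 ^ length us ≤ C * 2 * 2 ^ l * 2) (sym m≡) (m≤m*n (C * 2 * 2 ^ length us) 2))) roomy)
        ... | X' , X'⊆ , lin , reach with nonempty X' (linear-nonempty lin)
        ...   | x , x∈ = starAt large x (lookup X'⊆ x∈) (λ u → reach x∈ (us-complete u)) aligned

-- Patterns: a head, a galaxy and one inserted vertex

data Vtx (a r : ℕ) : Set where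
  hd  : Fin a → Vtx a r
  tl  : Fin r → Vtx a r
  ins : Vtx a r

vtx : ∀ {a r} {P : Vtx a r → Set} → (∀ x → P (hd x)) → (∀ g → P (tl g)) → P ins → ∀ u → P u
vtx p q r (hd x) = p x
vtx p q r (tl g) = q g
vtx p q r ins = r

eqFin : ∀ {n} → Fin n → Fin n → Bool
eqFin i j = toℕ i ≡ᵇ toℕ j

-- A head on a vertices, all of whose edges to the tail G point forward, and one more vertex `ins`
-- placed after the first s vertices of G, whose only edge to the head pointing backward ends in β.
patternArc : ∀ {a} (hh : Fin a → Fin a → Bool) (β : Fin a) (G : Digraph) (s : ℕ) →
  Vtx a (size G) → Vtx a (size G) → Bool
patternArc hh β G s (hd x) (hd y) = hh x y
patternArc hh β G s (hd x) (tl _) = true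
patternArc hh β G s (hd x) ins    = not (eqFin x β)
patternArc hh β G s (tl _) (hd y) = false
patternArc hh β G s (tl g) (tl k) = arc G g k
patternArc hh β G s (tl g) ins    = toℕ g <ᵇ s
patternArc hh β G s ins    (hd y) = eqFin y β
patternArc hh β G s ins    (tl g) = not (toℕ g <ᵇ s)
patternArc hh β G s ins    ins    = false

vertices : ∀ a r → List (Vtx a r)
vertices a r = map hd (allFin a) ++ ins ∷ map tl (allFin r)

vertices-complete : ∀ {a r} (u : Vtx a r) → u ∈ vertices a r
vertices-complete (hd x) = ∈-++⁺ˡ (∈-map⁺ hd (∈-allFin x))
vertices-complete {a} (tl g) = ∈-++⁺ʳ (map hd (allFin a)) (there (∈-map⁺ tl (∈-allFin g)))
vertices-complete {a} ins = ∈-++⁺ʳ (map hd (allFin a)) (here refl)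

isOdd-+ : ∀ a b → isOdd a ≡ false → isOdd (a + b) ≡ isOdd b
isOdd-+ zero b _ = refl
isOdd-+ (suc (suc a)) b e = trans (Bool.not-involutive (isOdd (a + b))) (isOdd-+ a b (trans (sym (Bool.not-involutive (isOdd a))) e))

isOdd-2* : ∀ a → isOdd (2 * a) ≡ false
isOdd-2* zero = refl
isOdd-2* (suc a) = trans (cong (not ∘ isOdd) (+-suc a (a + 0))) (trans (Bool.not-involutive (isOdd (2 * a))) (isOdd-2* a))

-- Leaves of one star must share a chain block, so that the edges between them are forward.
record Layout (G : Digraph) (ctr : Fin (size G) → Fin (size G)) (s : ℕ) : Set where
  field
    blk         : Fin (size G) → ℕ
    insBlk      : ℕ
    len         : ℕ
    1≤blk       : ∀ g → 1 ≤ blk g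
    1≤insBlk    : 1 ≤ insBlk
    blk<len     : ∀ g → blk g < len
    insBlk<len  : insBlk < len
    leaf-odd    : ∀ {g} → IsLeaf G ctr g → isOdd (blk g) ≡ true
    centre-even : ∀ {g} → IsLeaf G ctr g → isOdd (blk (ctr g)) ≡ false
    monotone    : ∀ {g k} → toℕ g < toℕ k → blk g < blk k ⊎ (blk g ≡ blk k × isOdd (blk g) ≡ true)
    leaves      : ∀ {g k} → IsLeaf G ctr g → IsLeaf G ctr k → ctr g ≡ ctr k → blk g ≡ blk k
    ins-after   : ∀ {g} → toℕ g < s → blk g < insBlk ⊎ (blk g ≡ insBlk × isOdd (blk g) ≡ true)
    ins-before  : ∀ {g} → s ≤ toℕ g → insBlk < blk g ⊎ (insBlk ≡ blk g × isOdd insBlk ≡ true)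

module Pattern {a} (hh : Fin a → Fin a → Bool) (β : Fin a) (G : Digraph) (s : ℕ)
               (hh-irrefl : ∀ x → hh x x ≡ false) (hh-anti : ∀ x y → x ≢ y → hh x y ≡ not (hh y x))
               (tG : IsTournament G) where
  r : ℕ
  r = size G

  U : Set
  U = Vtx a r

  h : U → U → Bool
  h = patternArc hh β G s

  h-irrefl : ∀ u → h u u ≡ false
  h-irrefl (hd x) = hh-irrefl x
  h-irrefl (tl g) = proj₁ tG g
  h-irrefl ins = refl

  h-anti : ∀ u v → u ≢ v → h u v ≡ not (h v u)
  h-anti (hd x) (hd y) ne = hh-anti x y (ne ∘ cong hd)
  h-anti (hd x) (tl g) ne = refl
  h-anti (hd x) ins ne = refl
  h-anti (tl g) (hd y) ne = refl
  h-anti (tl g) (tl k) ne = proj₂ tG g k (ne ∘ cong tl)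
  h-anti (tl g) ins ne = sym (Bool.not-involutive _)
  h-anti ins (hd y) ne = sym (Bool.not-involutive _)
  h-anti ins (tl g) ne = refl
  h-anti ins ins ne = ⊥-elim (ne refl)

  -- An injection into the pattern is enough: a realization of the pattern then contains `D`.
  record Presents (D : Digraph) : Set where
    field
      f       : Fin (size D) → U
      f-inj   : ∀ {i j} → f i ≡ f j → i ≡ j
      arc-f   : ∀ i j → arc D i j ≡ h (f i) (f j)

    isTournament : IsTournament D
    isTournament = (λ i → trans (arc-f i i) (h-irrefl (f i))) ,
      λ i j ne → trans (arc-f i j) (trans (h-anti (f i) (f j) (ne ∘ f-inj)) (cong not (sym (arc-f j i))))

    -- Injectivity follows from the arcs: a collision would make both arcs between two distinct
    -- vertices of the pattern absent.
    embed : ∀ {T} → IsTournament T → (φ : U → Fin (size T)) → (∀ u v → arc T (φ u) (φ v) ≡ h u v) → Contains T D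
    embed {T} tT φ φ-arc = (λ i → φ (f i)) , injective , λ i j → trans (arc-f i j) (sym (φ-arc (f i) (f j)))
      where
      loop : ∀ u v → φ u ≡ φ v → h u v ≡ false
      loop u v e = trans (sym (φ-arc u v)) (trans (cong (arc T (φ u)) (sym e)) (proj₁ tT (φ u)))
      injective : ∀ {i j} → φ (f i) ≡ φ (f j) → i ≡ j
      injective {i} {j} e with i F.≟ j
      ... | yes i≡j = i≡j
      ... | no ne with () ← trans (sym (loop (f i) (f j) e))
                    (trans (h-anti (f i) (f j) (ne ∘ f-inj)) (cong not (loop (f j) (f i) (sym e))))

module Placing {T q} (crit : Critical T q) (D : Digraph) (tD : IsTournament D) (noD : ¬ Contains T D) where
  open Slots crit D tD noD

  module Placement {m W N C E : ℕ} (ar : Arena m W N C E)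
    {a} (hh : Fin a → Fin a → Bool) (β : Fin a) (G : Digraph) (s : ℕ)
    (hh-irrefl : ∀ x → hh x x ≡ false) (hh-anti : ∀ x y → x ≢ y → hh x y ≡ not (hh y x))
    (tG : IsTournament G) (ctr : Fin (size G) → Fin (size G)) (stars : StarStructure G ctr) (s≤r : s ≤ size G)
    (m≡ : m ≡ length (vertices a (size G)))
    (ly : Layout G ctr s) (off e : ℕ) (off-even : isOdd off ≡ false)
    (off≤N : off + Layout.len ly ≤ N) (e≤W : 2 * size G + suc e ≤ W)
    (hslot : Fin a → Slot) (hcomp : Fin a → ℕ) (nh : ℕ) where
    open Pattern hh β G s hh-irrefl hh-anti tG public
    open Place ar public
    open Layout ly
    open StarStructure stars

    -- Up to the shift `e`, tail vertices get odd pieces and `ins` the even piece `2 * s`, which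
    -- separates the first `s` of them from the rest even within one chain. The shift reserves the
    -- first `e` pieces for the head.
    slot : U → Slot
    slot (hd x) = hslot x
    slot (tl g) = off + blk g , suc (2 * toℕ g + e)
    slot ins    = off + insBlk , 2 * s + e

    -- `ins` joins the component of `β`, its only neighbour in the backward graph; a star of the
    -- tail is numbered by its centre.
    comp : U → ℕ
    comp (hd x) = hcomp x
    comp (tl g) = nh + toℕ (ctr g)
    comp ins    = hcomp β

    odd-off : ∀ b → isOdd (off + b) ≡ isOdd b
    odd-off b = isOdd-+ off b off-even

    beforeᵇ : Slot → Slot → Bool
    beforeᵇ (b , p) (b' , p') = (b <ᵇ b') ∨ ((b ≡ᵇ b') ∧ (isOdd b ∧ (p <ᵇ p')))

    -- Boolean, so that a concrete arrangement of the head is checked by evaluation.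
    compatᵇ : Fin a → Fin a → Bool
    compatᵇ x y = (hcomp x ≡ᵇ hcomp y) ∨ (beforeᵇ (hslot x) (hslot y) ∧ (hh x y ∧ not (hh y x)))
                                       ∨ (beforeᵇ (hslot y) (hslot x) ∧ (hh y x ∧ not (hh x y)))

    -- Tail and `ins` start at block `off + 1` and use no piece below `e`; a head vertex may share
    -- that block in a lower piece.
    EarlyHead : Fin a → Set
    EarlyHead x = proj₁ (hslot x) < suc off ⊎ (proj₁ (hslot x) ≡ suc off × proj₂ (hslot x) < e)

    module _ (hvalid : ∀ x → Valid (hslot x)) where

      tail-piece : ∀ g → suc (2 * toℕ g + e) ≤ W
      tail-piece g = ≤-trans (≤-reflexive (sym (+-suc (2 * toℕ g) e)))
        (≤-trans (+-monoˡ-≤ (suc e) (*-monoʳ-≤ 2 {toℕ g} {size G} (<⇒≤ (toℕ<n g)))) e≤W)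

      valid : ∀ u → Valid (slot u)
      valid (hd x) = hvalid x
      valid (tl g) = <-≤-trans (+-monoʳ-< off (blk<len g)) off≤N , tail-piece g
      valid ins = <-≤-trans (+-monoʳ-< off insBlk<len) off≤N ,
        ≤-trans (+-mono-≤ (*-monoʳ-≤ 2 {s} {size G} s≤r) (n≤1+n e)) e≤W

      open Assemble (vertices a r) vertices-complete m≡ h h-irrefl slot valid comp public

      before-off : ∀ {b b' p p'} → b < b' ⊎ (b ≡ b' × isOdd b ≡ true) → p < p' → Before (off + b , p) (off + b' , p')
      before-off (inj₁ lt) _ = inj₁ (+-monoʳ-< off lt)
      before-off {b} (inj₂ (refl , o)) p<p' = inj₂ (refl , trans (odd-off b) o , p<p')

      tail-before : ∀ {g k} → toℕ g < toℕ k → Before (slot (tl g)) (slot (tl k))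
      tail-before lt = before-off (monotone lt) (s≤s (+-monoˡ-< e (*-monoʳ-< 2 lt)))

      no-back⇒arc : ∀ {g k} → toℕ g < toℕ k → ¬ BE G g k → arc G g k ≡ true × arc G k g ≡ false
      no-back⇒arc {g} {k} lt ¬be with arc G k g in ekg
      ... | true = ⊥-elim (¬be (inj₁ (lt , refl)))
      ... | false = trans (proj₂ tG g k (λ g≡k → <-irrefl (cong toℕ g≡k) lt)) (cong not ekg) , refl

      tail-compat : ∀ g k → ctr g ≢ ctr k → Forward (tl g) (tl k) ⊎ Forward (tl k) (tl g)
      tail-compat g k ne with <-cmp (toℕ g) (toℕ k)
      ... | tri< lt _ _ = inj₁ (tail-before lt , no-back⇒arc lt (ne ∘ edge-same g k))
      ... | tri≈ _ eq _ = ⊥-elim (ne (cong ctr (toℕ-injective eq)))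
      ... | tri> _ _ gt = inj₂ (tail-before gt , no-back⇒arc gt (ne ∘ sym ∘ edge-same k g))

      ins-compat : ∀ g → Forward (tl g) ins ⊎ Forward ins (tl g)
      ins-compat g with toℕ g <? s
      ... | yes lt = inj₁ (before-off (ins-after lt) piece , T⇒≡true (<⇒<ᵇ lt) , cong not (T⇒≡true (<⇒<ᵇ lt)))
        where
        piece : suc (2 * toℕ g + e) < 2 * s + e
        piece = +-monoˡ-≤ e (≤-trans (≤-reflexive (cong suc (sym (+-suc (toℕ g) (toℕ g + 0))))) (*-monoʳ-≤ 2 lt))
      ... | no ¬lt = inj₂ (before-off (ins-before (≮⇒≥ ¬lt)) (s≤s (+-monoˡ-≤ e (*-monoʳ-≤ 2 (≮⇒≥ ¬lt)))) ,
                           cong not no<ᵇ , no<ᵇ)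
        where
        no<ᵇ : (toℕ g <ᵇ s) ≡ false
        no<ᵇ with toℕ g <ᵇ s in eq
        ... | false = refl
        ... | true = ⊥-elim (¬lt (<ᵇ⇒< (toℕ g) s (≡true⇒T eq)))

      module _ (hcompat : all (λ x → all (compatᵇ x) (allFin a)) (allFin a) ≡ true)
               (early : ∀ x → EarlyHead x) where

        before-sound : ∀ {s t} → beforeᵇ s t ≡ true → Before s t
        before-sound {b , p} {b' , p'} eq with b <ᵇ b' in lt
        ... | true = inj₁ (<ᵇ⇒< b b' (≡true⇒T lt))
        ... | false with ∧-true⁻ eq
        ...   | e₁ , e₂ with ∧-true⁻ e₂
        ...     | o , e₃ = inj₂ (≡ᵇ⇒≡ b b' (≡true⇒T e₁) , o , <ᵇ⇒< p p' (≡true⇒T e₃))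

        head-compat : ∀ x y → hcomp x ≢ hcomp y → Forward (hd x) (hd y) ⊎ Forward (hd y) (hd x)
        head-compat x y ne with all-true⁻ (compatᵇ x) (allFin a) (all-true⁻ (λ x → all (compatᵇ x) (allFin a)) (allFin a) hcompat (∈-allFin x)) (∈-allFin y)
        ... | c with hcomp x ≡ᵇ hcomp y in same
        ...   | true = ⊥-elim (ne (≡ᵇ⇒≡ (hcomp x) (hcomp y) (≡true⇒T same)))
        ...   | false with beforeᵇ (hslot x) (hslot y) ∧ (hh x y ∧ not (hh y x)) in fwd
        ...     | true with ∧-true⁻ fwd
        ...       | b , e₁ with ∧-true⁻ e₁
        ...         | e₂ , e₃ = inj₁ (before-sound b , e₂ , not-true e₃)
        head-compat x y ne | c | false | false with ∧-true⁻ c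
        ...       | b , e₁ with ∧-true⁻ e₁
        ...         | e₂ , e₃ = inj₂ (before-sound b , e₂ , not-true e₃)

        early-before : ∀ x {b p} → 1 ≤ b → e ≤ p → Before (hslot x) (off + b , p)
        early-before x {b} {p} 1≤b e≤p with early x
        ... | inj₁ lt = inj₁ (<-≤-trans lt (≤-trans (≤-reflexive (+-comm 1 off)) (+-monoʳ-≤ off 1≤b)))
        ... | inj₂ (eq , lt) with m≤n⇒m<n∨m≡n 1≤b
        ...   | inj₁ 1<b = inj₁ (subst (_< off + b) (sym eq) (≤-trans (≤-reflexive (+-comm 2 off)) (+-monoʳ-≤ off 1<b)))
        ...   | inj₂ refl = inj₂ (trans eq (+-comm 1 off) , trans (cong isOdd (trans eq (+-comm 1 off))) (odd-off 1) , <-≤-trans lt e≤p)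

        eqFin-refl : ∀ {n} {i j : Fin n} → eqFin i j ≡ true → i ≡ j
        eqFin-refl {i = i} {j} eq = toℕ-injective (≡ᵇ⇒≡ (toℕ i) (toℕ j) (≡true⇒T eq))

        head-ins : ∀ x → hcomp x ≢ hcomp β → Forward (hd x) ins
        head-ins x ne with eqFin x β in eq
        ... | true = ⊥-elim (ne (cong hcomp (eqFin-refl eq)))
        ... | false = early-before x 1≤insBlk (m≤n+m e (2 * s)) , refl , refl

        head-tail : ∀ x g → Forward (hd x) (tl g)
        head-tail x g = early-before x (1≤blk g) (m≤n⇒m≤1+n (m≤n+m e (2 * toℕ g))) , refl , refl

        compat : ∀ u v → comp u ≢ comp v → Forward u v ⊎ Forward v u
        compat (hd x) (hd y) ne = head-compat x y ne
        compat (hd x) (tl g) ne = inj₁ (head-tail x g)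
        compat (hd x) ins ne = inj₁ (head-ins x ne)
        compat (tl g) (hd y) ne = inj₂ (head-tail y g)
        compat (tl g) (tl k) ne = tail-compat g k (ne ∘ cong (λ c → nh + toℕ c))
        compat (tl g) ins ne = ins-compat g
        compat ins (hd y) ne = inj₂ (head-ins y (ne ∘ sym))
        compat ins (tl g) ne with ins-compat g
        ... | inj₁ f = inj₂ f
        ... | inj₂ f = inj₁ f
        compat ins ins ne = ⊥-elim (ne refl)

        module _ (hcomp< : ∀ x → hcomp x < nh) where

          in-tail : ∀ {i} → nh ≤ i → ∀ u → comp u ≡ i → ∃ λ g → u ≡ tl g
          in-tail le (tl g) _ = g , refl
          in-tail le (hd x) refl = ⊥-elim (<-irrefl refl (<-≤-trans (hcomp< x) le))
          in-tail le ins refl = ⊥-elim (<-irrefl refl (<-≤-trans (hcomp< β) le))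

          comp⇒ctr : ∀ {i g k} → comp (tl g) ≡ i → comp (tl k) ≡ i → ctr g ≡ ctr k
          comp⇒ctr p refl = toℕ-injective (+-cancelˡ-≡ nh _ _ p)

          -- Such a component is empty, a singleton of the galaxy or one of its stars.
          tail-gadget : ∀ i → nh ≤ i → Gadget i
          tail-gadget i le with any? (λ g → comp (tl g) ≟ i)
          ... | no none = single λ u v p _ → ⊥-elim (none (empty u p))
            where
            empty : ∀ u → comp u ≡ i → ∃ λ g → comp (tl g) ≡ i
            empty u p with in-tail le u p
            ... | g , refl = g , p
          ... | yes (g , gi) with any? (λ l → (comp (tl l) ≟ i) ×-dec ¬? (l F.≟ ctr l))
          ...   | no none = single unique
            where
            lone : ∀ k → comp (tl k) ≡ i → k ≡ ctr k
            lone k p with k F.≟ ctr k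
            ... | yes eq = eq
            ... | no ne = ⊥-elim (none (k , p , ne))
            unique : ∀ u v → comp u ≡ i → comp v ≡ i → u ≡ v
            unique u v p p' with in-tail le u p | in-tail le v p'
            ... | k , refl | l , refl = cong tl (trans (lone k p) (trans (comp⇒ctr p p') (sym (lone l p'))))
          ...   | yes (l , li , l-leaf) = star (tl c) c∈i (trans (odd-off (blk c)) (centre-even l-leaf)) classify aligned
            where
            c = ctr l
            c∈i : comp (tl c) ≡ i
            c∈i = trans (cong (λ z → nh + toℕ z) (ctr-idem l)) li
            to-c : ∀ {k} → comp (tl k) ≡ i → ctr k ≡ c
            to-c p = comp⇒ctr p li
            BE⇒back : ∀ {k} → BE G k c → Backward (tl k) (tl c) ⊎ Backward (tl c) (tl k)
            BE⇒back {k} (inj₁ (lt , a)) = inj₁ (tail-before lt , trans (proj₂ tG k c (λ eq → <-irrefl (cong toℕ eq) lt)) (cong not a) , a)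
            BE⇒back {k} (inj₂ (lt , a)) = inj₂ (tail-before lt , trans (proj₂ tG c k (λ eq → <-irrefl (cong toℕ eq) lt)) (cong not a) , a)
            mkLeaf : ∀ k → comp (tl k) ≡ i → k ≢ c → Leaf (tl c) (tl k)
            mkLeaf k p ne = leaf (trans (odd-off (blk k)) (leaf-odd is)) (BE⇒back (subst (BE G k) (to-c p) (leaf-adj k is)))
              where
              is : IsLeaf G ctr k
              is eq = ne (trans eq (to-c p))
            classify : ∀ u → comp u ≡ i → u ≡ tl c ⊎ Leaf (tl c) u
            classify u p with in-tail le u p
            ... | k , refl with k F.≟ c
            ...   | yes eq = inj₁ (cong tl eq)
            ...   | no ne = inj₂ (mkLeaf k p ne)
            leaf⇒IsLeaf : ∀ {k} → comp (tl k) ≡ i → Leaf (tl c) (tl k) → IsLeaf G ctr k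
            leaf⇒IsLeaf {k} p lf eq with () ← trans (sym (Leaf.odd lf))
              (trans (cong (λ z → isOdd (off + blk z)) (trans eq (to-c p))) (trans (odd-off (blk c)) (centre-even l-leaf)))
            aligned-< : ∀ {k k'} → comp (tl k) ≡ i → comp (tl k') ≡ i → IsLeaf G ctr k → IsLeaf G ctr k' →
                        toℕ k < toℕ k' → Aligned (tl k) (tl k')
            aligned-< {k} {k'} p p' is is' lt = cong (off +_) (leaves is is' (comp⇒ctr p p')) ,
              s≤s (+-monoˡ-< e (*-monoʳ-< 2 lt)) , no-back⇒arc lt no-edge
              where
              no-edge : ¬ BE G k k'
              no-edge be with edge-ctr k k' be
              ... | inj₁ eq = is eq
              ... | inj₂ eq = is' eq
            aligned : ∀ u v → comp u ≡ i → comp v ≡ i → Leaf (tl c) u → Leaf (tl c) v → u ≡ v ⊎ (Aligned u v ⊎ Aligned v u)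
            aligned u v p p' lu lv with in-tail le u p | in-tail le v p'
            ... | k , refl | k' , refl with <-cmp (toℕ k) (toℕ k')
            ...   | tri≈ _ eq _ = inj₁ (cong tl (toℕ-injective eq))
            ...   | tri< lt _ _ = inj₂ (inj₁ (aligned-< p p' (leaf⇒IsLeaf p lu) (leaf⇒IsLeaf p' lv) lt))
            ...   | tri> _ _ gt = inj₂ (inj₂ (aligned-< p' p (leaf⇒IsLeaf p' lv) (leaf⇒IsLeaf p lu) gt))

          -- `k` is 0 in the main arrangements, and 1 where component 0 contains a triangle found in
          -- `T` and has been placed by hand.
          realize : ∀ k φ → Partial k φ → k ≤ nh → (∀ i → k ≤ i → i < nh → Gadget i) →
                    Σ[ φ' ∈ (U → V) ] (∀ u v → arc T (φ' u) (φ' v) ≡ h u v)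
          realize k φ part k≤ gadgets = assemble compat ((nh ∸ k) + r) k φ part pick all<
            where
            total : k + ((nh ∸ k) + r) ≡ nh + r
            total = trans (sym (+-assoc k (nh ∸ k) r)) (cong (_+ r) (m+[n∸m]≡n k≤))
            pick : ∀ i → k ≤ i → i < k + ((nh ∸ k) + r) → Gadget i
            pick i k≤i _ with i <? nh
            ... | yes lt = gadgets i k≤i lt
            ... | no ¬lt = tail-gadget i (≮⇒≥ ¬lt)
            head< : ∀ x → hcomp x < k + ((nh ∸ k) + r)
            head< x = subst (hcomp x <_) (sym total) (<-≤-trans (hcomp< x) (m≤m+n nh r))
            all< : ∀ u → comp u < k + ((nh ∸ k) + r)
            all< (hd x) = head< x
            all< (tl g) = subst (nh + toℕ (ctr g) <_) (sym total) (+-monoʳ-< nh (toℕ<n (ctr g)))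
            all< ins = head< β

-- Gadgets for paths and two-sided stars

module Gadgets {T q} (crit : Critical T q) (D : Digraph) (tD : IsTournament D) (noD : ¬ Contains T D)
  {m W N C E : ℕ} (ar : Slots.Arena crit D tD noD m W N C E)
  {U : Set} (us : List U) (us-complete : ∀ u → u ∈ us) (m≡ : m ≡ length us)
  (h : U → U → Bool) (h-irrefl : ∀ u → h u u ≡ false)
  (slot : U → Slot) (valid : ∀ u → Slots.Place.Valid crit D tD noD ar (slot u)) (comp : U → ℕ) where
  open Slots crit D tD noD
  open Place ar
  open Assemble us us-complete m≡ h h-irrefl slot valid comp

  Indexes : ∀ {j} → (Fin j → U) → ℕ → Set
  Indexes idx k = ∀ u → comp u ≡ k → ∃ λ i → u ≡ idx i

  indexed : ∀ {j k} {A : U → List V} (idx : Fin j → U) → Indexes idx k → (val : Fin j → V) →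
    (∀ i → val i ∈ A (idx i)) → (∀ i i' → arc T (val i) (val i') ≡ h (idx i) (idx i')) →
    Σ[ ψ ∈ (∀ u → comp u ≡ k → V) ] ((∀ u p → ψ u p ∈ A u) × (∀ u v p r → arc T (ψ u p) (ψ v r) ≡ h u v))
  indexed {k = k} {A} idx cls val val∈ arcs = (λ u p → val (proj₁ (cls u p))) , ψ∈ , ψ-arc
    where
    ψ∈ : ∀ u p → val (proj₁ (cls u p)) ∈ A u
    ψ∈ u p with cls u p
    ... | i , refl = val∈ i
    ψ-arc : ∀ u v p r → arc T (val (proj₁ (cls u p))) (val (proj₁ (cls v r))) ≡ h u v
    ψ-arc u v p r with cls u p | cls v r
    ... | i , refl | j , refl = arcs i j

  start : ∀ {j} (idx : Fin j → U) → Indexes idx 0 → (val : Fin j → V) → (∀ i → val i ∈ SU (idx i)) →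
    (∀ i i' → arc T (val i) (val i') ≡ h (idx i) (idx i')) → Σ[ φ ∈ (U → V) ] Partial 1 φ
  start idx cls val val∈ arcs with indexed {A = SU} idx cls val val∈ arcs
  ... | ψ , ψ∈ , ψ-arc = φ , φ∈ , φ-arc
    where
    φ : U → V
    φ u with comp u ≟ 0
    ... | yes p = ψ u p
    -- A dummy value: `Partial 1` says nothing about later components.
    ... | no _ = apex
    φ∈ : ∀ u → comp u < 1 → φ u ∈ SU u
    φ∈ u lt with comp u ≟ 0
    ... | yes p = ψ∈ u p
    ... | no ne = ⊥-elim (ne (n<1⇒n≡0 lt))
    φ-arc : ∀ u v → comp u < 1 → comp v < 1 → arc T (φ u) (φ v) ≡ h u v
    φ-arc u v lu lv with comp u ≟ 0 | comp v ≟ 0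
    ... | yes p | yes r = ψ-arc u v p r
    ... | no ne | _ = ⊥-elim (ne (n<1⇒n≡0 lu))
    ... | yes _ | no ne = ⊥-elim (ne (n<1⇒n≡0 lv))

  empty-start : Partial 0 (λ _ → apex)
  empty-start = (λ _ ()) , λ _ _ ()

  arc-or-back : ∀ {s t} → Valid s → Valid t → Before s t → ∀ {x y} → x ∈ St s → y ∈ St t → Arc x y ⊎ Arc y x
  arc-or-back vs vt bef {x} {y} x∈ y∈ with arc T x y in e
  ... | true = inj₁ refl
  ... | false = inj₂ (¬Arc⇒Arc (before-disjoint vs vt bef x∈ y∈) e)

  private
    -- Room for two refinements of half a linear slot; the vertex given as argument only certifies
    -- `1 ≤ m`.
    room : U → C * 2 * 2 * 2 * (E * 2) ≤ q
    room u = ≤-trans (*-monoˡ-≤ (E * 2) (*-monoˡ-≤ 2 (*-monoʳ-≤ (C * 2) (^-monoʳ-≤ 2 1≤m)))) roomy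
      where
      1≤m : 1 ≤ m
      1≤m = subst (1 ≤_) (sym m≡) (∈⇒nonempty (us-complete u))

    room₁ : U → C * 2 * 2 * (E * 2) ≤ q
    room₁ u = ≤-trans (*-monoˡ-≤ (E * 2) (m≤m*n (C * 2 * 2) 2)) (room u)

    1≤E2 : 1 ≤ E * 2
    1≤E2 = ≤-trans 1≤D (m≤m*n E 2)

    room₂ : U → C * 2 * 2 * 2 ≤ q
    room₂ u = ≤-trans (≤-trans (≤-reflexive (sym (*-identityʳ _))) (*-monoʳ-≤ (C * 2 * 2 * 2) 1≤E2)) (room u)

    loop : ∀ y u → arc T y y ≡ h u u
    loop y u = trans (proj₁ tournament y) (sym (h-irrefl u))

    by : ∀ {x y b b'} → Arc x y → b ≡ true → b' ≡ false → arc T x y ≡ b × arc T y x ≡ b'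
    by a e e' = trans a (sym e) , trans (Arc-asym a) (sym e')

  edge : ∀ {k} (c l : U) → comp c ≡ k → isOdd (proj₁ (slot c)) ≡ false → Leaf c l →
    (∀ u → comp u ≡ k → u ≡ c ⊎ u ≡ l) → Gadget k
  edge c l kc ec lf cls = star c kc ec classify aligned
    where
    classify : ∀ u → comp u ≡ _ → u ≡ c ⊎ Leaf c u
    classify u p with cls u p
    ... | inj₁ e = inj₁ e
    ... | inj₂ refl = inj₂ lf
    aligned : ∀ u v → comp u ≡ _ → comp v ≡ _ → Leaf c u → Leaf c v → u ≡ v ⊎ (Aligned u v ⊎ Aligned v u)
    aligned u v p r lu lv with cls u p | cls v r
    ... | inj₁ refl | _ with () ← trans (sym (Leaf.odd lu)) ec
    aligned u v p r lu lv | inj₂ refl | inj₁ refl with () ← trans (sym (Leaf.odd lv)) ec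
    aligned u v p r lu lv | inj₂ refl | inj₂ refl = inj₁ refl

  twoLeaves : ∀ {k} (c l l' : U) → comp c ≡ k → isOdd (proj₁ (slot c)) ≡ false → Leaf c l → Leaf c l' → Aligned l l' →
    (∀ u → comp u ≡ k → u ≡ c ⊎ u ≡ l ⊎ u ≡ l') → Gadget k
  twoLeaves c l l' kc ec lf lf' al cls = star c kc ec classify aligned
    where
    classify : ∀ u → comp u ≡ _ → u ≡ c ⊎ Leaf c u
    classify u p with cls u p
    ... | inj₁ e = inj₁ e
    ... | inj₂ (inj₁ refl) = inj₂ lf
    ... | inj₂ (inj₂ refl) = inj₂ lf'
    aligned : ∀ u v → comp u ≡ _ → comp v ≡ _ → Leaf c u → Leaf c v → u ≡ v ⊎ (Aligned u v ⊎ Aligned v u)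
    aligned u v p r lu lv with cls u p | cls v r
    ... | inj₁ refl | _ with () ← trans (sym (Leaf.odd lu)) ec
    aligned u v p r lu lv | inj₂ (inj₁ refl) | inj₁ refl with () ← trans (sym (Leaf.odd lv)) ec
    aligned u v p r lu lv | inj₂ (inj₂ refl) | inj₁ refl with () ← trans (sym (Leaf.odd lv)) ec
    aligned u v p r lu lv | inj₂ (inj₁ refl) | inj₂ (inj₁ refl) = inj₁ refl
    aligned u v p r lu lv | inj₂ (inj₁ refl) | inj₂ (inj₂ refl) = inj₂ (inj₁ al)
    aligned u v p r lu lv | inj₂ (inj₂ refl) | inj₂ (inj₁ refl) = inj₂ (inj₂ al)
    aligned u v p r lu lv | inj₂ (inj₂ refl) | inj₂ (inj₂ refl) = inj₁ refl

  -- A linear centre between its two leaves: the only obstruction is a backward transitive triangle.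
  middle : ∀ {k} (l c g : U) → comp l ≡ k → comp c ≡ k → comp g ≡ k →
    isOdd (proj₁ (slot l)) ≡ true → isOdd (proj₁ (slot c)) ≡ false → isOdd (proj₁ (slot g)) ≡ true →
    Backward l c → Backward c g → Forward l g →
    (∀ u → comp u ≡ k → u ≡ l ⊎ u ≡ c ⊎ u ≡ g) →
    (∀ {x y z} → x ∈ SU l → y ∈ SU c → z ∈ SU g → Arc y x → Arc z y → Arc z x → ⊥) → Gadget k
  middle l c g kl kc kg ol ec og lc cg lg cls noTri A large =
    step₁ (attach {c = c} {u = l} large kl (leaf ol (inj₁ lc)) (room₁ c) (large-linear large kc ec) (lookup (proj₁ (large c kc))))
    where
    inS : ∀ {u} → comp u ≡ _ → ∀ {y} → y ∈ A u → y ∈ SU u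
    inS {u} p = lookup (proj₁ (large u p))
    Goal = Σ[ ψ ∈ (∀ u → comp u ≡ _ → V) ] ((∀ u p → ψ u p ∈ A u) × (∀ u v p r → arc T (ψ u p) (ψ v r) ≡ h u v))
    finish : ∀ {v} → v ∈ A c → Attached A c l v → Attached A c g v → Goal
    finish {v} v∈ (x , x∈ , vx , xv) (z , z∈ , vz , zv) =
      indexed (fin3 l c g) (λ u p → index3 (cls u p)) (fin3 x v z) (fin3 x∈ v∈ z∈)
        (fin3 (fin3 (loop x l) xv (proj₁ xz')) (fin3 vx (loop v c) vz) (fin3 (proj₂ xz') zv (loop z g)))
      where
      forward : Arc x z ⊎ Arc z x → Arc x z
      forward (inj₁ a) = a
      forward (inj₂ a) = ⊥-elim (noTri (inS kl x∈) (inS kc v∈) (inS kg z∈) (trans vx (proj₂ (proj₂ lc))) (trans zv (proj₂ (proj₂ cg))) a)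
      xz' = by (forward (arc-or-back (valid l) (valid g) (proj₁ lg) (inS kl x∈) (inS kg z∈))) (proj₁ (proj₂ lg)) (proj₂ (proj₂ lg))
    step₁ : Σ[ X ∈ List V ] (X ⊆ A c × Linear (C * 2 * 2) X × (∀ {x} → x ∈ X → Attached A c l x)) → Goal
    step₁ (X₁ , X₁⊆ , lin₁ , att₁) =
      step₂ (attach {c = c} {u = g} large kg (leaf og (inj₂ cg)) (room c) lin₁ (λ x∈ → inS kc (lookup X₁⊆ x∈)))
      where
      step₂ : Σ[ X ∈ List V ] (X ⊆ X₁ × Linear (C * 2 * 2 * 2) X × (∀ {x} → x ∈ X → Attached A c g x)) → Goal
      step₂ (X₂ , X₂⊆ , lin₂ , att₂) = pick (nonempty X₂ (linear-nonempty lin₂))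
        where
        pick : (∃ λ v → v ∈ X₂) → Goal
        pick (v , v∈) = finish (lookup X₁⊆ (lookup X₂⊆ v∈)) (att₁ (lookup X₂⊆ v∈)) (att₂ v∈)

  -- The path p – w – z – q of backward edges with w < q < p < z, where p and q come from one chain.
  -- The ends p, q are neighbours of w, z only, unless there is a backward transitive triangle.
  path : ∀ {k} (Good : V → Set) (w b p z : U) → comp w ≡ k → comp b ≡ k → comp p ≡ k → comp z ≡ k →
    isOdd (proj₁ (slot w)) ≡ false → isOdd (proj₁ (slot b)) ≡ true → isOdd (proj₁ (slot p)) ≡ true → isOdd (proj₁ (slot z)) ≡ false →
    Forward w b → Backward w p → Backward w z → Aligned b p → Backward b z → Forward p z →
    (∀ u → comp u ≡ k → u ≡ w ⊎ u ≡ b ⊎ u ≡ p ⊎ u ≡ z) →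
    (∀ {F X} → Linear F X → (∀ {x} → x ∈ X → x ∈ SU z) → F * 2 * (E * 2) ≤ q →
       Σ[ X' ∈ List V ] (X' ⊆ X × Linear (F * 2) X' × (∀ {x} → x ∈ X' → Good x))) →
    (∀ {x y v} → x ∈ SU w → y ∈ SU b ⊎ y ∈ SU p → v ∈ SU z → Good v → Arc y x → Arc v y → Arc v x → ⊥) → Gadget k
  path Good w b p z kw kb kp kz ew ob op ez wb wp wz bp bz pz cls refine noTri A large =
    step (attach {c = w} {u = p} large kp (leaf op (inj₂ wp)) (room₁ w) (large-linear large kw ew) (lookup (proj₁ (large w kw))))
         (attach {c = z} {u = b} large kb (leaf ob (inj₁ bz)) (room₁ z) (large-linear large kz ez) (lookup (proj₁ (large z kz))))
    where
    inS : ∀ {u} → comp u ≡ _ → ∀ {y} → y ∈ A u → y ∈ SU u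
    inS {u} p = lookup (proj₁ (large u p))
    Goal = Σ[ ψ ∈ (∀ u → comp u ≡ _ → V) ] ((∀ u p → ψ u p ∈ A u) × (∀ u v p r → arc T (ψ u p) (ψ v r) ≡ h u v))
    finish : ∀ {x v} → x ∈ A w → v ∈ A z → Good v → Arc v x → Attached A w p x → Attached A z b v → Goal
    finish {x} {v} x∈ v∈ good vx (y , y∈ , xy , yx) (y' , y'∈ , vy' , y'v) =
      indexed (fin4 w b p z) (λ u e → index4 (cls u e)) (fin4 x y' y v) (fin4 x∈ y'∈ y∈ v∈)
        (fin4 (fin4 (loop x w) (proj₁ e-wb) xy (proj₂ e-zw))
              (fin4 (proj₂ e-wb) (loop y' b) (proj₁ e-bp) y'v)
              (fin4 yx (proj₂ e-bp) (loop y p) (proj₁ e-pz))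
              (fin4 (proj₁ e-zw) vy' (proj₂ e-pz) (loop v z)))
      where
      tri : ∀ {c} → c ∈ SU b ⊎ c ∈ SU p → Arc c x → Arc v c → ⊥
      tri c∈ cx vc = noTri (inS kw x∈) c∈ (inS kz v∈) good cx vc vx
      forward-wb : Arc x y' ⊎ Arc y' x → Arc x y'
      forward-wb (inj₁ a) = a
      forward-wb (inj₂ a) = ⊥-elim (tri (inj₁ (inS kb y'∈)) a (trans vy' (proj₂ (proj₂ bz))))
      forward-pz : Arc y v ⊎ Arc v y → Arc y v
      forward-pz (inj₁ a) = a
      forward-pz (inj₂ a) = ⊥-elim (tri (inj₂ (inS kp y∈)) (trans yx (proj₂ (proj₂ wp))) a)
      y'y : Arc y' y
      y'y = ordered ob (proj₁ (proj₂ bp)) (inS kb y'∈) (subst (λ z → y ∈ St (z , proj₂ (slot p))) (sym (proj₁ bp)) (inS kp y∈)) (proj₁ (valid b))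
      e-wb = by (forward-wb (arc-or-back (valid w) (valid b) (proj₁ wb) (inS kw x∈) (inS kb y'∈))) (proj₁ (proj₂ wb)) (proj₂ (proj₂ wb))
      e-pz = by (forward-pz (arc-or-back (valid p) (valid z) (proj₁ pz) (inS kp y∈) (inS kz v∈))) (proj₁ (proj₂ pz)) (proj₂ (proj₂ pz))
      e-bp = by y'y (proj₁ (proj₂ (proj₂ bp))) (proj₂ (proj₂ (proj₂ bp)))
      e-zw = by vx (proj₂ (proj₂ wz)) (proj₁ (proj₂ wz))
    step : Σ[ X ∈ List V ] (X ⊆ A w × Linear (C * 2 * 2) X × (∀ {x} → x ∈ X → Attached A w p x)) →
           Σ[ Z ∈ List V ] (Z ⊆ A z × Linear (C * 2 * 2) Z × (∀ {v} → v ∈ Z → Attached A z b v)) → Goal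
    step (X₁ , X₁⊆ , lin₁ , att₁) (Z₁ , Z₁⊆ , linZ₁ , attZ₁) = step' (refine linZ₁ (λ x∈ → inS kz (lookup Z₁⊆ x∈)) (room z))
      where
      step' : Σ[ Z ∈ List V ] (Z ⊆ Z₁ × Linear (C * 2 * 2 * 2) Z × (∀ {v} → v ∈ Z → Good v)) → Goal
      -- The edge w - z joins two linear sets; it exists because `X₁` cannot be complete to `Z₂`.
      -- The ends of the path are already attached to all candidates.
      step' (Z₂ , Z₂⊆ , linZ₂ , good) = use (backArc X₁ Z₂ not-complete)
        where
        not-complete : ¬ (X₁ ⇒ₐ Z₂)
        not-complete = linear⇏linear (room₂ w) (linear-mono (m≤m*n (C * 2 * 2) 2) lin₁) linZ₂
        use : (∃ λ x → ∃ λ v → x ∈ X₁ × v ∈ Z₂ × (x ≢ v → Arc v x)) → Goal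
        use (x , v , x∈ , v∈ , vx) = finish (lookup X₁⊆ x∈) (lookup Z₁⊆ (lookup Z₂⊆ v∈)) (good v∈)
          (vx (before-disjoint (valid w) (valid z) (proj₁ wz) (inS kw (lookup X₁⊆ x∈)) (inS kz (lookup Z₁⊆ (lookup Z₂⊆ v∈)))))
          (att₁ x∈) (attZ₁ (lookup Z₂⊆ v∈))

-- Block layouts of galaxies

<⇒<ᵇ-true : ∀ {m n} → m < n → (m <ᵇ n) ≡ true
<⇒<ᵇ-true lt = T⇒≡true (<⇒<ᵇ lt)

≮⇒<ᵇ-false : ∀ {m n} → ¬ m < n → (m <ᵇ n) ≡ false
≮⇒<ᵇ-false {m} {n} ¬lt with m <ᵇ n in eq
... | false = refl
... | true = ⊥-elim (¬lt (<ᵇ⇒< m n (≡true⇒T eq)))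

<ᵇ-false⇒≮ : ∀ {m n} → (m <ᵇ n) ≡ false → ¬ m < n
<ᵇ-false⇒≮ e lt with () ← trans (sym e) (<⇒<ᵇ-true lt)

≢⇒≡ᵇ-false : ∀ {m n} → m ≢ n → (m ≡ᵇ n) ≡ false
≢⇒≡ᵇ-false {m} {n} ne with m ≡ᵇ n in eq
... | false = refl
... | true = ⊥-elim (ne (≡ᵇ⇒≡ m n (≡true⇒T eq)))

≡ᵇ-refl : ∀ m → (m ≡ᵇ m) ≡ true
≡ᵇ-refl m = T⇒≡true (≡⇒≡ᵇ m m refl)

ordArc-irrefl : ∀ back a → ordArc back a a ≡ false
ordArc-irrefl back a rewrite ≮⇒<ᵇ-false (<-irrefl {a} refl) = refl

ordArc-anti : ∀ back a b → a ≢ b → ordArc back a b ≡ not (ordArc back b a)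
ordArc-anti back a b ne with <-cmp a b
... | tri< lt _ _ rewrite <⇒<ᵇ-true lt | ≮⇒<ᵇ-false (<⇒≯ lt) = refl
... | tri≈ _ eq _ = ⊥-elim (ne eq)
... | tri> _ _ gt rewrite <⇒<ᵇ-true gt | ≮⇒<ᵇ-false (<⇒≯ gt) = sym (Bool.not-involutive _)

module GalaxyLayout (G : Digraph) (ctr : Fin (size G) → Fin (size G)) (stars : StarStructure G ctr) (s : ℕ) where
  open StarStructure stars

  private
    r = size G

  -- A singleton is not a centre in this sense, so it goes into a chain block like a leaf.
  centre? : ∀ c → _
  centre? c = any? (λ u → ¬? (u F.≟ c) ×-dec (ctr u F.≟ c))

  isCentre : Fin r → Bool
  isCentre c = does (centre? c)

  earlier : ℕ → Fin r → Bool
  earlier k c = isCentre c ∧ (toℕ c <ᵇ k)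

  centres : ℕ → ℕ
  centres k = count (earlier k) (allFin r)

  -- Each centre of a star gets an even block of its own; each run of other vertices between
  -- consecutive centres shares the odd block in between.
  blk : Fin r → ℕ
  blk g = 2 * centres (toℕ g) + (if isCentre g then 2 else 1)

  centre⇒star : ∀ {c} → isCentre c ≡ true → IsStarCenter G ctr c
  centre⇒star {c} e with centre? c
  ... | yes (u , ne , refl) = ctr-idem u , u , ne , refl

  leaf⇒¬centre : ∀ {g} → IsLeaf G ctr g → isCentre g ≡ false
  leaf⇒¬centre {g} lf with isCentre g in e
  ... | false = refl
  ... | true = ⊥-elim (lf (sym (proj₁ (centre⇒star e))))

  leaf⇒centre : ∀ {g} → IsLeaf G ctr g → isCentre (ctr g) ≡ true
  leaf⇒centre {g} lf with centre? (ctr g)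
  ... | yes _ = refl
  ... | no ¬c = ⊥-elim (¬c (g , lf , refl))

  centres-mono : ∀ {k l} → k ≤ l → centres k ≤ centres l
  centres-mono {k} {l} k≤l = count-mono (earlier k) (earlier l) (allFin r) λ {c} _ e → let e₁ , e₂ = ∧-true⁻ e in
    cong₂ _∧_ e₁ (<⇒<ᵇ-true (<-≤-trans (<ᵇ⇒< (toℕ c) k (≡true⇒T e₂)) k≤l))

  centres-step : ∀ {g l} → isCentre g ≡ true → toℕ g < l → centres (toℕ g) < centres l
  centres-step {g} {l} e g<l = count-strict (earlier (toℕ g)) (earlier l) (allFin r) {g} (∈-allFin g)
    (cong₂ _∧_ e (≮⇒<ᵇ-false (<-irrefl {toℕ g} refl))) (cong₂ _∧_ e (<⇒<ᵇ-true g<l))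
    λ {c} e → let e₁ , e₂ = ∧-true⁻ e in
      cong₂ _∧_ e₁ (<⇒<ᵇ-true (<-trans (<ᵇ⇒< (toℕ c) (toℕ g) (≡true⇒T e₂)) g<l))

  centres≤ : ∀ k → centres k ≤ r
  centres≤ k = ≤-trans (length-filter (T? ∘ earlier k) (allFin r)) (≤-reflexive (length-tabulate {n = r} id))

  blk-centre : ∀ {g} → isCentre g ≡ true → blk g ≡ 2 * centres (toℕ g) + 2
  blk-centre e rewrite e = refl

  blk-other : ∀ {g} → isCentre g ≡ false → blk g ≡ 2 * centres (toℕ g) + 1
  blk-other e rewrite e = refl

  odd-1 : ∀ k → isOdd (2 * k + 1) ≡ true
  odd-1 k = isOdd-+ (2 * k) 1 (isOdd-2* k)

  even-2 : ∀ k → isOdd (2 * k + 2) ≡ false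
  even-2 k = isOdd-+ (2 * k) 2 (isOdd-2* k)

  1≤+ : ∀ a {b} → 1 ≤ b → 1 ≤ a + b
  1≤+ a 1≤b = ≤-trans 1≤b (m≤n+m _ a)

  blk≥ : ∀ g → 2 * centres (toℕ g) + 1 ≤ blk g
  blk≥ g with isCentre g
  ... | true = +-monoʳ-≤ (2 * centres (toℕ g)) (s≤s z≤n)
  ... | false = ≤-refl

  blk≤ : ∀ g → blk g ≤ 2 * centres (toℕ g) + 2
  blk≤ g with isCentre g
  ... | true = ≤-refl
  ... | false = +-monoʳ-≤ (2 * centres (toℕ g)) (s≤s z≤n)

  centre-below : ∀ {g l} → isCentre g ≡ true → toℕ g < l → blk g < 2 * centres l + 1
  centre-below {g} {l} e lt = subst₂ _≤_ (cong suc (sym (blk-centre {g} e))) (+-comm 1 (2 * centres l)) (s≤s (begin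
      2 * centres (toℕ g) + 2 ≡⟨ +-comm _ 2 ⟩
      2 + 2 * centres (toℕ g) ≡⟨ sym (*-suc 2 (centres (toℕ g))) ⟩
      2 * suc (centres (toℕ g)) ≤⟨ *-monoʳ-≤ 2 (centres-step {g} e lt) ⟩
      2 * centres l ∎))
    where open ≤-Reasoning

  other-below : ∀ {g l} → isCentre g ≡ false → toℕ g ≤ l →
                blk g < 2 * centres l + 1 ⊎ (blk g ≡ 2 * centres l + 1 × isOdd (blk g) ≡ true)
  other-below {g} {l} e le with m≤n⇒m<n∨m≡n (+-monoˡ-≤ 1 (*-monoʳ-≤ 2 (centres-mono le)))
  ... | inj₁ lt = inj₁ (subst (_< 2 * centres l + 1) (sym (blk-other {g} e)) lt)
  ... | inj₂ eq = inj₂ (trans (blk-other {g} e) eq , trans (cong isOdd (blk-other {g} e)) (odd-1 (centres (toℕ g))))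

  before-level : ∀ {g l} → toℕ g < l →
                 blk g < 2 * centres l + 1 ⊎ (blk g ≡ 2 * centres l + 1 × isOdd (blk g) ≡ true)
  before-level {g} {l} lt = case (isCentre g) refl
    where
    case : ∀ b → isCentre g ≡ b →
           blk g < 2 * centres l + 1 ⊎ (blk g ≡ 2 * centres l + 1 × isOdd (blk g) ≡ true)
    case true e = inj₁ (centre-below e lt)
    case false e = other-below e (<⇒≤ lt)

  monotone : ∀ {g k} → toℕ g < toℕ k → blk g < blk k ⊎ (blk g ≡ blk k × isOdd (blk g) ≡ true)
  monotone {g} {k} lt with before-level {g} lt
  ... | inj₁ b< = inj₁ (<-≤-trans b< (blk≥ k))
  ... | inj₂ (eq , o) with m≤n⇒m<n∨m≡n (blk≥ k)
  ...   | inj₁ b< = inj₁ (subst (_< blk k) (sym eq) b<)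
  ...   | inj₂ eq' = inj₂ (trans eq eq' , o)

  -- No centre lies between two leaves of a star.
  leaves-≤ : ∀ {g k} → IsLeaf G ctr g → IsLeaf G ctr k → ctr g ≡ ctr k → centres (toℕ k) ≤ centres (toℕ g)
  leaves-≤ {g} {k} lg lk same = count-mono (earlier (toℕ k)) (earlier (toℕ g)) (allFin r) step
    where
    step : ∀ {c} → c ∈ allFin r → earlier (toℕ k) c ≡ true → earlier (toℕ g) c ≡ true
    step {c} _ e with ∧-true⁻ e
    ... | e₁ , e₂ with <-cmp (toℕ c) (toℕ g)
    ...   | tri< lt _ _ = cong₂ _∧_ e₁ (<⇒<ᵇ-true lt)
    ...   | tri≈ _ eq _ rewrite toℕ-injective eq with () ← trans (sym e₁) (leaf⇒¬centre lg)
    ...   | tri> _ _ gt = ⊥-elim (noncross g k c lg lk same (centre⇒star e₁) c≢ (gt , c<k))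
      where
      c<k : toℕ c < toℕ k
      c<k = <ᵇ⇒< (toℕ c) (toℕ k) (≡true⇒T e₂)
      c≢ : c ≢ ctr g
      -- `noncross` concerns the centres of other stars; the star's own centre is excluded because
      -- it comes first or last.
      c≢ eq with side c
      ... | inj₁ right = <-irrefl refl (<-≤-trans c<k (right k (trans (sym same) (sym eq))))
      ... | inj₂ left = <-irrefl refl (<-≤-trans gt (left g (sym eq)))

  layout : Layout G ctr s
  layout = record
    { blk = blk ; insBlk = 2 * centres s + 1 ; len = 2 * r + 3
    ; 1≤blk = λ g → ≤-trans (1≤+ (2 * centres (toℕ g)) ≤-refl) (blk≥ g)
    ; 1≤insBlk = 1≤+ (2 * centres s) ≤-refl
    ; blk<len = λ g → ≤-<-trans (blk≤ g) (+-mono-≤-< (*-monoʳ-≤ 2 (centres≤ (toℕ g))) ≤-refl)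
    ; insBlk<len = +-mono-≤-< (*-monoʳ-≤ 2 (centres≤ s)) (s≤s (s≤s z≤n))
    ; leaf-odd = λ {g} lf → trans (cong isOdd (blk-other {g} (leaf⇒¬centre lf))) (odd-1 (centres (toℕ g)))
    ; centre-even = λ {g} lf → trans (cong isOdd (blk-centre {ctr g} (leaf⇒centre lf))) (even-2 (centres (toℕ (ctr g))))
    ; monotone = monotone
    ; leaves = λ {g} {k} lg lk same → trans (blk-other {g} (leaf⇒¬centre lg)) (trans
        (cong (λ z → 2 * z + 1) (≤-antisym (leaves-≤ lk lg (sym same)) (leaves-≤ lg lk same)))
        (sym (blk-other {k} (leaf⇒¬centre lk))))
    ; ins-after = before-level
    ; ins-before = λ {g} le → ins-before g le
    }
    where
    ins-before : ∀ g → s ≤ toℕ g → 2 * centres s + 1 < blk g ⊎ (2 * centres s + 1 ≡ blk g × isOdd (2 * centres s + 1) ≡ true)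
    ins-before g le with m≤n⇒m<n∨m≡n (≤-trans (+-monoˡ-≤ 1 (*-monoʳ-≤ 2 (centres-mono le))) (blk≥ g))
    ... | inj₁ lt = inj₁ lt
    ... | inj₂ eq = inj₂ (eq , odd-1 (centres s))

module MatchingGalaxy (t : ℕ) where

  P : Digraph
  P = record { size = suc (2 * t) ; arc = λ i j → ordArc backP (toℕ i) (toℕ j) }

  tP : IsTournament P
  tP = (λ i → ordArc-irrefl backP (toℕ i)) , λ i j ne → ordArc-anti backP (toℕ i) (toℕ j) (ne ∘ toℕ-injective)

  -- Counting from 0, the edges join 2i to 2i + 1. The later end is taken as centre, and the
  -- unmatched last vertex as its own.
  partner : ∀ (u : Fin (suc (2 * t))) → Bool → Fin (suc (2 * t))
  partner u true = u
  partner u false with suc (toℕ u) <? suc (2 * t)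
  ... | yes lt = fromℕ< lt
  ... | no _ = u

  ctr : Fin (suc (2 * t)) → Fin (suc (2 * t))
  ctr u = partner u (isOdd (toℕ u))

  ctr-odd : ∀ u → isOdd (toℕ u) ≡ true → ctr u ≡ u
  ctr-odd u e rewrite e = refl

  ctr-leaf : ∀ u → IsLeaf P ctr u → isOdd (toℕ u) ≡ false × toℕ (ctr u) ≡ suc (toℕ u)
  ctr-leaf u lf with isOdd (toℕ u)
  ... | true = ⊥-elim (lf refl)
  ... | false with suc (toℕ u) <? suc (2 * t)
  ...   | yes lt = refl , toℕ-fromℕ< lt
  ...   | no _ = ⊥-elim (lf refl)

  ctr-next : ∀ u v → isOdd (toℕ u) ≡ false → toℕ v ≡ suc (toℕ u) → ctr u ≡ v
  ctr-next u v e eq rewrite e with suc (toℕ u) <? suc (2 * t)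
  ... | yes lt = toℕ-injective (trans (toℕ-fromℕ< lt) (sym eq))
  ... | no ¬lt = ⊥-elim (¬lt (subst (_< suc (2 * t)) eq (toℕ<n v)))

  backP⁻ : ∀ x y → backP x y ≡ true → isOdd x ≡ false × y ≡ suc x
  backP⁻ x (suc w) a with isOdd w in e
  ... | false with refl ← ≡ᵇ⇒≡ x w (≡true⇒T a) = e , refl

  back⇒next : ∀ u v → toℕ u < toℕ v → arc P v u ≡ true → isOdd (toℕ u) ≡ false × toℕ v ≡ suc (toℕ u)
  back⇒next u v lt a rewrite ≮⇒<ᵇ-false (<⇒≯ lt) | <⇒<ᵇ-true lt = backP⁻ (toℕ u) (toℕ v) a

  odd-suc : ∀ {x y} → isOdd x ≡ false → y ≡ suc x → isOdd y ≡ true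
  odd-suc e refl rewrite e = refl

  edge⇒partners : ∀ u v → toℕ u < toℕ v → arc P v u ≡ true → ctr u ≡ v × ctr v ≡ v
  edge⇒partners u v lt a with back⇒next u v lt a
  ... | e , eq = ctr-next u v e eq , ctr-odd v (odd-suc e eq)

  leaf-ctr-odd : ∀ u → IsLeaf P ctr u → isOdd (toℕ (ctr u)) ≡ true
  leaf-ctr-odd u lf = odd-suc (proj₁ (ctr-leaf u lf)) (proj₂ (ctr-leaf u lf))

  ≤ctr : ∀ u → toℕ u ≤ toℕ (ctr u)
  ≤ctr u with u F.≟ ctr u
  ... | yes eq = ≤-reflexive (cong toℕ eq)
  ... | no lf = ≤-trans (n≤1+n _) (≤-reflexive (sym (proj₂ (ctr-leaf u lf))))

  leaf-unique : ∀ {u v} → IsLeaf P ctr u → IsLeaf P ctr v → ctr u ≡ ctr v → u ≡ v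
  leaf-unique {u} {v} lu lv eq = toℕ-injective (suc-injective
    (trans (sym (proj₂ (ctr-leaf u lu))) (trans (cong toℕ eq) (proj₂ (ctr-leaf v lv)))))

  stars : StarStructure P ctr
  stars = record
    { ctr-idem = idem
    ; edge-same = λ { u v (inj₁ (lt , a)) → let e₁ , e₂ = edge⇒partners u v lt a in trans e₁ (sym e₂)
                    ; u v (inj₂ (lt , a)) → let e₁ , e₂ = edge⇒partners v u lt a in trans e₂ (sym e₁) }
    ; edge-ctr = λ { u v (inj₁ (lt , a)) → inj₂ (sym (proj₂ (edge⇒partners u v lt a)))
                   ; u v (inj₂ (lt , a)) → inj₁ (sym (proj₂ (edge⇒partners v u lt a))) }
    ; leaf-adj = adjacent
    ; side = λ c → inj₁ λ u eq → subst (λ z → toℕ u ≤ toℕ z) eq (≤ctr u)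
    ; noncross = λ { l l' c ll ll' same _ _ (l<c , c<l') →
        <-irrefl (cong toℕ (leaf-unique ll ll' same)) (<-trans l<c c<l') }
    }
    where
    idem : ∀ u → ctr (ctr u) ≡ ctr u
    idem u with u F.≟ ctr u
    ... | yes eq = cong ctr (sym eq)
    ... | no lf = ctr-odd (ctr u) (leaf-ctr-odd u lf)
    back : ∀ x → isOdd x ≡ false → ordArc backP (suc x) x ≡ true
    back x e rewrite ≮⇒<ᵇ-false (<⇒≯ (n<1+n x)) | <⇒<ᵇ-true (n<1+n x) | e = ≡ᵇ-refl x
    adjacent : ∀ u → IsLeaf P ctr u → BE P u (ctr u)
    adjacent u lf with ctr-leaf u lf
    ... | e , eq = inj₁ (subst (toℕ u <_) (sym eq) (n<1+n _) ,
                         trans (cong (λ z → ordArc backP z (toℕ u)) eq) (back (toℕ u) e))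

  blkℕ : ℕ → ℕ
  blkℕ zero = 1
  blkℕ (suc k) = 4 + k

  blkℕ-odd : ∀ k → isOdd (blkℕ k) ≡ not (isOdd k)
  blkℕ-odd zero = refl
  blkℕ-odd (suc k) = Bool.not-involutive _

  blkℕ-mono : ∀ {k l} → k < l → blkℕ k < blkℕ l
  blkℕ-mono {zero} {suc l} _ = s≤s (s≤s z≤n)
  blkℕ-mono {suc k} {suc l} (s≤s lt) = +-monoʳ-< 4 lt

  -- Every vertex gets a block of its own; block 2 stays free for a linear `ins` after the first vertex.
  layout : ∀ i → (1 < i ⊎ (1 ≡ i × isOdd 1 ≡ true)) → i < 4 → 1 ≤ i → Layout P ctr 1
  layout i after i<4 1≤i = record
    { blk = blkℕ ∘ toℕ ; insBlk = i ; len = 4 + suc (2 * t)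
    ; 1≤blk = λ g → 1≤blkℕ (toℕ g)
    ; 1≤insBlk = 1≤i
    ; blk<len = λ g → <len (toℕ g) (toℕ<n g)
    ; insBlk<len = <-≤-trans i<4 (m≤m+n 4 _)
    ; leaf-odd = λ {g} lf → trans (blkℕ-odd (toℕ g)) (cong not (proj₁ (ctr-leaf g lf)))
    ; centre-even = λ {g} lf → trans (blkℕ-odd (toℕ (ctr g))) (cong not (leaf-ctr-odd g lf))
    ; monotone = λ lt → inj₁ (blkℕ-mono lt)
    ; leaves = λ lg lk same → cong (blkℕ ∘ toℕ) (leaf-unique lg lk same)
    ; ins-after = λ {g} lt → subst (λ z → blkℕ z < i ⊎ (blkℕ z ≡ i × isOdd (blkℕ z) ≡ true)) (sym (n<1⇒n≡0 lt)) after
    ; ins-before = λ {g} → later (toℕ g)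
    }
    where
    1≤blkℕ : ∀ k → 1 ≤ blkℕ k
    1≤blkℕ zero = ≤-refl
    1≤blkℕ (suc k) = s≤s z≤n
    <len : ∀ k → k < suc (2 * t) → blkℕ k < 4 + suc (2 * t)
    <len zero _ = s≤s (s≤s z≤n)
    <len (suc k) lt = +-monoʳ-< 4 (<-trans (n<1+n k) lt)
    later : ∀ k → 1 ≤ k → i < blkℕ k ⊎ (i ≡ blkℕ k × isOdd i ≡ true)
    later (suc k) _ = inj₁ (<-≤-trans i<4 (m≤m+n 4 k))

-- The two families as patterns

labelArc : (ℕ → ℕ → Bool) → (ℕ → ℕ → Bool) → Lab → Lab → ℕ → ℕ → Bool
labelArc a₁ a₂ (L x) (L y) _ _ = a₁ x y
labelArc a₁ a₂ (R x) (R y) _ _ = a₂ x y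
labelArc a₁ a₂ (L _) (R _) p q = p <ᵇ q
labelArc a₁ a₂ (R _) (L _) p q = p <ᵇ q

product-arc : ∀ n a₁ a₂ lab (i j : Fin n) →
  arc (product n a₁ a₂ lab) i j ≡ labelArc a₁ a₂ (lab (toℕ i)) (lab (toℕ j)) (toℕ i) (toℕ j)
product-arc n a₁ a₂ lab i j with lab (toℕ i) | lab (toℕ j)
... | L _ | L _ = refl
... | L _ | R _ = refl
... | R _ | L _ = refl
... | R _ | R _ = refl

-- A product is a pattern as soon as each vertex u of the pattern has a position pos u carrying its label.
module Presentation {a} (hh : Fin a → Fin a → Bool) (β : Fin a) (G : Digraph) (s : ℕ)
  (hh-irrefl : ∀ x → hh x x ≡ false) (hh-anti : ∀ x y → x ≢ y → hh x y ≡ not (hh y x)) (tG : IsTournament G)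
  (n : ℕ) (a₁ a₂ : ℕ → ℕ → Bool) (lab : ℕ → Lab) (pos : Vtx a (size G) → ℕ)
  (f : ∀ p → p < n → ∃ λ u → pos u ≡ p)
  (lab-hd : ∀ x → lab (pos (hd x)) ≡ L (toℕ x)) (lab-tl : ∀ g → lab (pos (tl g)) ≡ R (toℕ g)) (lab-ins : lab (pos ins) ≡ L a)
  (a₁-hd : ∀ x y → a₁ (toℕ x) (toℕ y) ≡ hh x y) (a₂-tl : ∀ g k → a₂ (toℕ g) (toℕ k) ≡ arc G g k)
  (a₁-ins : ∀ x → a₁ (toℕ x) a ≡ not (eqFin x β) × a₁ a (toℕ x) ≡ eqFin x β) (a₁-refl : a₁ a a ≡ false)
  (hd-tl : ∀ x g → pos (hd x) < pos (tl g))
  (tl-ins : ∀ g → (toℕ g <ᵇ s) ≡ (pos (tl g) <ᵇ pos ins) × not (toℕ g <ᵇ s) ≡ (pos ins <ᵇ pos (tl g))) where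
  open Pattern hh β G s hh-irrefl hh-anti tG

  private
    arc-pos : ∀ u v → labelArc a₁ a₂ (lab (pos u)) (lab (pos v)) (pos u) (pos v) ≡ h u v
    arc-pos (hd x) (hd y) rewrite lab-hd x | lab-hd y = a₁-hd x y
    arc-pos (hd x) (tl g) rewrite lab-hd x | lab-tl g = <⇒<ᵇ-true (hd-tl x g)
    arc-pos (hd x) ins rewrite lab-hd x | lab-ins = proj₁ (a₁-ins x)
    arc-pos (tl g) (hd x) rewrite lab-hd x | lab-tl g = ≮⇒<ᵇ-false (<⇒≯ (hd-tl x g))
    arc-pos (tl g) (tl k) rewrite lab-tl g | lab-tl k = a₂-tl g k
    arc-pos (tl g) ins rewrite lab-tl g | lab-ins = sym (proj₁ (tl-ins g))
    arc-pos ins (hd x) rewrite lab-hd x | lab-ins = proj₂ (a₁-ins x)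
    arc-pos ins (tl g) rewrite lab-tl g | lab-ins = sym (proj₂ (tl-ins g))
    arc-pos ins ins rewrite lab-ins = a₁-refl

    place : Fin n → U
    place i = proj₁ (f (toℕ i) (toℕ<n i))

    pos-place : ∀ i → pos (place i) ≡ toℕ i
    pos-place i = proj₂ (f (toℕ i) (toℕ<n i))

  presents : Presents (product n a₁ a₂ lab)
  presents = record
    { f = place
    ; f-inj = λ {i} {j} e → toℕ-injective (trans (sym (pos-place i)) (trans (cong pos e) (pos-place j)))
    ; arc-f = λ i j → trans (product-arc n a₁ a₂ lab i j)
        (trans (cong₂ (λ p q → labelArc a₁ a₂ (lab p) (lab q) p q) (sym (pos-place i)) (sym (pos-place j)))
          (arc-pos (place i) (place j)))
    }

headArc : ∀ a → (ℕ → ℕ → Bool) → Fin a → Fin a → Bool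
headArc a back x y = ordArc back (toℕ x) (toℕ y)

headArc-irrefl : ∀ {a} back (x : Fin a) → headArc a back x x ≡ false
headArc-irrefl back x = ordArc-irrefl back (toℕ x)

headArc-anti : ∀ {a} back (x y : Fin a) → x ≢ y → headArc a back x y ≡ not (headArc a back y x)
headArc-anti back x y ne = ordArc-anti back (toℕ x) (toℕ y) (ne ∘ toℕ-injective)

arcℕ-toℕ : ∀ G (g k : Fin (size G)) → arcℕ G (toℕ g) (toℕ k) ≡ arc G g k
arcℕ-toℕ G g k with toℕ g <? size G | toℕ k <? size G
... | yes p | yes q = cong₂ (arc G) (fromℕ<-toℕ g p) (fromℕ<-toℕ k q)
... | yes _ | no ¬q = ⊥-elim (¬q (toℕ<n k))
... | no ¬p | _ = ⊥-elim (¬p (toℕ<n g))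

module RightPseudogalaxy (G : Digraph) (tG : IsTournament G) (s : ℕ) (s≤r : s ≤ size G) where

  hh : Fin 6 → Fin 6 → Bool
  hh = headArc 6 backHl

  -- `ins` is h₇, and `# 4` is h₅, the other end of its backward edge.
  open Pattern hh (# 4) G s (headArc-irrefl backHl) (headArc-anti backHl) tG public

  private
    tailPos : ℕ → ℕ
    tailPos k = if k <ᵇ s then 6 + k else 7 + k

    pos : Vtx 6 (size G) → ℕ
    pos (hd x) = toℕ x
    pos (tl g) = tailPos (toℕ g)
    pos ins    = 6 + s

    lab-tail : ∀ k → labRPG s (tailPos k) ≡ R k
    lab-tail k with k <ᵇ s in e
    ... | true rewrite e = refl
    ... | false rewrite ≮⇒<ᵇ-false {suc k} {s} (λ lt → <ᵇ-false⇒≮ e (<-trans (n<1+n k) lt))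
                      | ≢⇒≡ᵇ-false {suc k} {s} (λ eq → <ᵇ-false⇒≮ e (subst (k <_) eq (n<1+n k))) = refl

    lab-ins : labRPG s (6 + s) ≡ L 6
    lab-ins rewrite ≮⇒<ᵇ-false (<-irrefl {s} refl) | ≡ᵇ-refl s = refl

    find : ∀ p → p < 7 + size G → ∃ λ u → pos u ≡ p
    find p lt with p <? 6
    ... | yes p<6 = hd (fromℕ< p<6) , toℕ-fromℕ< p<6
    ... | no p≮6 = subst (λ p → ∃ λ u → pos u ≡ p) (m+[n∸m]≡n (≮⇒≥ p≮6)) (tail (p ∸ 6) (+-cancelˡ-≤ 6 _ _
            (subst (_≤ 7 + size G) (trans (cong suc (sym (m+[n∸m]≡n (≮⇒≥ p≮6)))) (sym (+-suc 6 (p ∸ 6)))) lt)))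
      where
      at : ∀ k (lt : k < size G) p → tailPos k ≡ p → ∃ λ u → pos u ≡ p
      at k lt p e = tl (fromℕ< lt) , trans (cong tailPos (toℕ-fromℕ< lt)) e
      tail : ∀ k → k < suc (size G) → ∃ λ u → pos u ≡ 6 + k
      tail k k≤ with <-cmp k s
      ... | tri< k<s _ _ = at k (<-≤-trans k<s s≤r) (6 + k) (cong (λ b → if b then 6 + k else 7 + k) (<⇒<ᵇ-true k<s))
      ... | tri≈ _ refl _ = ins , refl
      tail (suc k) (s≤s k<) | tri> _ _ (s≤s s≤k) =
        at k k< (7 + k) (cong (λ b → if b then 6 + k else 7 + k) (≮⇒<ᵇ-false (≤⇒≯ s≤k)))

    hd-tl : ∀ (x : Fin 6) k → toℕ x < tailPos k
    hd-tl x k with k <ᵇ s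
    ... | true = <-≤-trans (toℕ<n x) (m≤m+n 6 k)
    ... | false = <-≤-trans (toℕ<n x) (≤-trans (n≤1+n 6) (m≤m+n 7 k))

    tl-ins : ∀ k → (k <ᵇ s) ≡ (tailPos k <ᵇ 6 + s) × not (k <ᵇ s) ≡ (6 + s <ᵇ tailPos k)
    tl-ins k with k <ᵇ s in e
    ... | true = sym e , sym (≮⇒<ᵇ-false (<⇒≯ (<ᵇ⇒< k s (≡true⇒T e))))
    ... | false = sym (≮⇒<ᵇ-false {suc k} {s} λ lt → <ᵇ-false⇒≮ {k} {s} e (<-trans (n<1+n k) lt)) , sym (<⇒<ᵇ-true {s} {suc k} (s≤s (≮⇒≥ (<ᵇ-false⇒≮ {k} {s} e))))

    lab-hd : ∀ (x : Fin 6) → labRPG s (toℕ x) ≡ L (toℕ x)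
    lab-hd x rewrite <⇒<ᵇ-true (toℕ<n x) = refl

    ins-arc : ∀ (x : Fin 6) → ordArc backHl (toℕ x) 6 ≡ not (eqFin x (# 4)) × ordArc backHl 6 (toℕ x) ≡ eqFin x (# 4)
    ins-arc fz = refl , refl
    ins-arc (fs fz) = refl , refl
    ins-arc (fs (fs fz)) = refl , refl
    ins-arc (fs (fs (fs fz))) = refl , refl
    ins-arc (fs (fs (fs (fs fz)))) = refl , refl
    ins-arc (fs (fs (fs (fs (fs fz))))) = refl , refl

  presents : Presents (rightPseudogalaxy s G)
  presents = Presentation.presents hh (# 4) G s (headArc-irrefl backHl) (headArc-anti backHl) tG
    (7 + size G) (ordArc backHl) (arcℕ G) (labRPG s) pos find lab-hd (λ g → lab-tail (toℕ g)) lab-ins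
    (λ _ _ → refl) (arcℕ-toℕ G) ins-arc refl (λ x g → hd-tl x (toℕ g)) (λ g → tl-ins (toℕ g))

-- Positions matter only for arcs between the two factors, and there just p₁ precedes h₆. So `s` is
-- 1, and the tail keeps the numbering of `P`, although the chain interleaves its vertices. `ins` is
-- h₆, attached to h₃.
module C5Chain (t : ℕ) where
  open MatchingGalaxy t

  hh : Fin 5 → Fin 5 → Bool
  hh = headArc 5 backHl'

  open Pattern hh (# 2) P 1 (headArc-irrefl backHl') (headArc-anti backHl') tP public

  private
    tailPos : ℕ → ℕ
    tailPos zero = 5
    tailPos (suc k) = if isOdd k then 6 + k else 8 + k

    pos : Vtx 5 (suc (2 * t)) → ℕ
    pos (hd x) = toℕ x
    pos (tl g) = tailPos (toℕ g)
    pos ins    = 6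

    lab-tail : ∀ k → labC5 (tailPos k) ≡ R k
    lab-tail zero = refl
    lab-tail (suc zero) = refl
    lab-tail (suc (suc k)) with isOdd k in e
    ... | true rewrite e = refl
    ... | false rewrite e = refl

    find : ∀ p → p < 7 + 2 * t → ∃ λ u → pos u ≡ p
    find 0 _ = hd (# 0) , refl
    find 1 _ = hd (# 1) , refl
    find 2 _ = hd (# 2) , refl
    find 3 _ = hd (# 3) , refl
    find 4 _ = hd (# 4) , refl
    find 5 _ = tl fz , refl
    find 6 _ = ins , refl
    find (suc (suc (suc (suc (suc (suc (suc k))))))) (s≤s (s≤s (s≤s (s≤s (s≤s (s≤s (s≤s lt))))))) = tail k lt (isOdd k) refl
      where
      at : ∀ k (lt : k < suc (2 * t)) p → tailPos k ≡ p → ∃ λ u → pos u ≡ p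
      at k lt p e = tl (fromℕ< lt) , trans (cong tailPos (toℕ-fromℕ< lt)) e
      tail : ∀ k → k < 2 * t → ∀ b → isOdd k ≡ b → ∃ λ u → pos u ≡ 7 + k
      tail (suc k) lt true e = at (suc k) (m≤n⇒m≤1+n lt) _ (cong (λ b → if b then 6 + k else 8 + k) (not-true e))
      -- For even `k`, position `7 + k` carries index `k + 2`; this is in range since k + 1 is odd
      -- and hence differs from `2 * t`.
      tail k lt false e = at (2 + k) (s≤s (≤∧≢⇒< lt odd≢)) _ (cong (λ b → if not b then 7 + k else 9 + k) e)
        where
        odd≢ : suc k ≢ 2 * t
        odd≢ eq with () ← trans (sym (cong not e)) (trans (cong isOdd eq) (isOdd-2* t))

    5≤tail : ∀ k → 5 ≤ tailPos k
    5≤tail zero = ≤-refl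
    5≤tail (suc k) with isOdd k
    ... | true = ≤-trans (n≤1+n 5) (m≤m+n 6 k)
    ... | false = ≤-trans (m≤m+n 5 3) (m≤m+n 8 k)

    tl-ins : ∀ k → (k <ᵇ 1) ≡ (tailPos k <ᵇ 6) × not (k <ᵇ 1) ≡ (6 <ᵇ tailPos k)
    tl-ins zero = refl , refl
    tl-ins (suc zero) = refl , refl
    tl-ins (suc (suc k)) with isOdd k
    ... | true = refl , refl
    ... | false = refl , refl

    lab-hd : ∀ (x : Fin 5) → labC5 (toℕ x) ≡ L (toℕ x)
    lab-hd x rewrite <⇒<ᵇ-true (toℕ<n x) = refl

    ins-arc : ∀ (x : Fin 5) → ordArc backHl' (toℕ x) 5 ≡ not (eqFin x (# 2)) × ordArc backHl' 5 (toℕ x) ≡ eqFin x (# 2)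
    ins-arc fz = refl , refl
    ins-arc (fs fz) = refl , refl
    ins-arc (fs (fs fz)) = refl , refl
    ins-arc (fs (fs (fs fz))) = refl , refl
    ins-arc (fs (fs (fs (fs fz)))) = refl , refl

  presents : Presents (c5Chain t)
  presents = Presentation.presents hh (# 2) P 1 (headArc-irrefl backHl') (headArc-anti backHl') tP
    (7 + 2 * t) (ordArc backHl') (ordArc backP) labC5 pos find lab-hd (λ g → lab-tail (toℕ g)) refl
    (λ _ _ → refl) (λ _ _ → refl) ins-arc refl
    (λ x g → <-≤-trans (toℕ<n x) (5≤tail (toℕ g))) (λ g → tl-ins (toℕ g))

-- Right pseudogalaxies

module EmbedRightPseudogalaxy {T q} (crit : Critical T q) (G : Digraph) (tG : IsTournament G)
  (ctr : Fin (size G) → Fin (size G)) (stars : StarStructure G ctr) (s : ℕ) (s≤r : s ≤ size G)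
  (layout : Layout G ctr s) (ins-odd : isOdd (Layout.insBlk layout) ≡ true)
  (D : Digraph) (tD : IsTournament D) (noD : ¬ Contains T D)
  (presents : Pattern.Presents (headArc 6 backHl) (# 4) G s (headArc-irrefl backHl) (headArc-anti backHl) tG D)
  {m W N C E : ℕ} (m≡ : m ≡ length (vertices 6 (size G))) (W≥6 : 2 * size G + 6 ≤ W)
  (N≥ : 10 + 2 * Layout.len layout + Layout.len layout ≤ N)
  (ar : Slots.Arena crit D tD noD m W N C E) where
    open CriticalFacts crit
    open Layout layout using (len; insBlk; insBlk<len; 1≤insBlk)

    hh : Fin 6 → Fin 6 → Bool
    hh = headArc 6 backHl

    private
      W≥ : 2 * size G + 1 ≤ W
      W≥ = ≤-trans (+-monoʳ-≤ (2 * size G) (s≤s z≤n)) W≥6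

    -- The ordering h₂ h₄ h₁ h₅ h₃ h₆: a backward triangle {h₂,h₁,h₆} and the backward edges h₃h₄, h₇h₅.
    module Triangle (off : ℕ) (off-even : isOdd off ≡ false) (off≤N : off + len ≤ N) (hslot : Fin 6 → Slot)
      (hvalid : ∀ x → proj₁ (hslot x) < N × proj₂ (hslot x) ≤ W)
      (early : ∀ x → proj₁ (hslot x) < suc off)
      (o₃ : isOdd (proj₁ (hslot (# 2))) ≡ true) (e₄ : isOdd (proj₁ (hslot (# 3))) ≡ false)
      (e₅ : isOdd (proj₁ (hslot (# 4))) ≡ false) (4<3 : Before (hslot (# 3)) (hslot (# 2))) where

      hcomp : Fin 6 → ℕ
      hcomp = fin6 0 0 1 1 2 0

      open Placing.Placement crit D tD noD ar hh (# 4) G s (headArc-irrefl backHl) (headArc-anti backHl) tG ctr stars s≤r m≡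
        layout off 0 off-even off≤N W≥ hslot hcomp 3
      open Gadgets crit D tD noD ar (vertices 6 (size G)) vertices-complete m≡ h h-irrefl slot (valid hvalid) comp

      hcomp< : ∀ x → hcomp x < 3
      hcomp< = fin6 (s≤s z≤n) (s≤s z≤n) (s≤s (s≤s z≤n)) (s≤s (s≤s z≤n)) ≤-refl (s≤s z≤n)

      -- The slots are still variables here, so the check is left to the concrete arrangements,
      -- where `refl` proves it.
      module _ (hcompat : all (λ x → all (compatᵇ x) (allFin 6)) (allFin 6) ≡ true) where

        idx : Fin 3 → U
        idx = fin3 (hd (# 1)) (hd (# 0)) (hd (# 5))

        cls : Indexes idx 0
        cls = vtx (fin6 (λ _ → # 1 , refl) (λ _ → # 0 , refl) unequal unequal unequal (λ _ → # 2 , refl)) (λ _ → unequal) unequal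

        cls₁ : ∀ u → comp u ≡ 1 → u ≡ hd (# 3) ⊎ u ≡ hd (# 2)
        cls₁ = vtx (fin6 unequal unequal (λ _ → inj₂ refl) (λ _ → inj₁ refl) unequal unequal) (λ _ → unequal) unequal

        cls₂ : ∀ u → comp u ≡ 2 → u ≡ hd (# 4) ⊎ u ≡ ins
        cls₂ = vtx (fin6 unequal unequal unequal unequal (λ _ → inj₁ refl) unequal) (λ _ → unequal) (λ _ → inj₂ refl)

        gadgets : ∀ i → 1 ≤ i → i < 3 → Gadget hvalid i
        gadgets = just-1-2
          (edge (hd (# 3)) (hd (# 2)) refl e₄ (leaf o₃ (inj₂ (4<3 , refl , refl))) cls₁)
          (edge (hd (# 4)) ins refl e₅
            (leaf (trans (odd-off insBlk) ins-odd)
              (inj₂ (early-before hvalid hcompat (inj₁ ∘ early) (# 4) 1≤insBlk z≤n , refl , refl))) cls₂)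

        unrealizable : ∀ (φ : U → V) → Partial hvalid 1 φ → ⊥
        unrealizable φ part = absurd (realize hvalid hcompat (λ x → inj₁ (early x)) hcomp< 1 φ part (s≤s z≤n) gadgets)
          where
          absurd : Σ[ φ' ∈ (U → V) ] (∀ u v → arc T (φ' u) (φ' v) ≡ h u v) → ⊥
          absurd (φ' , φ'-arc) = noD (Pattern.Presents.embed presents tournament φ' φ'-arc)

        contradict : ∀ {x y z} → x ∈ St (hslot (# 1)) → y ∈ St (hslot (# 0)) → z ∈ St (hslot (# 5)) →
          Arc y x → Arc z y → Arc z x → ⊥
        contradict {x} {y} {z} x∈ y∈ z∈ yx zy zx = unrealizable (proj₁ started) (proj₂ started)
          where
          val : Fin 3 → V
          val = fin3 x y z
          val∈ : ∀ i → val i ∈ SU hvalid (idx i)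
          val∈ = fin3 x∈ y∈ z∈
          arcs : ∀ i i' → arc T (val i) (val i') ≡ h (idx i) (idx i')
          arcs = fin3 (fin3 (proj₁ tournament x) (Arc-asym yx) (Arc-asym zx))
                       (fin3 yx (proj₁ tournament y) (Arc-asym zy))
                       (fin3 zx zy (proj₁ tournament z))
          started : Σ[ φ ∈ (U → V) ] Partial hvalid 1 φ
          started = start idx cls val val∈ arcs

    private
      len≥1 : 1 ≤ len
      len≥1 = ≤-trans (s≤s z≤n) insBlk<len

      2len : ∀ {k} → k ≤ len → k ≤ 2 * len
      2len le = ≤-trans le (m≤n*m len 2)

      within : ∀ {b p} → b ≤ 10 → p ≤ 6 → b < N × p ≤ W
      within b≤ p≤ = ≤-trans (s≤s b≤) (≤-trans (≤-trans (≤-reflexive (+-comm 1 10)) (+-monoʳ-≤ 10 (2len len≥1)))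
                        (≤-trans (m≤m+n (10 + 2 * len) len) N≥)) ,
        ≤-trans p≤ (≤-trans (m≤n+m 6 (2 * size G)) W≥6)

      within! : ∀ b p → {_ : (b ≤ᵇ 10) ≡ true} → {_ : (p ≤ᵇ 6) ≡ true} → b < N × p ≤ W
      within! b p {eb} {ep} = within (≤ᵇ-true⇒≤ eb) (≤ᵇ-true⇒≤ ep)

      10≤N : 10 + len ≤ N
      10≤N = ≤-trans (+-monoʳ-≤ 10 (2len ≤-refl)) (≤-trans (m≤m+n (10 + 2 * len) len) N≥)

      ins-valid : 10 + insBlk < N × 2 * s + 0 ≤ W
      ins-valid = <-≤-trans (+-monoʳ-< 10 insBlk<len) 10≤N ,
        ≤-trans (+-mono-≤ (*-monoʳ-≤ 2 s≤r) z≤n) W≥6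

    -- Excludes the triangles that could obstruct the path; `a` will be the piece of h₂ or of h₄ in
    -- the main arrangement.
    module OuterTriangle (a : ℕ) (a≤ : a ≤ 6) where
      open Slots.Arena ar using (St)

      hslot : Fin 6 → Slot
      hslot = fin6 (3 , a) (0 , 0) (5 , 0) (2 , 0) (4 , 0) (10 , 0)

      hvalid : ∀ x → proj₁ (hslot x) < N × proj₂ (hslot x) ≤ W
      hvalid = fin6 (proj₁ (within! 3 0 {refl} {refl}) , proj₂ (within {0} z≤n a≤)) (within! 0 0 {refl} {refl}) (within! 5 0 {refl} {refl})
        (within! 2 0 {refl} {refl}) (within! 4 0 {refl} {refl}) (within! 10 0 {refl} {refl})

      early : ∀ x → proj₁ (hslot x) < 11
      early = fin6 (≤ᵇ-true⇒≤ {4} {11} refl) (≤ᵇ-true⇒≤ {1} {11} refl) (≤ᵇ-true⇒≤ {6} {11} refl)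
        (≤ᵇ-true⇒≤ {3} {11} refl) (≤ᵇ-true⇒≤ {5} {11} refl) ≤-refl

      open Triangle 10 refl 10≤N hslot hvalid early refl refl refl (inj₁ (≤ᵇ-true⇒≤ {3} {5} refl)) using (contradict)

      absurd : ∀ {x y z} → x ∈ St (0 , 0) → y ∈ St (3 , a) → z ∈ St (10 , 0) → Arc y x → Arc z y → Arc z x → ⊥
      absurd = contradict refl

    -- Excludes the triangles that could obstruct the two-sided star. They use the slot that `ins`
    -- has amid the tail, so here the whole tail moves to an even offset beyond that slot.
    module InnerTriangle where
      open Slots.Arena ar using (St)

      hslot : Fin 6 → Slot
      hslot = fin6 (6 , 0) (3 , 1) (9 , 0) (4 , 0) (8 , 0) (10 + insBlk , 2 * s + 0)

      hvalid : ∀ x → proj₁ (hslot x) < N × proj₂ (hslot x) ≤ W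
      hvalid = fin6 (within! 6 0 {refl} {refl}) (within! 3 1 {refl} {refl}) (within! 9 0 {refl} {refl})
        (within! 4 0 {refl} {refl}) (within! 8 0 {refl} {refl}) ins-valid

      off : ℕ
      off = 10 + 2 * len

      low : ∀ {b} → b ≤ 10 → b < suc off
      low b≤ = s≤s (≤-trans b≤ (m≤m+n 10 (2 * len)))

      early : ∀ x → proj₁ (hslot x) < suc off
      early = fin6 (low (≤ᵇ-true⇒≤ {6} {10} refl)) (low (≤ᵇ-true⇒≤ {3} {10} refl)) (low (≤ᵇ-true⇒≤ {9} {10} refl))
        (low (≤ᵇ-true⇒≤ {4} {10} refl)) (low (≤ᵇ-true⇒≤ {8} {10} refl)) (s≤s (+-monoʳ-≤ 10 (2len (<⇒≤ insBlk<len))))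

      open Triangle off (trans (isOdd-+ 10 (2 * len) refl) (isOdd-2* len)) N≥ hslot hvalid early refl refl refl
        (inj₁ (≤ᵇ-true⇒≤ {5} {9} refl)) using (contradict)

      absurd : ∀ {x y z} → x ∈ St (3 , 1) → y ∈ St (6 , 0) → z ∈ St (10 + insBlk , 2 * s + 0) → Arc y x → Arc z y → Arc z x → ⊥
      absurd = contradict refl

    -- The head in its own order: component 0 is the path h₄ - h₁ - h₆ - h₂, component 1 the star of
    -- h₅ with leaves h₃ and h₇ on either side.
    module Main where
      hslot : Fin 6 → Slot
      hslot = fin6 (0 , 0) (3 , 0) (3 , 1) (3 , 2) (6 , 0) (10 , 0)

      hvalid : ∀ x → proj₁ (hslot x) < N × proj₂ (hslot x) ≤ W
      hvalid = fin6 (within! 0 0 {refl} {refl}) (within! 3 0 {refl} {refl}) (within! 3 1 {refl} {refl})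
        (within! 3 2 {refl} {refl}) (within! 6 0 {refl} {refl}) (within! 10 0 {refl} {refl})

      hcomp : Fin 6 → ℕ
      hcomp = fin6 0 0 1 0 1 0

      early : ∀ x → proj₁ (hslot x) < 11
      early = fin6 (≤ᵇ-true⇒≤ {1} {11} refl) (≤ᵇ-true⇒≤ {4} {11} refl) (≤ᵇ-true⇒≤ {4} {11} refl)
        (≤ᵇ-true⇒≤ {4} {11} refl) (≤ᵇ-true⇒≤ {7} {11} refl) ≤-refl

      hcomp< : ∀ x → hcomp x < 2
      hcomp< = fin6 (s≤s z≤n) (s≤s z≤n) ≤-refl (s≤s z≤n) ≤-refl (s≤s z≤n)

      open Placing.Placement crit D tD noD ar hh (# 4) G s (headArc-irrefl backHl) (headArc-anti backHl) tG ctr stars s≤r m≡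
        layout 10 0 refl 10≤N W≥ hslot hcomp 2
      open Gadgets crit D tD noD ar (vertices 6 (size G)) vertices-complete m≡ h h-irrefl slot (valid hvalid) comp

      cls₀ : ∀ u → comp u ≡ 0 → u ≡ hd (# 0) ⊎ u ≡ hd (# 1) ⊎ u ≡ hd (# 3) ⊎ u ≡ hd (# 5)
      cls₀ = vtx (fin6 (λ _ → inj₁ refl) (λ _ → inj₂ (inj₁ refl)) unequal (λ _ → inj₂ (inj₂ (inj₁ refl))) unequal (λ _ → inj₂ (inj₂ (inj₂ refl)))) (λ _ → unequal) unequal

      cls₁ : ∀ u → comp u ≡ 1 → u ≡ hd (# 2) ⊎ u ≡ hd (# 4) ⊎ u ≡ ins
      cls₁ = vtx (fin6 unequal unequal (λ _ → inj₁ refl) unequal (λ _ → inj₂ (inj₁ refl)) unequal) (λ _ → unequal) (λ _ → inj₂ (inj₂ refl))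

      late : ∀ x → Before (hslot x) (10 + insBlk , 2 * s + 0)
      late x = inj₁ (<-≤-trans (early x) (≤-trans (≤-reflexive (+-comm 1 10)) (+-monoʳ-≤ 10 1≤insBlk)))

      noOuter : ∀ {x y v} → x ∈ St (0 , 0) → y ∈ St (3 , 0) ⊎ y ∈ St (3 , 2) → v ∈ St (10 , 0) → ⊤ →
                Arc y x → Arc v y → Arc v x → ⊥
      noOuter x∈ (inj₁ y∈) v∈ _ = OuterTriangle.absurd 0 z≤n x∈ y∈ v∈
      noOuter x∈ (inj₂ y∈) v∈ _ = OuterTriangle.absurd 2 (s≤s (s≤s z≤n)) x∈ y∈ v∈

      gadgets : ∀ i → 0 ≤ i → i < 2 → Gadget hvalid i
      gadgets = just-0-1
        (path (λ _ → ⊤) (hd (# 0)) (hd (# 1)) (hd (# 3)) (hd (# 5)) refl refl refl refl refl refl refl refl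
          (inj₁ (s≤s z≤n) , refl , refl) (inj₁ (s≤s z≤n) , refl , refl) (inj₁ (s≤s z≤n) , refl , refl)
          (refl , s≤s z≤n , refl , refl) (inj₁ (≤ᵇ-true⇒≤ {4} {10} refl) , refl , refl) (inj₁ (≤ᵇ-true⇒≤ {4} {10} refl) , refl , refl)
          cls₀ (λ {F} {X} lin _ _ → X , ⊆-refl , linear-mono (m≤m*n F 2) lin , λ _ → tt) noOuter)
        (middle (hd (# 2)) (hd (# 4)) ins refl refl refl refl refl (trans (odd-off insBlk) ins-odd)
          (inj₁ (≤ᵇ-true⇒≤ {4} {6} refl) , refl , refl) (late (# 4) , refl , refl) (late (# 2) , refl , refl) cls₁
          InnerTriangle.absurd)

      impossible : ⊥
      impossible = absurd (realize hvalid refl (λ x → inj₁ (early x)) hcomp< 0 (λ _ → apex) (empty-start) z≤n gadgets)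
        where
        absurd : Σ[ φ ∈ (U → V) ] (∀ u v → arc T (φ u) (φ v) ≡ h u v) → ⊥
        absurd (φ , φ-arc) = noD (Pattern.Presents.embed presents tournament φ φ-arc)

-- C₅-chains

module EmbedC5Chain {T q} (crit : Critical T q) (t : ℕ) (D : Digraph) (tD : IsTournament D) (noD : ¬ Contains T D)
  (presents : Pattern.Presents (headArc 5 backHl') (# 2) (MatchingGalaxy.P t) 1 (headArc-irrefl backHl') (headArc-anti backHl')
                (MatchingGalaxy.tP t) D)
  {m W N C E : ℕ} (m≡ : m ≡ length (vertices 5 (suc (2 * t)))) (W≥ : 2 * suc (2 * t) + 6 ≤ W)
  (N≥ : 8 + (4 + suc (2 * t)) ≤ N)
  (ar : Slots.Arena crit D tD noD m W N C E) where
    open CriticalFacts crit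
    open MatchingGalaxy t using (P; tP; ctr; stars; layout)

    hh : Fin 5 → Fin 5 → Bool
    hh = headArc 5 backHl'

    -- In the main arrangement h₆ is the linear end of its edge; in the triangle arrangements it
    -- lies in a chain.
    linearIns chainIns : Layout P ctr 1
    linearIns = layout 2 (inj₁ ≤-refl) (≤ᵇ-true⇒≤ {3} {4} refl) (s≤s z≤n)
    chainIns = layout 1 (inj₂ (refl , refl)) (≤ᵇ-true⇒≤ {2} {4} refl) ≤-refl

    private
      within : ∀ b p → {_ : (b ≤ᵇ 10) ≡ true} → {_ : (p ≤ᵇ 6) ≡ true} → b < N × p ≤ W
      within b p {eb} {ep} = ≤-trans (s≤s (≤ᵇ-true⇒≤ eb)) (≤-trans (≤-trans (≤ᵇ-true⇒≤ {11} {12} refl) (m≤m+n 12 (suc (2 * t)))) N≥) ,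
        ≤-trans (≤ᵇ-true⇒≤ ep) (≤-trans (m≤n+m 6 (2 * suc (2 * t))) W≥)

      W≥' : ∀ e → {_ : (suc e ≤ᵇ 6) ≡ true} → 2 * suc (2 * t) + suc e ≤ W
      W≥' e {le} = ≤-trans (+-monoʳ-≤ (2 * suc (2 * t)) (≤ᵇ-true⇒≤ le)) W≥

      low : ∀ b → {_ : (suc b ≤ᵇ 9) ≡ true} → b < 9
      low b {e} = ≤ᵇ-true⇒≤ e

      bef : ∀ b b' {p p'} → {e : (suc b ≤ᵇ b') ≡ true} → Before (b , p) (b' , p')
      bef b b' {e = e} = inj₁ (≤ᵇ-true⇒≤ e)

    -- The ordering h₁ h₃ h₅ h₂ h₄ p₁ h₆: a backward triangle {h₁,h₅,h₄} and the star of h₃ with leaves h₂, h₆.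
    module LateTriangle (b a : ℕ) (b<4 : b < 4) (a≤6 : a ≤ 6) where
      hslot : Fin 5 → Slot
      hslot = fin5 (b , a) (9 , 0) (4 , 0) (9 , 4) (6 , 0)

      hvalid : ∀ x → proj₁ (hslot x) < N × proj₂ (hslot x) ≤ W
      hvalid = fin5 (<-trans b<4 (proj₁ (within 4 0 {refl} {refl})) , ≤-trans a≤6 (proj₂ (within 0 6 {refl} {refl}))) (within 9 0 {refl} {refl})
        (within 4 0 {refl} {refl}) (within 9 4 {refl} {refl}) (within 6 0 {refl} {refl})

      hcomp : Fin 5 → ℕ
      hcomp = fin5 0 1 1 0 0

      hcomp< : ∀ x → hcomp x < 2
      hcomp< = fin5 (s≤s z≤n) ≤-refl ≤-refl (s≤s z≤n) (s≤s z≤n)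

      -- The shift 5 leaves pieces 0 to 4 of block 9 to h₂ and h₄.
      open Placing.Placement crit D tD noD ar hh (# 2) P 1 (headArc-irrefl backHl') (headArc-anti backHl') tP ctr stars (s≤s z≤n) m≡
        chainIns 8 5 refl N≥ (W≥' 5 {refl}) hslot hcomp 2
      open Gadgets crit D tD noD ar (vertices 5 (suc (2 * t))) vertices-complete m≡ h h-irrefl slot (valid hvalid) comp

      early : ∀ x → EarlyHead x
      early = fin5 (inj₁ (<-trans b<4 (low 4 {refl}))) (inj₂ (refl , s≤s z≤n)) (inj₁ (low 4 {refl})) (inj₂ (refl , ≤-refl)) (inj₁ (low 6 {refl}))

      idx : Fin 3 → U
      idx = fin3 (hd (# 0)) (hd (# 4)) (hd (# 3))

      cls : Indexes idx 0
      cls = vtx (fin5 (λ _ → # 0 , refl) unequal unequal (λ _ → # 2 , refl) (λ _ → # 1 , refl)) (λ _ → unequal) unequal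

      cls₁ : ∀ u → comp u ≡ 1 → u ≡ hd (# 2) ⊎ u ≡ hd (# 1) ⊎ u ≡ ins
      cls₁ = vtx (fin5 unequal (λ _ → inj₂ (inj₁ refl)) (λ _ → inj₁ refl) unequal unequal) (λ _ → unequal) (λ _ → inj₂ (inj₂ refl))

      gadgets : ∀ i → 1 ≤ i → i < 2 → Gadget hvalid i
      gadgets = just-1
        (twoLeaves (hd (# 2)) (hd (# 1)) ins refl refl
          (leaf refl (inj₂ (bef 4 9 {e = refl} , refl , refl))) (leaf refl (inj₂ (bef 4 9 {e = refl} , refl , refl)))
          (refl , s≤s z≤n , refl , refl) cls₁)

      module _ (hcompat : all (λ x → all (compatᵇ x) (allFin 5)) (allFin 5) ≡ true) where

        unrealizable : ∀ (φ : U → V) → Partial hvalid 1 φ → ⊥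
        unrealizable φ part = absurd (realize hvalid hcompat early hcomp< 1 φ part (s≤s z≤n) gadgets)
          where
          absurd : Σ[ φ' ∈ (U → V) ] (∀ u v → arc T (φ' u) (φ' v) ≡ h u v) → ⊥
          absurd (φ' , φ'-arc) = noD (Pattern.Presents.embed presents tournament φ' φ'-arc)

        contradict : ∀ {x y z} → x ∈ St (b , a) → y ∈ St (6 , 0) → z ∈ St (9 , 4) → Arc y x → Arc z y → Arc z x → ⊥
        contradict {x} {y} {z} x∈ y∈ z∈ yx zy zx = unrealizable (proj₁ started) (proj₂ started)
          where
          val : Fin 3 → V
          val = fin3 x y z
          val∈ : ∀ i → val i ∈ SU hvalid (idx i)
          val∈ = fin3 x∈ y∈ z∈
          arcs : ∀ i i' → arc T (val i) (val i') ≡ h (idx i) (idx i')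
          arcs = fin3 (fin3 (proj₁ tournament x) (Arc-asym yx) (Arc-asym zx))
                       (fin3 yx (proj₁ tournament y) (Arc-asym zy))
                       (fin3 zx zy (proj₁ tournament z))
          started : Σ[ φ ∈ (U → V) ] Partial hvalid 1 φ
          started = start idx cls val val∈ arcs

    -- The ordering h₅ h₂ h₄ h₁ h₃ p₁ h₆: a backward triangle {h₅,h₄,h₃} with h₆ attached to h₃, and the edge h₁h₂.
    module PendantTriangle (a : ℕ) (a≤6 : a ≤ 6) where
      hslot : Fin 5 → Slot
      hslot = fin5 (5 , 0) (2 , 0) (6 , 0) (3 , a) (0 , 0)

      hvalid : ∀ x → proj₁ (hslot x) < N × proj₂ (hslot x) ≤ W
      hvalid = fin5 (within 5 0 {refl} {refl}) (within 2 0 {refl} {refl})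
        (within 6 0 {refl} {refl}) (proj₁ (within 3 0 {refl} {refl}) , ≤-trans a≤6 (proj₂ (within 0 6 {refl} {refl}))) (within 0 0 {refl} {refl})

      hcomp : Fin 5 → ℕ
      hcomp = fin5 1 1 0 0 0

      hcomp< : ∀ x → hcomp x < 2
      hcomp< = fin5 ≤-refl ≤-refl (s≤s z≤n) (s≤s z≤n) (s≤s z≤n)

      -- With shift 2 the slot of h₆ becomes (9, 4), the same piece that holds h₄ in `LateTriangle`:
      -- one vertex of it can play either role.
      open Placing.Placement crit D tD noD ar hh (# 2) P 1 (headArc-irrefl backHl') (headArc-anti backHl') tP ctr stars (s≤s z≤n) m≡
        chainIns 8 2 refl N≥ (W≥' 2 {refl}) hslot hcomp 2
      open Gadgets crit D tD noD ar (vertices 5 (suc (2 * t))) vertices-complete m≡ h h-irrefl slot (valid hvalid) comp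

      early : ∀ x → EarlyHead x
      early = fin5 (inj₁ (low 5 {refl})) (inj₁ (low 2 {refl})) (inj₁ (low 6 {refl})) (inj₁ (low 3 {refl})) (inj₁ (low 0 {refl}))

      idx : Fin 4 → U
      idx = fin4 (hd (# 4)) (hd (# 3)) (hd (# 2)) ins

      cls : Indexes idx 0
      cls = vtx (fin5 unequal unequal (λ _ → # 2 , refl) (λ _ → # 1 , refl) (λ _ → # 0 , refl)) (λ _ → unequal) (λ _ → # 3 , refl)

      cls₁ : ∀ u → comp u ≡ 1 → u ≡ hd (# 1) ⊎ u ≡ hd (# 0)
      cls₁ = vtx (fin5 (λ _ → inj₂ refl) (λ _ → inj₁ refl) unequal unequal unequal) (λ _ → unequal) unequal

      gadgets : ∀ i → 1 ≤ i → i < 2 → Gadget hvalid i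
      gadgets = just-1
        (edge (hd (# 1)) (hd (# 0)) refl refl (leaf refl (inj₂ (bef 2 5 {e = refl} , refl , refl))) cls₁)

      unrealizable : ∀ (φ : U → V) → Partial hvalid 1 φ → ⊥
      unrealizable φ part = absurd (realize hvalid refl early hcomp< 1 φ part (s≤s z≤n) gadgets)
        where
        absurd : Σ[ φ' ∈ (U → V) ] (∀ u v → arc T (φ' u) (φ' v) ≡ h u v) → ⊥
        absurd (φ' , φ'-arc) = noD (Pattern.Presents.embed presents tournament φ' φ'-arc)

      contradict : ∀ {x y v z} → x ∈ St (0 , 0) → y ∈ St (3 , a) → v ∈ St (6 , 0) → z ∈ St (9 , 4) →
        Arc y x → Arc v y → Arc v x → Arc z v → Arc x z → Arc y z → ⊥
      contradict {x} {y} {v} {z} x∈ y∈ v∈ z∈ yx vy vx zv xz yz = unrealizable (proj₁ started) (proj₂ started)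
        where
        val : Fin 4 → V
        val = fin4 x y v z
        val∈ : ∀ i → val i ∈ SU hvalid (idx i)
        val∈ = fin4 x∈ y∈ v∈ z∈
        arcs : ∀ i i' → arc T (val i) (val i') ≡ h (idx i) (idx i')
        arcs = fin4 (fin4 (proj₁ tournament x) (Arc-asym yx) (Arc-asym vx) xz)
                     (fin4 yx (proj₁ tournament y) (Arc-asym vy) yz)
                     (fin4 vx vy (proj₁ tournament v) (Arc-asym zv))
                     (fin4 (Arc-asym xz) (Arc-asym yz) zv (proj₁ tournament z))
        started : Σ[ φ ∈ (U → V) ] Partial hvalid 1 φ
        started = start idx cls val val∈ arcs

    -- The head in its own order: component 0 is the path h₄ - h₁ - h₅ - h₂, component 1 the edge h₃
    -- - h₆.
    module Main where
      hslot : Fin 5 → Slot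
      hslot = fin5 (0 , 0) (3 , 0) (3 , 1) (3 , 2) (6 , 0)

      hvalid : ∀ x → proj₁ (hslot x) < N × proj₂ (hslot x) ≤ W
      hvalid = fin5 (within 0 0 {refl} {refl}) (within 3 0 {refl} {refl})
        (within 3 1 {refl} {refl}) (within 3 2 {refl} {refl}) (within 6 0 {refl} {refl})

      hcomp : Fin 5 → ℕ
      hcomp = fin5 0 0 1 0 0

      hcomp< : ∀ x → hcomp x < 2
      hcomp< = fin5 (s≤s z≤n) (s≤s z≤n) ≤-refl (s≤s z≤n) (s≤s z≤n)

      open Placing.Placement crit D tD noD ar hh (# 2) P 1 (headArc-irrefl backHl') (headArc-anti backHl') tP ctr stars (s≤s z≤n) m≡
        linearIns 8 0 refl N≥ (W≥' 0 {refl}) hslot hcomp 2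
      open Gadgets crit D tD noD ar (vertices 5 (suc (2 * t))) vertices-complete m≡ h h-irrefl slot (valid hvalid) comp

      early : ∀ x → EarlyHead x
      early = fin5 (inj₁ (low 0 {refl})) (inj₁ (low 3 {refl})) (inj₁ (low 3 {refl})) (inj₁ (low 3 {refl})) (inj₁ (low 6 {refl}))

      cls₀ : ∀ u → comp u ≡ 0 → u ≡ hd (# 0) ⊎ u ≡ hd (# 1) ⊎ u ≡ hd (# 3) ⊎ u ≡ hd (# 4)
      cls₀ = vtx (fin5 (λ _ → inj₁ refl) (λ _ → inj₂ (inj₁ refl)) unequal (λ _ → inj₂ (inj₂ (inj₁ refl))) (λ _ → inj₂ (inj₂ (inj₂ refl)))) (λ _ → unequal) unequal

      cls₁ : ∀ u → comp u ≡ 1 → u ≡ ins ⊎ u ≡ hd (# 2)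
      cls₁ = vtx (fin5 unequal unequal (λ _ → inj₂ refl) unequal unequal) (λ _ → unequal) (λ _ → inj₁ refl)

      -- The fourth vertex that is needed when the path runs into a triangle.
      Good : V → Set
      Good v = ∃ λ z → z ∈ St (9 , 4) × Arc z v

      v94 : 9 < N × 4 ≤ W
      v94 = within 9 4 {refl} {refl}

      refine : ∀ {F X} → Linear F X → (∀ {x} → x ∈ X → x ∈ St (6 , 0)) → F * 2 * (E * 2) ≤ q →
               Σ[ X' ∈ List V ] (X' ⊆ X × Linear (F * 2) X' × (∀ {x} → x ∈ X' → Good x))
      refine {F} lin inS room = refine-in {F} {E * 2} room (≤-trans 1≤D (m≤m*n E 2)) lin
        (longChain-mono (m≤m*n E 2) (St-chain refl v94))
        λ x∈ y∈ → before-disjoint (within 6 0 {refl} {refl}) v94 (bef 6 9 {e = refl}) (inS x∈) y∈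

      -- If both `x` and `y` have arcs to `z`, then `z` hangs on the triangle as a pendant vertex.
      -- Otherwise `z`, `v` and the vertex that receives an arc from `z` form a backward triangle
      -- ending in block 9.
      noTriangle : ∀ a → (a ≤ 6) → ∀ {x y v} → x ∈ St (0 , 0) → y ∈ St (3 , a) → v ∈ St (6 , 0) → Good v →
                   Arc y x → Arc v y → Arc v x → ⊥
      noTriangle a a≤6 {x} {y} {v} x∈ y∈ v∈ (z , z∈ , zv) yx vy vx = split
        (arc-or-back (within 0 0 {refl} {refl}) v94 (bef 0 9 {e = refl}) x∈ z∈)
        (arc-or-back (proj₁ (within 3 0 {refl} {refl}) , ≤-trans a≤6 (proj₂ (within 0 6 {refl} {refl}))) v94 (bef 3 9 {e = refl}) y∈ z∈)
        where
        split : Arc x z ⊎ Arc z x → Arc y z ⊎ Arc z y → ⊥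
        split (inj₁ xz) (inj₁ yz) = PendantTriangle.contradict a a≤6 x∈ y∈ v∈ z∈ yx vy vx zv xz yz
        split (inj₂ zx) _ = LateTriangle.contradict 0 0 (s≤s z≤n) z≤n refl x∈ v∈ z∈ vx zv zx
        split (inj₁ _) (inj₂ zy) = LateTriangle.contradict 3 a ≤-refl a≤6 refl y∈ v∈ z∈ vy zv zy

      noTri : ∀ {x y v} → x ∈ St (0 , 0) → y ∈ St (3 , 0) ⊎ y ∈ St (3 , 2) → v ∈ St (6 , 0) → Good v →
              Arc y x → Arc v y → Arc v x → ⊥
      noTri x∈ (inj₁ y∈) = noTriangle 0 z≤n x∈ y∈
      noTri x∈ (inj₂ y∈) = noTriangle 2 (s≤s (s≤s z≤n)) x∈ y∈

      gadgets : ∀ i → 0 ≤ i → i < 2 → Gadget hvalid i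
      gadgets = just-0-1
        (path Good (hd (# 0)) (hd (# 1)) (hd (# 3)) (hd (# 4)) refl refl refl refl refl refl refl refl
          (bef 0 3 {e = refl} , refl , refl) (bef 0 3 {e = refl} , refl , refl) (bef 0 6 {e = refl} , refl , refl)
          (refl , s≤s z≤n , refl , refl) (bef 3 6 {e = refl} , refl , refl) (bef 3 6 {e = refl} , refl , refl)
          cls₀ refine noTri)
        (edge ins (hd (# 2)) refl refl (leaf refl (inj₁ (bef 3 10 {e = refl} , refl , refl))) cls₁)

      impossible : ⊥
      impossible = absurd (realize hvalid refl early hcomp< 0 (λ _ → apex) (empty-start) z≤n gadgets)
        where
        absurd : Σ[ φ ∈ (U → V) ] (∀ u v → arc T (φ u) (φ v) ≡ h u v) → ⊥
        absurd (φ , φ-arc) = noD (Pattern.Presents.embed presents tournament φ φ-arc)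

-- The Erdős–Hajnal bound

lookup-AllPairs : ∀ {A : Set} {R : A → A → Set} {xs} → AllPairs R xs → ∀ {i j : Fin (length xs)} →
                  i F.< j → R (List.lookup xs i) (List.lookup xs j)
lookup-AllPairs {xs = _ ∷ xs} (r ∷ _) {fz} {fs j} _ = All.lookup r (∈-lookup {xs = xs} j)
lookup-AllPairs (_ ∷ rs) {fs i} {fs j} (s≤s lt) = lookup-AllPairs rs lt

lookup-≢ : ∀ {A : Set} {xs : List A} → AllPairs _≢_ xs → ∀ {i j : Fin (length xs)} → i ≢ j → List.lookup xs i ≢ List.lookup xs j
lookup-≢ u {i} {j} ne with <-cmp (toℕ i) (toℕ j)
... | tri< lt _ _ = lookup-AllPairs u lt
... | tri≈ _ e _ = ⊥-elim (ne (toℕ-injective e))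
... | tri> _ _ gt = lookup-AllPairs u gt ∘ sym

-- A chain of τ + 1 vertices already meets the bound, so in a counterexample `τ` limits all chains.
root : ∀ q n → 1 ≤ q → 1 ≤ n → Σ[ τ ∈ ℕ ] (τ ^ q < n × n ≤ suc τ ^ q)
root q n 1≤q 1≤n = down n (≤-trans (n≤1+n n) (≤-trans (≤-reflexive (sym (^-identityʳ (suc n)))) (^-monoʳ-≤ (suc n) 1≤q)))
  where
  down : ∀ b → n ≤ suc b ^ q → Σ[ τ ∈ ℕ ] (τ ^ q < n × n ≤ suc τ ^ q)
  down b le with b ^ q <? n
  ... | yes lt = b , lt , le
  down zero le | no ¬lt = ⊥-elim (¬lt (subst (_< n) (sym (0^ q 1≤q)) 1≤n))
    where
    0^ : ∀ q → 1 ≤ q → 0 ^ q ≡ 0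
    0^ (suc q) _ = refl
  down (suc b) le | no ¬lt = down b (≮⇒≥ ¬lt)

module _ (T : Digraph) (tT : IsTournament T) where
  open Arcs T tT

  -- Exhaustive search, which makes the bound decidable and the choice of a minimal counterexample
  -- constructive. `p` collects the out-neighbourhood conditions of the vertices chosen so far.
  chainOfLength? : ∀ k (p : V → Bool) → Dec (Σ[ ys ∈ List V ] (Chain ys × All (λ y → p y ≡ true) ys × length ys ≡ k))
  chainOfLength? zero p = yes ([] , [] , [] , refl)
  chainOfLength? (suc k) p with any? (λ v → (p v Bool.≟ true) ×-dec chainOfLength? k (λ y → arc T v y ∧ p y))
  ... | yes (v , pv , ys , c , a , l) =
        yes (v ∷ ys , All.map (λ e → proj₁ (∧-true⁻ e)) a ∷ c , pv ∷ All.map (λ {y} e → proj₂ (∧-true⁻ {arc T v y} e)) a , cong suc l)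
  ... | no none = no λ { (v ∷ ys , r ∷ c , pv ∷ a , refl) →
        none (v , pv , ys , c , All.zipWith (λ { (e₁ , e₂) → cong₂ _∧_ e₁ e₂ }) (r , a) , refl) }

HasLongChain : ℕ → Digraph → Set
HasLongChain q T = Σ[ ys ∈ List (Fin (size T)) ] (AllPairs (λ x y → arc T x y ≡ true) ys × size T ≤ length ys ^ q)

induced-tournament : ∀ {T} → IsTournament T → ∀ {k} (e : Fin k → Fin (size T)) →
  (∀ {i j} → i ≢ j → e i ≢ e j) → IsTournament (induced T e)
induced-tournament (irr , anti) e e-inj = (λ i → irr (e i)) , λ i j ne → anti (e i) (e j) (e-inj ne)

contains-induced : ∀ {T D k} (e : Fin k → Fin (size T)) → (∀ {i j} → i ≢ j → e i ≢ e j) →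
  Contains (induced T e) D → Contains T D
contains-induced e e-inj (φ , φ-inj , φ-arc) = e ∘ φ , inj , φ-arc
  where
  inj : Injective _≡_ _≡_ (e ∘ φ)
  inj {i} {j} eq with φ i F.≟ φ j
  ... | yes φ≡ = φ-inj φ≡
  ... | no ne = ⊥-elim (e-inj ne eq)

module MinimalCounterexample (D : Digraph) (q : ℕ) (4≤q : 4 ≤ q)
  (no-critical : ∀ T → Critical T q → ¬ Contains T D → ⊥) where

  private
    1≤q : 1 ≤ q
    1≤q = ≤-trans (s≤s z≤n) 4≤q

    mkCritical : ∀ {n} T → IsTournament T → size T ≡ suc (suc n) → ¬ Contains T D →
      (∀ T' → size T' < size T → IsTournament T' → ¬ Contains T' D → HasLongChain q T') →
      ∀ τ → τ ^ q < size T → (∀ {ys} → AllPairs (λ x y → arc T x y ≡ true) ys → length ys ≤ τ) → Critical T q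
    mkCritical {n} T@(record { arc = a }) tT refl noD smaller τ τ<n chain≤ = record
      { tournament = tT ; 4≤q = 4≤q ; τ = τ ; τ^q<n = τ<n
      ; base = base ; apex = fz
      -- Removing one of at least two vertices leaves at least half of them.
      ; base-large = ≤-trans (s≤s (≤-trans (m≤n+m (suc n) n) (≤-reflexive (cong (n +_) (sym (+-identityʳ (suc n)))))))
                             (≤-reflexive (cong (2 *_) (sym base-length)))
      ; base-uniq = base-uniq
      ; apex∉base = λ x∈ → fz∉ (∈-tabulate⁻ x∈)
      ; chain≤τ = chain≤
      ; subchain = subchain
      }
      where
      base : List (Fin (suc (suc n)))
      base = tabulate fs
      base-length : length base ≡ suc n
      base-length = length-tabulate fs
      base-uniq : AllPairs _≢_ base
      base-uniq = AllPairs.tabulate⁺ λ ne e → ne (F.suc-injective e)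
      fz∉ : ∀ {x} → (∃ λ i → x ≡ fs i) → fz ≢ x
      fz∉ (_ , refl) ()
      subchain : ∀ X → X ⊆ base → _
      subchain X X⊆ = transport (smaller (induced T (List.lookup X))
          (s≤s (≤-trans (length-mono-≤ X⊆) (≤-reflexive base-length)))
          (induced-tournament tT (List.lookup X) distinct) (noD ∘ contains-induced {T} {D} (List.lookup X) distinct))
        where
        distinct : ∀ {i j} → i ≢ j → List.lookup X i ≢ List.lookup X j
        distinct = lookup-≢ (AllPairs-resp-⊆ X⊆ base-uniq)
        transport : HasLongChain q (induced T (List.lookup X)) → Σ[ ys ∈ List (Fin (suc (suc n))) ]
          (AllPairs (λ x y → a x y ≡ true) ys × (∀ {y} → y ∈ ys → y ∈ X) × length X ≤ length ys ^ q)
        transport (ys , c , le) = map (List.lookup X) ys , AllPairs.map⁺ c , members ,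
          subst (λ l → length X ≤ l ^ q) (sym (length-map (List.lookup X) ys)) le
          where
          members : ∀ {y} → y ∈ map (List.lookup X) ys → y ∈ X
          members y∈ with ∈-map⁻ (List.lookup X) y∈
          ... | i , _ , refl = ∈-lookup {xs = X} i

    decide : ∀ n T → size T ≡ n → IsTournament T → ¬ Contains T D →
      (∀ T' → size T' < size T → IsTournament T' → ¬ Contains T' D → HasLongChain q T') → HasLongChain q T
    decide zero (record { size = zero }) refl tT noD smaller = [] , [] , z≤n
    decide (suc zero) (record { size = suc zero }) refl tT noD smaller =
      fz ∷ [] , [] ∷ [] , ≤-reflexive (sym (^-zeroˡ q))
    decide (suc (suc n)) T eq tT noD smaller = search (root q (size T) 1≤q (subst (1 ≤_) (sym eq) (s≤s z≤n)))
      where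
      search : Σ[ τ ∈ ℕ ] (τ ^ q < size T × size T ≤ suc τ ^ q) → HasLongChain q T
      search (τ , τ<n , n≤) with chainOfLength? T tT (suc τ) (λ _ → true)
      ... | yes (ys , c , _ , l) = ys , c , subst (λ l → size T ≤ l ^ q) (sym l) n≤
      ... | no none = ⊥-elim (no-critical T (mkCritical T tT eq noD smaller τ τ<n short) noD)
        where
        short : ∀ {ys} → AllPairs (λ x y → arc T x y ≡ true) ys → length ys ≤ τ
        short {ys} c with length ys ≤? τ
        ... | yes le = le
        ... | no ¬le = ⊥-elim (none (take (suc τ) ys , AllPairs.take⁺ (suc τ) c , All.universal (λ _ → refl) _ ,
                trans (length-take (suc τ) ys) (m≤n⇒m⊓n≡m (≰⇒> ¬le))))

    induction : ∀ T → Acc _<_ (size T) → IsTournament T → ¬ Contains T D → HasLongChain q T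
    induction T (acc rs) tT noD = decide (size T) T refl tT noD λ T' lt → induction T' (rs lt)

  hasLongChain : ∀ T → IsTournament T → ¬ Contains T D → HasLongChain q T
  hasLongChain T = induction T (<-wellFounded (size T))

complement-tournament : ∀ {T} → IsTournament T → IsTournament (complement T)
complement-tournament (irr , anti) = irr , λ i j ne → anti j i (ne ∘ sym)

-- A chain of the complement is listed against the arcs of T, so arcs of T decrease the position in the list.
module Conclude (H D : Digraph) (f : Fin (size H) → Fin (size D)) (f-inj : ∀ {i j} → f i ≡ f j → i ≡ j)
  (f-arc : ∀ i j → arc H i j ≡ arc D (f j) (f i)) (q : ℕ)
  (long : ∀ T → IsTournament T → ¬ Contains T D → HasLongChain q T) where

  transitive : ∀ T → IsTournament T → ¬ Contains T H → Σ[ k ∈ ℕ ] Σ[ e ∈ (Fin k → Fin (size T)) ]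
    (Injective _≡_ _≡_ e × Transitive (induced T e) × size T ^ 1 ≤ k ^ q)
  transitive T tT noH = build (long (complement T) (complement-tournament tT) noD)
    where
    noD : ¬ Contains (complement T) D
    noD (φ , φ-inj , φ-arc) = noH ((λ i → φ (f i)) , (λ eq → f-inj (φ-inj eq)) ,
      λ i j → trans (f-arc i j) (φ-arc (f j) (f i)))
    build : HasLongChain q (complement T) → Σ[ k ∈ ℕ ] Σ[ e ∈ (Fin k → Fin (size T)) ]
      (Injective _≡_ _≡_ e × Transitive (induced T e) × size T ^ 1 ≤ k ^ q)
    build (ys , c , le) = length ys , e , (λ {i} {j} → injective {i} {j}) , acyclic , subst (_≤ length ys ^ q) (sym (^-identityʳ (size T))) le
      where
      open Arcs T tT
      e : Fin (length ys) → V
      e = List.lookup ys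
      down : ∀ {i j} → i F.< j → Arc (e j) (e i)
      down = lookup-AllPairs c
      injective : Injective _≡_ _≡_ e
      injective {i} {j} eq with <-cmp (toℕ i) (toℕ j)
      ... | tri< lt _ _ = ⊥-elim (Arc⇒≢ (down lt) (sym eq))
      ... | tri≈ _ eq' _ = toℕ-injective eq'
      ... | tri> _ _ gt = ⊥-elim (Arc⇒≢ (down gt) eq)
      decreasing : ∀ {i j} → Arc (e i) (e j) → j F.< i
      decreasing {i} {j} a with <-cmp (toℕ i) (toℕ j)
      ... | tri< lt _ _ with () ← trans (sym a) (Arc-asym (down lt))
      ... | tri≈ _ eq _ = ⊥-elim (Arc⇒≢ a (cong e (toℕ-injective eq)))
      ... | tri> _ _ gt = gt
      acyclic : Transitive (induced T e)
      acyclic (k , c , _ , arcs) = descend fz (<-wellFounded (toℕ (c fz)))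
        where
        descend : ∀ i → Acc _<_ (toℕ (c i)) → ⊥
        descend i (acc rs) = descend (next i) (rs (decreasing (arcs i)))

module _ (G : Digraph) (tG : IsTournament G) (ctr : Fin (size G) → Fin (size G)) (stars : StarStructure G ctr)
         (s : ℕ) (s≤r : s ≤ size G) where
  open GalaxyLayout G ctr stars s using (layout; odd-1; centres)
  open RightPseudogalaxy G tG s s≤r using (presents)

  private
    D = rightPseudogalaxy s G
    m = length (vertices 6 (size G))
    W = 2 * size G + 6
    -- A stretch `2 * len` to step over the tail in `InnerTriangle`, and `len` for the tail itself.
    N = 10 + 2 * Layout.len layout + Layout.len layout

  -- The summand 4 supplies the `4 ≤ q` asked for by `Critical`, from which τ ≥ 2 follows.
  pseudogalaxyExponent : ℕ
  pseudogalaxyExponent = 4 + Constants.requirement (size D) m W N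

  rightPseudogalaxy-chain : ∀ T → IsTournament T → ¬ Contains T D → HasLongChain pseudogalaxyExponent T
  rightPseudogalaxy-chain = MinimalCounterexample.hasLongChain D pseudogalaxyExponent (m≤m+n 4 _) λ T crit noD →
    EmbedRightPseudogalaxy.Main.impossible crit G tG ctr stars s s≤r layout (odd-1 (centres s)) D tD noD
      presents refl ≤-refl ≤-refl (Slots.arena crit D tD noD m W N (m≤n+m _ 4))
    where
    tD : IsTournament D
    tD = Pattern.Presents.isTournament presents

module _ (t : ℕ) where
  open C5Chain t using (presents)

  private
    D = c5Chain t
    m = length (vertices 5 (suc (2 * t)))
    W = 2 * suc (2 * t) + 6
    N = 8 + (4 + suc (2 * t))

  c5ChainExponent : ℕ
  c5ChainExponent = 4 + Constants.requirement (size D) m W N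

  c5Chain-chain : ∀ T → IsTournament T → ¬ Contains T D → HasLongChain c5ChainExponent T
  c5Chain-chain = MinimalCounterexample.hasLongChain D c5ChainExponent (m≤m+n 4 _) λ T crit noD →
    EmbedC5Chain.Main.impossible crit t D tD noD
      presents refl ≤-refl ≤-refl (Slots.arena crit D tD noD m W N (m≤n+m _ 4))
    where
    tD : IsTournament D
    tD = Pattern.Presents.isTournament presents

theorem19 : (H : Digraph) → IsLeftPseudogalaxy H ⊎ IsC5CoChain H →
    Σ[ p ∈ ℕ ] Σ[ q ∈ ℕ ] (1 ≤ p × 1 ≤ q ×
    ((T : Digraph) → IsTournament T → ¬ Contains T H →
    Σ[ k ∈ ℕ ] Σ[ e ∈ (Fin k → Fin (size T)) ]
    (Injective _≡_ _≡_ e × Transitive (induced T e) × size T ^ p ≤ k ^ q)))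
theorem19 H (inj₁ (G , s , ctr , tG , stars , _ , s≤r , _ , f , g , gf , _ , f-arc)) =
  -- The exponent ε(H) is the reciprocal of this number.
  1 , pseudogalaxyExponent G tG ctr stars s s≤r , s≤s z≤n , s≤s z≤n ,
  Conclude.transitive H (rightPseudogalaxy s G) f (λ {i} {j} eq → trans (sym (gf i)) (trans (cong g eq) (gf j)))
    (λ i j → f-arc j i) (pseudogalaxyExponent G tG ctr stars s s≤r) (rightPseudogalaxy-chain G tG ctr stars s s≤r)
theorem19 H (inj₂ (t , f , g , gf , _ , f-arc)) =
  1 , c5ChainExponent t , s≤s z≤n , s≤s z≤n ,
  Conclude.transitive H (c5Chain t) f (λ {i} {j} eq → trans (sym (gf i)) (trans (cong g eq) (gf j)))
    f-arc (c5ChainExponent t) (c5Chain-chain t)
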